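{- Let $N\ge1$ and let $\Gamma_0(z),\Gamma_1(z),\Gamma_2(z)\in\mathrm{End}(V_1\otimes\cdots\otimes V_N)$ be the twisted column operators with parameters $(x_1,\dots,x_N)$. (a) For each $k\in\{0,1,2\}$, $\Gamma_k(z)=\Gamma_k(z;x_1,\dots,x_N)$ is invariant under simultaneous permutation of the alphabet $(x_1,\dots,x_N)$ and of the spaces $V_1,\dots,V_N$: writing $\langle\langle i_1,\dots,i_N\|\Gamma_k(z;x_1,\dots,x_N)\|j_1,\dots,j_N\rangle\rangle$ for its matrix entries, one has for every permutation $\sigma\in\mathfrak{S}_N$ $$\langle\langle i_{\sigma(1)},\dots,i_{\sigma(N)}\|\Gamma_k(z;x_{\sigma(1)},\dots,x_{\sigma(N)})\|j_{\sigma(1)},\dots,j_{\sigma(N)}\rangle\rangle=\langle\langle i_1,\dots,i_N\|\Gamma_k(z;x_1,\dots,x_N)\|j_1,\dots,j_N\rangle\rangle .$$ (b) The operators satisfy the exchange relations of the Yang--Baxter algebra of the Izergin--Korepin model: for all $k,\ell\in\{0,1,2\}$ and parameters $z,y$, $$\Gamma_k(z)\Gamma_\ell(y)=\sum_{i=0}^{2}\sum_{j=0}^{2}W_{z/y}(i,j;k,\ell)\,\Gamma_j(y)\Gamma_i(z).$$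
   Context: **Weights.** All parameters ($q$ and the spectral parameters) are generic/indeterminates. For $i,j,k,\ell\in\{0,1,2\}$ the Izergin--Korepin vertex weight $W_{y/x}(i,j;k,\ell)$ depends on $x,y$ only through $y/x$, and, with $D=(x-q^2y)(x-q^3y)$, is given by $W(0,0;0,0)=W(2,2;2,2)=1$; $W(1,0;1,0)=W(2,1;2,1)=\frac{q^2(x-y)}{x-q^2y}$; $W(1,0;0,1)=W(2,1;1,2)=\frac{(1-q^2)x}{x-q^2y}$; $W(0,1;1,0)=W(1,2;2,1)=\frac{(1-q^2)y}{x-q^2y}$; $W(0,1;0,1)=W(1,2;1,2)=\frac{x-y}{x-q^2y}$; $W(2,0;2,0)=\frac{q^4(x-y)(x-qy)}{D}$; $W(2,0;1,1)=-\frac{q(1-q)^2(1+q)x(x-y)}{D}$; $W(2,0;0,2)=\frac{(1-q^2)x(x+qx-qy-q^3y)}{D}$; $W(1,1;2,0)=-\frac{q^4(1+q)(x-y)y}{D}$; $W(1,1;1,1)=\frac{ -qx^2+(1+q)(1-q^2+q^4)xy-q^4y^2}{D}$; $W(1,1;0,2)=\frac{(1+q)x(x-y)}{D}$; $W(0,2;2,0)=\frac{(1-q^2)(x+q^2x-q^2y-q^3y)y}{D}$; $W(0,2;1,1)=\frac{q(1-q)^2(1+q)(x-y)y}{D}$; $W(0,2;0,2)=\frac{(x-y)(x-qy)}{D}$; and $W=0$ in all other cases. ($W_{z/y}$ is obtained by the substitution $x\mapsto y$, $y\mapsto z$.) **Local matrices.** $V_i\cong\mathbb{C}^3$ with basis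 indexed by $0,1,2$ (rows and columns of $3\times3$ matrices are indexed in this order); a subscript $i$ means the matrix acts on $V_i$ and as the identity on the other factors. Let $E_i^{a,b}$ denote the elementary matrix with a 1 in row $a$, column $b$, acting on $V_i$. Diagonal matrices: $d_i(z)=\mathrm{diag}\left(1,\frac{x_i-z}{x_i-q^2z},\frac{(x_i-z)(x_i-qz)}{(x_i-q^2z)(x_i-q^3z)}\right)_i$, $d_i^{\circ}(z)=\mathrm{diag}\left(1,\frac{(qx_i-z)(x_i-q^2z)}{(1+q)(x_i-z)},\frac{x_i-q^3z}{x_i-qz}\right)_i$, $d_i^{\bullet}(z)=\mathrm{diag}\left(1,\frac{1+q}{qx_i-z},\frac{x_i-q^2z}{x_i-z}\right)_i$, $d_i^{\bullet\circ}(z)=\mathrm{diag}\left(1,\frac{x_i-q^2z}{x_i-z},\frac{(x_i-q^2z)(x_i-q^3z)}{(x_i-z)(x_i-qz)}\right)_i$. Non-diagonal matrices: $e_i^{\circ}(z)=\frac{(1-q^2)z}{x_i-q^2z}E_i^{1,0}$, $e_i^{\bullet}(z)=\frac{q(1-q)^2(1+q)(x_i-z)z}{(x_i-q^2z)(x_i-q^3z)}E_i^{2,1}$, $e_i^{\bullet\circ}(z)=\frac{(1-q^2)(x_i+q^2x_i-q^2z-q^3z)z}{(x_i-q^2z)(x_i-q^3z)}E_i^{2,0}$. For $i\ne j$: $e_{ij}^{\circ\circ}(z)=\frac{x_ix_j+q^2x_ix_j-q^2x_iz-q^2x_jz}{(1-q^2)z}e_i^{\circ}(z)e_j^{\circ}(z)$,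 $e_{ij}^{\bullet\circ}(z)=e_{ji}^{\circ\bullet}(z)=\frac{x_ix_j+q^2x_ix_j-q^2x_iz-q^3x_jz}{q(1-q)(x_i-x_j)z}e_i^{\bullet}(z)e_j^{\circ}(z)$, $e_{ij}^{\bullet\bullet}(z)=\frac{(1+q)(x_ix_j+q^2x_ix_j-q^3x_iz-q^3x_jz)}{q(1-q)(x_i-qx_j)(x_j-qx_i)z}e_i^{\bullet}(z)e_j^{\bullet}(z)$. **Twisted column operators.** $$\Gamma_0(z)=\prod_{i=1}^{N}d_i(z),\qquad \Gamma_1(z)=\sum_{u\in\{\circ,\bullet\}}\sum_{i=1}^{N}e_i^{u}(z)\prod_{j\ne i}d_j(z)d_j^{u}(x_i),$$ $$\Gamma_2(z)=\sum_{i=1}^{N}e_i^{\bullet\circ}(z)\prod_{j\ne i}d_j(z)d_j^{\bullet\circ}(x_i)+\sum_{u,v\in\{\circ,\bullet\}}\ \sum_{1\le i<j\le N}e_{ij}^{uv}(z)\prod_{k\ne i,j}d_k(z)d_k^{u}(x_i)d_k^{v}(x_j).$$ -}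

module Defs where

open import Level using (_⊔_)
open import Algebra.Apartness.Bundles using (HeytingField; HeytingCommutativeRing)
open import Algebra.Bundles using (CommutativeRing; Semiring)
import Algebra.Apartness.Properties.HeytingCommutativeRing as HeytingProperties
import Algebra.Definitions.RawSemiring as RawSemiringDefinitions
open import Data.Fin.Base using (Fin; _<_)
open import Data.Fin.Patterns using (0F; 1F; 2F)
open import Data.Fin.Permutation using (Permutation′; _⟨$⟩ʳ_)
open import Data.Fin.Properties using (_≟_; _<?_; <⇒≢)
open import Data.Nat.Base using (ℕ; zero; suc)
open import Data.Product.Base using (_,_; proj₁)
open import Data.Vec.Base using (Vec; []; _∷_; lookup; tabulate)
open import Data.Vec.Functional using (foldr)
open import Function.Base using (_∘_)
open import Function.Bundles using (Injection)
open import Function.Properties.Inverse using (Inverse⇒Injection)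
open import Relation.Binary.PropositionalEquality.Core using (_≡_; _≢_; ≢-sym)
open import Relation.Nullary.Decidable.Core using (Dec; yes; no)
open import Relation.Nullary.Negation.Core using (¬_)

-- A basis vector of V₁ ⊗ ⋯ ⊗ V_N.
State : ℕ → Set
State N = Vec (Fin 3) N

-- (s₁,…,s_N) ↦ (s_σ(1),…,s_σ(N))
permuteState : ∀ {N} → Permutation′ N → State N → State N
permuteState σ s = tabulate (λ k → lookup s (σ ⟨$⟩ʳ k))

⟨$⟩ʳ-≢ : ∀ {N} (σ : Permutation′ N) {i j} → i ≢ j → σ ⟨$⟩ʳ i ≢ σ ⟨$⟩ʳ j
⟨$⟩ʳ-≢ σ i≢j = i≢j ∘ Injection.injective (Inverse⇒Injection σ)

data Decoration : Set where
  ○ ● : Decoration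

module FieldNotation {c ℓ₁ ℓ₂} (F : HeytingField c ℓ₁ ℓ₂) where

  open HeytingField F public
  open HeytingProperties heytingCommutativeRing public
    using (x#0y#0→xy#0; x-0≈x; invertibleˡ⇒#)
  open HeytingCommutativeRing heytingCommutativeRing public
    using (commutativeRing)
  open Semiring (CommutativeRing.semiring commutativeRing) public using (rawSemiring)
  open RawSemiringDefinitions rawSemiring public using (_^_; sum; product)

  infixl 7 _/_⟨_⟩
  _/_⟨_⟩ : (a b : Carrier) → b # 0# → Carrier
  a / b ⟨ b#0 ⟩ = a * proj₁ (#⇒invertible b#0)

  x#y⇒x-y#0 : ∀ {x y} → x # y → x - y # 0#
  x#y⇒x-y#0 x#y with #⇒invertible x#y
  ... | inv , inv*[x-y]≈1 , _ =
    invertibleˡ⇒# (inv , trans (*-congˡ (x-0≈x _)) inv*[x-y]≈1)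

-- Matrices on (K³)^⊗N, with rows and columns indexed by `State N`.
module Operators {c ℓ₁ ℓ₂} (F : HeytingField c ℓ₁ ℓ₂) where

  open FieldNotation F

  Mat₃ : Set c
  Mat₃ = Fin 3 → Fin 3 → Carrier

  elementary : Fin 3 → Fin 3 → Mat₃
  elementary a b r s with a ≟ r | b ≟ s
  ... | yes _ | yes _ = 1#
  ... | _     | _     = 0#

  diag : Carrier → Carrier → Carrier → Mat₃
  diag a b c 0F 0F = a
  diag a b c 1F 1F = b
  diag a b c 2F 2F = c
  diag a b c _  _  = 0#

  I₃ : Mat₃
  I₃ = diag 1# 1# 1#

  scale₃ : Carrier → Mat₃ → Mat₃
  scale₃ a m r s = a * m r s

  Op : ℕ → Set c
  Op N = State N → State N → Carrier

  infix 4 _≈ᴼ_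
  _≈ᴼ_ : ∀ {N} → Op N → Op N → Set ℓ₁
  A ≈ᴼ B = ∀ s t → A s t ≈ B s t

  sumStates : ∀ {N} → (State N → Carrier) → Carrier
  sumStates {zero}  f = f []
  sumStates {suc N} f = sum {3} (λ a → sumStates (λ s → f (a ∷ s)))

  infixl 6 _⊕_
  infixl 7 _⊙_
  infixr 8 _·_

  _⊕_ : ∀ {N} → Op N → Op N → Op N
  (A ⊕ B) s t = A s t + B s t

  _⊙_ : ∀ {N} → Op N → Op N → Op N
  (A ⊙ B) s t = sumStates (λ r → A s r * B r t)

  _·_ : ∀ {N} → Carrier → Op N → Op N
  (a · A) s t = a * A s t

  ⨂ : ∀ {N} → (Fin N → Mat₃) → Op N
  ⨂ M s t = product (λ k → M k (lookup s k) (lookup t k))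

  𝟘 : ∀ {N} → Op N
  𝟘 s t = 0#

  𝟙 : ∀ {N} → Op N
  𝟙 = ⨂ (λ _ → I₃)

  -- The subscript notation m_i: m acts on V_i, the identity elsewhere.
  infix 9 _at_
  _at_ : ∀ {N} → Mat₃ → Fin N → Op N
  m at i = ⨂ (λ k → local (k ≟ i))
    where
    local : ∀ {k} → Dec (k ≡ i) → Mat₃
    local (yes _) = m
    local (no  _) = I₃

  ∑ᴼ : ∀ {N n} → (Fin n → Op N) → Op N
  ∑ᴼ = foldr _⊕_ 𝟘

  -- Ordered product; all products below are of commuting operators.
  ∏ᴼ : ∀ {N n} → (Fin n → Op N) → Op N
  ∏ᴼ = foldr _⊙_ 𝟙

  sumIf : ∀ {N p} {P : Set p} → Dec P → (P → Op N) → Op N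
  sumIf (yes p) f = f p
  sumIf (no  _) f = 𝟘

  mulUnless : ∀ {N p} {P : Set p} → Dec P → (¬ P → Op N) → Op N
  mulUnless (yes _)  f = 𝟙
  mulUnless (no  ¬p) f = f ¬p

  ∑-decorations : ∀ {N} → (Decoration → Op N) → Op N
  ∑-decorations f = f ○ ⊕ f ●

-- The parameters are generic: they are arbitrary elements of a field at which
-- no denominator in the formulas below vanishes.
module _ {c ℓ₁ ℓ₂} (F : HeytingField c ℓ₁ ℓ₂) where

  open FieldNotation F

  record GenericQ (q : Carrier) : Set ℓ₂ where
    field
      q#0   : q # 0#
      1#q   : 1# # q
      1#q²  : 1# # q ^ 2
      1+q#0 : 1# + q # 0#

  record Alphabet (q : Carrier) (N : ℕ) : Set (c ⊔ ℓ₂) where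
    field
      letter    : Fin N → Carrier
      distinct   : ∀ {i j} → i ≢ j → letter i # letter j
      q-distinct : ∀ {i j} → i ≢ j → letter i # q * letter j

  open Alphabet

  record GenericSpectral {q N} (x : Alphabet q N) (z : Carrier) : Set ℓ₂ where
    field
      z#0   : z # 0#
      x#q²z : ∀ i → letter x i # q ^ 2 * z
      x#q³z : ∀ i → letter x i # q ^ 3 * z

  permuteAlphabet : ∀ {q N} → Permutation′ N → Alphabet q N → Alphabet q N
  permuteAlphabet σ x = record
    { letter     = λ k → letter x (σ ⟨$⟩ʳ k)
    ; distinct   = λ i≢j → distinct x (⟨$⟩ʳ-≢ σ i≢j)
    ; q-distinct = λ i≢j → q-distinct x (⟨$⟩ʳ-≢ σ i≢j)
    }

  permuteGeneric : ∀ {q N} (σ : Permutation′ N) {x : Alphabet q N} {z} →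
                   GenericSpectral x z → GenericSpectral (permuteAlphabet σ x) z
  permuteGeneric σ g = record
    { z#0   = z#0
    ; x#q²z = λ i → x#q²z (σ ⟨$⟩ʳ i)
    ; x#q³z = λ i → x#q³z (σ ⟨$⟩ʳ i)
    }
    where open GenericSpectral g

module Weights {c ℓ₁ ℓ₂} (F : HeytingField c ℓ₁ ℓ₂) where

  open FieldNotation F

  module _ (q x y : Carrier)
           (x#q²y : x # q ^ 2 * y) (x#q³y : x # q ^ 3 * y) where

    A D : Carrier
    A = x - q ^ 2 * y
    D = A * (x - q ^ 3 * y)

    A#0 : A # 0#
    A#0 = x#y⇒x-y#0 x#q²y

    D#0 : D # 0#
    D#0 = x#0y#0→xy#0 A#0 (x#y⇒x-y#0 x#q³y)

    -- weight i j k l = W_{y/x}(i,j;k,l)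
    weight : (i j k l : Fin 3) → Carrier
    weight 0F 0F 0F 0F = 1#
    weight 2F 2F 2F 2F = 1#
    weight 1F 0F 1F 0F = (q ^ 2 * (x - y)) / A ⟨ A#0 ⟩
    weight 2F 1F 2F 1F = (q ^ 2 * (x - y)) / A ⟨ A#0 ⟩
    weight 1F 0F 0F 1F = ((1# - q ^ 2) * x) / A ⟨ A#0 ⟩
    weight 2F 1F 1F 2F = ((1# - q ^ 2) * x) / A ⟨ A#0 ⟩
    weight 0F 1F 1F 0F = ((1# - q ^ 2) * y) / A ⟨ A#0 ⟩
    weight 1F 2F 2F 1F = ((1# - q ^ 2) * y) / A ⟨ A#0 ⟩
    weight 0F 1F 0F 1F = (x - y) / A ⟨ A#0 ⟩
    weight 1F 2F 1F 2F = (x - y) / A ⟨ A#0 ⟩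
    weight 2F 0F 2F 0F = (q ^ 4 * (x - y) * (x - q * y)) / D ⟨ D#0 ⟩
    weight 2F 0F 1F 1F =
      (- (q * (1# - q) ^ 2 * (1# + q) * x * (x - y))) / D ⟨ D#0 ⟩
    weight 2F 0F 0F 2F =
      ((1# - q ^ 2) * x * (x + q * x - q * y - q ^ 3 * y)) / D ⟨ D#0 ⟩
    weight 1F 1F 2F 0F =
      (- (q ^ 4 * (1# + q) * (x - y) * y)) / D ⟨ D#0 ⟩
    weight 1F 1F 1F 1F =
      (- (q * x ^ 2) + (1# + q) * (1# - q ^ 2 + q ^ 4) * x * y - q ^ 4 * y ^ 2)
        / D ⟨ D#0 ⟩
    weight 1F 1F 0F 2F = ((1# + q) * x * (x - y)) / D ⟨ D#0 ⟩
    weight 0F 2F 2F 0F =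
      ((1# - q ^ 2) * (x + q ^ 2 * x - q ^ 2 * y - q ^ 3 * y) * y) / D ⟨ D#0 ⟩
    weight 0F 2F 1F 1F =
      (q * (1# - q) ^ 2 * (1# + q) * (x - y) * y) / D ⟨ D#0 ⟩
    weight 0F 2F 0F 2F = ((x - y) * (x - q * y)) / D ⟨ D#0 ⟩
    weight _  _  _  _  = 0#

module ColumnOperators {c ℓ₁ ℓ₂} (F : HeytingField c ℓ₁ ℓ₂) where

  open FieldNotation F
  open Operators F

  module _ {q : Carrier} (q-generic : GenericQ F q) where

    open GenericQ q-generic
    open Alphabet using (letter; distinct; q-distinct)

    1-q#0 : 1# - q # 0#
    1-q#0 = x#y⇒x-y#0 1#q

    1-q²#0 : 1# - q ^ 2 # 0#
    1-q²#0 = x#y⇒x-y#0 1#q²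

    module Twisted {N : ℕ} (X : Alphabet F q N) where

      x : Fin N → Carrier
      x = letter X

      module _ (i : Fin N) (w : Carrier) (xᵢ#w : x i # w)
               (xᵢ#qw : x i # q * w) (w#qxᵢ : w # q * x i) where

        xᵢ-w#0 : x i - w # 0#
        xᵢ-w#0 = x#y⇒x-y#0 xᵢ#w

        xᵢ-qw#0 : x i - q * w # 0#
        xᵢ-qw#0 = x#y⇒x-y#0 xᵢ#qw

        d○ : Op N
        d○ = diag 1#
          (((q * x i - w) * (x i - q ^ 2 * w))
            / ((1# + q) * (x i - w)) ⟨ x#0y#0→xy#0 1+q#0 xᵢ-w#0 ⟩)
          ((x i - q ^ 3 * w) / (x i - q * w) ⟨ xᵢ-qw#0 ⟩)
          at i

        d● : Op N
        d● = diag 1#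
          ((1# + q) / (q * x i - w) ⟨ x#y⇒x-y#0 (#-sym w#qxᵢ) ⟩)
          ((x i - q ^ 2 * w) / (x i - w) ⟨ xᵢ-w#0 ⟩)
          at i

        d●○ : Op N
        d●○ = diag 1#
          ((x i - q ^ 2 * w) / (x i - w) ⟨ xᵢ-w#0 ⟩)
          (((x i - q ^ 2 * w) * (x i - q ^ 3 * w))
            / ((x i - w) * (x i - q * w)) ⟨ x#0y#0→xy#0 xᵢ-w#0 xᵢ-qw#0 ⟩)
          at i

        dᵘ : Decoration → Op N
        dᵘ ○ = d○
        dᵘ ● = d●

      module _ (i j : Fin N) (i≢j : i ≢ j) where

        -- d_i^u(x_j)
        dᵘ[x] : Decoration → Op N
        dᵘ[x] = dᵘ i (x j) (distinct X i≢j) (q-distinct X i≢j)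
                   (q-distinct X (≢-sym i≢j))

        -- d_i^●○(x_j)
        d●○[x] : Op N
        d●○[x] = d●○ i (x j) (distinct X i≢j) (q-distinct X i≢j)
                     (q-distinct X (≢-sym i≢j))

      module _ (z : Carrier) (z-generic : GenericSpectral F X z) where

        open GenericSpectral z-generic

        xᵢ-q²z#0 : ∀ i → x i - q ^ 2 * z # 0#
        xᵢ-q²z#0 i = x#y⇒x-y#0 (x#q²z i)

        den : Fin N → Carrier
        den i = (x i - q ^ 2 * z) * (x i - q ^ 3 * z)

        den#0 : ∀ i → den i # 0#
        den#0 i = x#0y#0→xy#0 (xᵢ-q²z#0 i) (x#y⇒x-y#0 (x#q³z i))

        d : Fin N → Op N
        d i = diag 1#
          ((x i - z) / (x i - q ^ 2 * z) ⟨ xᵢ-q²z#0 i ⟩)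
          (((x i - z) * (x i - q * z)) / den i ⟨ den#0 i ⟩)
          at i

        e○ : Fin N → Op N
        e○ i = scale₃
          (((1# - q ^ 2) * z) / (x i - q ^ 2 * z) ⟨ xᵢ-q²z#0 i ⟩)
          (elementary 1F 0F) at i

        e● : Fin N → Op N
        e● i = scale₃
          ((q * (1# - q) ^ 2 * (1# + q) * (x i - z) * z) / den i ⟨ den#0 i ⟩)
          (elementary 2F 1F) at i

        e●○ : Fin N → Op N
        e●○ i = scale₃
          (((1# - q ^ 2) * (x i + q ^ 2 * x i - q ^ 2 * z - q ^ 3 * z) * z)
            / den i ⟨ den#0 i ⟩)
          (elementary 2F 0F) at i

        eᵘ : Decoration → Fin N → Op N
        eᵘ ○ = e○
        eᵘ ● = e●

        module _ (i j : Fin N) (i≢j : i ≢ j) where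

          e○,○ : Op N
          e○,○ =
            ((x i * x j + q ^ 2 * x i * x j - q ^ 2 * x i * z - q ^ 2 * x j * z)
              / ((1# - q ^ 2) * z) ⟨ x#0y#0→xy#0 1-q²#0 z#0 ⟩)
            · (e○ i ⊙ e○ j)

          e●,○ : Op N
          e●,○ =
            ((x i * x j + q ^ 2 * x i * x j - q ^ 2 * x i * z - q ^ 3 * x j * z)
              / (q * (1# - q) * (x i - x j) * z)
              ⟨ x#0y#0→xy#0
                  (x#0y#0→xy#0 (x#0y#0→xy#0 q#0 1-q#0)
                    (x#y⇒x-y#0 (distinct X i≢j)))
                  z#0 ⟩)
            · (e● i ⊙ e○ j)

          e●,● : Op N
          e●,● =
            (((1# + q) *
              (x i * x j + q ^ 2 * x i * x j - q ^ 3 * x i * z - q ^ 3 * x j * z))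
              / (q * (1# - q) * (x i - q * x j) * (x j - q * x i) * z)
              ⟨ x#0y#0→xy#0
                  (x#0y#0→xy#0
                    (x#0y#0→xy#0 (x#0y#0→xy#0 q#0 1-q#0)
                      (x#y⇒x-y#0 (q-distinct X i≢j)))
                    (x#y⇒x-y#0 (q-distinct X (≢-sym i≢j))))
                  z#0 ⟩)
            · (e● i ⊙ e● j)

        -- eᵘᵛ u v i j _ = e_{ij}^{uv}(z)
        eᵘᵛ : Decoration → Decoration → (i j : Fin N) → i ≢ j → Op N
        eᵘᵛ ○ ○ i j i≢j = e○,○ i j i≢j
        eᵘᵛ ● ○ i j i≢j = e●,○ i j i≢j
        eᵘᵛ ○ ● i j i≢j = e●,○ j i (≢-sym i≢j)
        eᵘᵛ ● ● i j i≢j = e●,● i j i≢j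

        Γ₀ : Op N
        Γ₀ = ∏ᴼ d

        Γ₁ : Op N
        Γ₁ = ∑-decorations λ u → ∑ᴼ λ i →
          eᵘ u i ⊙ ∏ᴼ λ j → mulUnless (j ≟ i) λ j≢i → d j ⊙ dᵘ[x] j i j≢i u

        Γ₂ : Op N
        Γ₂ =
          (∑ᴼ λ i →
            e●○ i ⊙ ∏ᴼ λ j → mulUnless (j ≟ i) λ j≢i → d j ⊙ d●○[x] j i j≢i)
          ⊕
          (∑-decorations λ u → ∑-decorations λ v →
            ∑ᴼ λ i → ∑ᴼ λ j → sumIf (i <? j) λ i<j →
              eᵘᵛ u v i j (<⇒≢ i<j) ⊙
              ∏ᴼ λ k → mulUnless (k ≟ i) λ k≢i → mulUnless (k ≟ j) λ k≢j →
                d k ⊙ dᵘ[x] k i k≢i u ⊙ dᵘ[x] k j k≢j v)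

    -- Γ k X z _ = Γ_k(z; x₁,…,x_N)
    Γ : ∀ {N} → Fin 3 → (X : Alphabet F q N) (z : Carrier) →
        GenericSpectral F X z → Op N
    Γ 0F X = Twisted.Γ₀ X
    Γ 1F X = Twisted.Γ₁ X
    Γ 2F X = Twisted.Γ₂ X

{-# OPTIONS --safe #-}
module Submission where

-- Between two basis states t and s the operators Γ_k(z) only raise sites. Raising a
-- site from 0 to 1 adds an arrow ○ to it, from 1 to 2 an arrow ●, and from 0 to 2
-- both. At most one term of the sums that define Γ_k(z) has a nonzero matrix element
-- from t to s, because its factors e determine which sites move. Hence this matrix
-- element vanishes unless k arrows are added, and is otherwise an explicit product
-- over the sites and over the pairs of sites (element, Γ-entry). The factor of a pair
-- does not depend on the order of its two sites (joint-sym), so the product may be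
-- taken over the permuted sites (pairProduct-permute). This is the invariance under
-- permutations (element-permute).
--
-- For the exchange relations, the matrix element of Γ_k(z) Γ_l(y) from t to s is a sum
-- over intermediate states, that is, over the ways to share the arrows between the two
-- factors, with k and l arrows respectively.
--
-- An idle site contributes the dressing factors of the sites that move. As d° d● = d●○,
-- it does not matter in which step a site moves (dressing-split), and these factors can
-- be pulled out of the sum. Further, an arrow ● at a site with letter x has the same
-- weights as an arrow ○ at a site with letter x/q, up to factors that again do not
-- depend on the intermediate state (site-gauge, pair-gauge). All these factors are the
-- same for Γ_j(y) Γ_i(z), since they are symmetric in z and y. What remains of the sum
-- depends only on the letters of the arrows (collapse, productElement-twoSteps), as if
-- there were only the sites that move, all of them starting in state 0.
--
-- At most four arrows are added, so that twenty identities between rational functions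
-- in at most seven variables are left, one for each k, l and each list of sites that
-- carry k + l arrows (exchange). For other numbers of arrows both sides vanish, because
-- the weight W(i,j;k,l) vanishes unless i + j = k + l.
--
-- A rational identity is brought over a common denominator (equal-sound), and the
-- resulting polynomial identity is verified by evaluation at a single integer point,
-- chosen such that the coefficients can be read off from the value as digits: the
-- Kronecker substitution (unique, null-sound). The polynomials then need not be
-- expanded. As the coefficients are integers, the identities hold in all commutative
-- rings.

open import Defs
open import Algebra.Apartness.Bundles using (HeytingField)
open import Algebra.Bundles using (RawRing; CommutativeRing; CommutativeSemiring)
import Algebra.Definitions.RawSemiring as RawSemiringDefinitions
import Algebra.Properties.CommutativeMonoid.Sum as Sums
import Algebra.Properties.Semiring.Sum as SemiringSum
open import Data.Bool.Base using (Bool; true; false; if_then_else_; _∧_; T)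
open import Data.Bool.Properties using (∧-zeroʳ)
open import Data.Empty using (⊥; ⊥-elim)
open import Data.Fin.Base as Fin using (Fin; zero; suc; toℕ)
open import Data.Fin.Patterns using (0F; 1F; 2F; 3F; 4F; 5F; 6F; 7F)
open import Data.Fin.Permutation using (Permutation′; _⟨$⟩ʳ_; _⟨$⟩ˡ_; inverseˡ; inverseʳ)
open import Data.Fin.Properties as Fin using (_≟_; _<?_; <⇒≢)
open import Data.Integer.Base as ℤ using (ℤ; +_; -[1+_])
import Data.Integer.Properties as ℤ
open import Data.List.Base as List using (List; []; _∷_; _++_; length)
open import Data.List.Relation.Unary.All using (All; []; _∷_)
open import Data.List.Relation.Unary.AllPairs using (AllPairs; []; _∷_)
open import Data.Maybe.Base as Maybe using (Maybe; just; nothing)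
open import Data.Nat.Base as ℕ using (ℕ; zero; suc; _≤_; _<_; _≥_; s≤s; z≤n)
import Data.Nat.DivMod as ℕ
import Data.Nat.Properties as ℕ
open import Data.Nat.Tactic.RingSolver using (solve-∀)
open import Data.Product.Base using (∃; _×_; _,_; proj₁; proj₂)
open import Data.Sum.Base as Sum using (_⊎_; inj₁; inj₂)
open import Data.Unit.Base using (⊤; tt)
open import Data.Vec.Base as Vec using (Vec; []; _∷_; lookup; map)
open import Data.Vec.Functional using (foldr)
import Data.Vec.Properties as Vec
open import Function.Base using (_∘_; id)
open import Level using (0ℓ; _⊔_)
open import Relation.Binary.PropositionalEquality.Core as ≡ using (_≡_; _≢_; ≢-sym)
open import Relation.Nullary.Decidable using (dec-false)
open import Relation.Nullary.Decidable.Core using (Dec; yes; no; does)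
open import Relation.Nullary.Negation using (¬_; contradiction)

-- Polynomial identities by evaluation at one point

-- Polynomials with natural coefficients, recursive in the variables: an element
-- of Poly (suc n) is the list of its coefficients, lowest power of the first
-- variable first, as polynomials in the other n variables. Trailing zero
-- coefficients are allowed, so one polynomial has many representations.
data Poly : ℕ → Set where
  con : ℕ → Poly zero
  []  : ∀ {n} → Poly (suc n)
  _∷_ : ∀ {n} → Poly n → Poly (suc n) → Poly (suc n)

infixl 6 _⊞_
infixl 7 _⊠_

constant : ∀ {n} → ℕ → Poly n
constant {zero}  k = con k
constant {suc n} k = constant k ∷ []

variable-at : ∀ {n} → Fin n → Poly n
variable-at zero    = constant 0 ∷ (constant 1 ∷ [])
variable-at (suc i) = variable-at i ∷ []

_⊞_ : ∀ {n} → Poly n → Poly n → Poly n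
con a    ⊞ con b    = con (a ℕ.+ b)
[]       ⊞ q        = q
(p ∷ ps) ⊞ []       = p ∷ ps
(p ∷ ps) ⊞ (q ∷ qs) = (p ⊞ q) ∷ (ps ⊞ qs)

mutual
  _⊠_ : ∀ {n} → Poly n → Poly n → Poly n
  con a    ⊠ con b = con (a ℕ.* b)
  []       ⊠ q     = []
  (p ∷ ps) ⊠ q     = scale p q ⊞ (constant 0 ∷ (ps ⊠ q))

  scale : ∀ {n} → Poly n → Poly (suc n) → Poly (suc n)
  scale p []       = []
  scale p (q ∷ qs) = (p ⊠ q) ∷ scale p qs

module PolyEval {c ℓ} (S : CommutativeSemiring c ℓ) where

  open CommutativeSemiring S
  open import Algebra.Properties.Semiring.Mult semiring
    using (×-homo-+; ×1-homo-*; ×-homo-1) renaming (_×_ to _·_)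
  open import Relation.Binary.Reasoning.Setoid setoid
  open import Algebra.Properties.CommutativeSemigroup +-commutativeSemigroup
    using () renaming (interchange to +-interchange)
  open import Algebra.Properties.CommutativeSemigroup *-commutativeSemigroup
    using (x∙yz≈y∙xz)

  ⟪_⟫ : ∀ {n} → Poly n → Vec Carrier n → Carrier
  ⟪ con k  ⟫ []       = k · 1#
  ⟪ []     ⟫ (x ∷ xs) = 0#
  ⟪ p ∷ ps ⟫ (x ∷ xs) = ⟪ p ⟫ xs + x * ⟪ ps ⟫ (x ∷ xs)

  ⟪constant⟫ : ∀ {n} k (xs : Vec Carrier n) → ⟪ constant k ⟫ xs ≈ k · 1#
  ⟪constant⟫ k []       = refl
  ⟪constant⟫ k (x ∷ xs) =
    trans (+-cong (⟪constant⟫ k xs) (zeroʳ x)) (+-identityʳ _)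

  ⟪0⟫ : ∀ {n} (xs : Vec Carrier n) → ⟪ constant 0 ⟫ xs ≈ 0#
  ⟪0⟫ = ⟪constant⟫ 0

  ⟪1⟫ : ∀ {n} (xs : Vec Carrier n) → ⟪ constant 1 ⟫ xs ≈ 1#
  ⟪1⟫ xs = trans (⟪constant⟫ 1 xs) (×-homo-1 1#)

  ⟪variable-at⟫ : ∀ {n} i (xs : Vec Carrier n) → ⟪ variable-at i ⟫ xs ≈ lookup xs i
  ⟪variable-at⟫ zero (x ∷ xs) = begin
    ⟪ constant 0 ⟫ xs + x * (⟪ constant 1 ⟫ xs + x * 0#)
      ≈⟨ +-cong (⟪0⟫ xs) (*-congˡ (+-cong (⟪1⟫ xs) (zeroʳ x))) ⟩
    0# + x * (1# + 0#)
      ≈⟨ trans (+-identityˡ _) (trans (*-congˡ (+-identityʳ 1#)) (*-identityʳ x)) ⟩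
    x ∎
  ⟪variable-at⟫ (suc i) (x ∷ xs) =
    trans (+-cong (⟪variable-at⟫ i xs) (zeroʳ x)) (+-identityʳ _)

  ⟪⊞⟫ : ∀ {n} (p q : Poly n) xs → ⟪ p ⊞ q ⟫ xs ≈ ⟪ p ⟫ xs + ⟪ q ⟫ xs
  ⟪⊞⟫ (con a)  (con b)  []       = ×-homo-+ 1# a b
  ⟪⊞⟫ []       q        (x ∷ xs) = sym (+-identityˡ _)
  ⟪⊞⟫ (p ∷ ps) []       (x ∷ xs) = sym (+-identityʳ _)
  ⟪⊞⟫ (p ∷ ps) (q ∷ qs) (x ∷ xs) = begin
    ⟪ p ⊞ q ⟫ xs + x * ⟪ ps ⊞ qs ⟫ (x ∷ xs)
      ≈⟨ +-cong (⟪⊞⟫ p q xs) (*-congˡ (⟪⊞⟫ ps qs (x ∷ xs))) ⟩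
    _ ≈⟨ +-congˡ (distribˡ x _ _) ⟩
    _ ≈⟨ +-interchange _ _ _ _ ⟩
    _ ∎

  mutual
    ⟪⊠⟫ : ∀ {n} (p q : Poly n) xs → ⟪ p ⊠ q ⟫ xs ≈ ⟪ p ⟫ xs * ⟪ q ⟫ xs
    ⟪⊠⟫ (con a)  (con b)  []       = ×1-homo-* a b
    ⟪⊠⟫ []       q        (x ∷ xs) = sym (zeroˡ _)
    ⟪⊠⟫ (p ∷ ps) q        (x ∷ xs) = begin
      ⟪ scale p q ⊞ (constant 0 ∷ (ps ⊠ q)) ⟫ (x ∷ xs)
        ≈⟨ ⟪⊞⟫ (scale p q) _ (x ∷ xs) ⟩
      ⟪ scale p q ⟫ (x ∷ xs) + (⟪ constant 0 ⟫ xs + x * ⟪ ps ⊠ q ⟫ (x ∷ xs))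
        ≈⟨ +-cong (⟪scale⟫ p q x xs)
             (trans (+-congʳ (⟪0⟫ xs)) (trans (+-identityˡ _) (*-congˡ (⟪⊠⟫ ps q (x ∷ xs))))) ⟩
      ⟪ p ⟫ xs * ⟪ q ⟫ (x ∷ xs) + x * (⟪ ps ⟫ (x ∷ xs) * ⟪ q ⟫ (x ∷ xs))
        ≈⟨ +-congˡ (*-assoc _ _ _) ⟨
      _ ≈⟨ distribʳ _ _ _ ⟨
      _ ∎

    ⟪scale⟫ : ∀ {n} (p : Poly n) q x xs →
              ⟪ scale p q ⟫ (x ∷ xs) ≈ ⟪ p ⟫ xs * ⟪ q ⟫ (x ∷ xs)
    ⟪scale⟫ p []       x xs = sym (zeroʳ _)
    ⟪scale⟫ p (q ∷ qs) x xs = begin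
      ⟪ p ⊠ q ⟫ xs + x * ⟪ scale p qs ⟫ (x ∷ xs)
        ≈⟨ +-cong (⟪⊠⟫ p q xs) (*-congˡ (⟪scale⟫ p qs x xs)) ⟩
      ⟪ p ⟫ xs * ⟪ q ⟫ xs + x * (⟪ p ⟫ xs * ⟪ qs ⟫ (x ∷ xs))
        ≈⟨ +-congˡ (x∙yz≈y∙xz x _ _) ⟩
      _ ≈⟨ distribˡ _ _ _ ⟨
      _ ∎

open PolyEval ℕ.+-*-commutativeSemiring using () renaming
  (⟪_⟫ to ⟪_⟫ℕ; ⟪⊞⟫ to ⟪⊞⟫ℕ; ⟪⊠⟫ to ⟪⊠⟫ℕ; ⟪0⟫ to ⟪0⟫ℕ; ⟪1⟫ to ⟪1⟫ℕ; ⟪variable-at⟫ to ⟪variable-at⟫ℕ)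

-- Separated f β bounds each coordinate of β from below by a value of f at the
-- later coordinates, all earlier ones being 1. For f the evaluation of a
-- polynomial p, the coefficients of p with respect to the first variable have
-- values at the remaining coordinates that add up to f (1 ∷ β); hence these
-- values are digits in base b.
Separated : ∀ {n} → (Vec ℕ n → ℕ) → Vec ℕ n → Set
Separated f []      = ⊤
Separated f (b ∷ β) = f (1 ∷ β) < b × Separated (λ v → f (1 ∷ v)) β

separated-mono : ∀ {n} {f g : Vec ℕ n → ℕ} → (∀ v → f v ≤ g v) →
                 ∀ β → Separated g β → Separated f β
separated-mono f≤g []      _        = tt
separated-mono f≤g (b ∷ β) (g<b , s) =
  ℕ.≤-<-trans (f≤g (1 ∷ β)) g<b , separated-mono (λ v → f≤g (1 ∷ v)) β s

-- The least separated point; its coordinates grow like those of a Kronecker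
-- substitution.
separating : ∀ {n} → (Vec ℕ n → ℕ) → Vec ℕ n
separating {zero}  f = []
separating {suc n} f with separating (λ v → f (1 ∷ v))
... | β = suc (f (1 ∷ β)) ∷ β

separating-separated : ∀ {n} (f : Vec ℕ n → ℕ) → Separated f (separating f)
separating-separated {zero}  f = tt
separating-separated {suc n} f = ℕ.≤-refl , separating-separated (λ v → f (1 ∷ v))

×1≡ : ∀ k → ⟪ con k ⟫ℕ [] ≡ k
×1≡ zero    = ≡.refl
×1≡ (suc k) = ≡.cong suc (×1≡ k)

digits-unique : ∀ {b c c′ m m′} → c < b → c′ < b →
                c ℕ.+ b ℕ.* m ≡ c′ ℕ.+ b ℕ.* m′ → c ≡ c′ × m ≡ m′
digits-unique {b@(suc _)} {c} {c′} {m} {m′} c<b c′<b eq = c≡c′ , m≡m′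
  where
  rem : ∀ {c m} → c < b → (c ℕ.+ b ℕ.* m) ℕ.% b ≡ c
  rem {c} {m} c<b = ≡.trans (≡.cong (λ k → (c ℕ.+ k) ℕ.% b) (ℕ.*-comm b m))
    (≡.trans (ℕ.[m+kn]%n≡m%n c m b) (ℕ.m<n⇒m%n≡m c<b))
  c≡c′ = ≡.trans (≡.sym (rem {c} {m} c<b)) (≡.trans (≡.cong (ℕ._% b) eq) (rem {c′} {m′} c′<b))
  m≡m′ = ℕ.*-cancelˡ-≡ m m′ b (ℕ.+-cancelˡ-≡ c _ _ (≡.trans eq (≡.cong (ℕ._+ b ℕ.* m′) (≡.sym c≡c′))))

module Uniqueness {c ℓ} (S : CommutativeSemiring c ℓ) where

  open CommutativeSemiring S
  open PolyEval S

  tail≤ : ∀ {n} (p : Poly n) ps {v} → ⟪ ps ⟫ℕ (1 ∷ v) ≤ ⟪ p ∷ ps ⟫ℕ (1 ∷ v)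
  tail≤ p ps {v} =
    ℕ.≤-trans (ℕ.≤-reflexive (≡.sym (ℕ.*-identityˡ _))) (ℕ.m≤n+m _ (⟪ p ⟫ℕ v))

  vanishing : ∀ {n} (p : Poly n) (β : Vec ℕ n) → Separated ⟪ p ⟫ℕ β →
              ⟪ p ⟫ℕ β ≡ 0 → ∀ xs → ⟪ p ⟫ xs ≈ 0#
  vanishing (con a)  []      _ eq [] =
    reflexive (≡.cong (λ k → ⟪ con k ⟫ []) (≡.trans (≡.sym (×1≡ a)) eq))
  vanishing []       β       _ _ (x ∷ xs) = refl
  vanishing (p ∷ ps) (b ∷ β) (p<b , s) eq (x ∷ xs) =
    trans (+-cong (vanishing p β (separated-mono (λ v → ℕ.m≤m+n _ _) β s) (proj₁ both) xs)
                  (trans (*-congˡ (vanishing ps (b ∷ β)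
                     (ℕ.≤-<-trans (tail≤ p ps) p<b , separated-mono (λ v → tail≤ p ps) β s)
                     (proj₂ both) (x ∷ xs))) (zeroʳ x)))
          (+-identityˡ 0#)
    where
    both : ⟪ p ⟫ℕ β ≡ 0 × ⟪ ps ⟫ℕ (b ∷ β) ≡ 0
    both = digits-unique (ℕ.≤-<-trans (ℕ.m≤m+n _ _) p<b) (ℕ.≤-<-trans z≤n p<b)
             (≡.trans eq (≡.sym (ℕ.*-zeroʳ b)))

  -- The value at a separated point determines the base-b digits, hence, by
  -- induction on the number of variables, all coefficients.
  unique : ∀ {n} (p q : Poly n) (β : Vec ℕ n) →
           Separated ⟪ p ⟫ℕ β → Separated ⟪ q ⟫ℕ β →
           ⟪ p ⟫ℕ β ≡ ⟪ q ⟫ℕ β → ∀ xs → ⟪ p ⟫ xs ≈ ⟪ q ⟫ xs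
  unique (con a) (con b) [] _ _ eq [] =
    reflexive (≡.cong (λ k → ⟪ con k ⟫ []) (≡.trans (≡.sym (×1≡ a)) (≡.trans eq (×1≡ b))))
  unique []       q        β@(_ ∷ _) _  sq eq xs@(_ ∷ _) = sym (vanishing q β sq (≡.sym eq) xs)
  unique (p ∷ ps) []       β@(_ ∷ _) sp _  eq xs@(_ ∷ _) = vanishing (p ∷ ps) β sp eq xs
  unique (p ∷ ps) (q ∷ qs) (b ∷ β) (p<b , sp) (q<b , sq) eq (x ∷ xs) =
    +-cong (unique p q β (separated-mono (λ v → ℕ.m≤m+n _ _) β sp)
                         (separated-mono (λ v → ℕ.m≤m+n _ _) β sq) (proj₁ both) xs)
           (*-congˡ (unique ps qs (b ∷ β)
             (ℕ.≤-<-trans (tail≤ p ps) p<b , separated-mono (λ v → tail≤ p ps) β sp)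
             (ℕ.≤-<-trans (tail≤ q qs) q<b , separated-mono (λ v → tail≤ q qs) β sq)
             (proj₂ both) (x ∷ xs)))
    where
    both : ⟪ p ⟫ℕ β ≡ ⟪ q ⟫ℕ β × ⟪ ps ⟫ℕ (b ∷ β) ≡ ⟪ qs ⟫ℕ (b ∷ β)
    both = digits-unique (ℕ.≤-<-trans (ℕ.m≤m+n _ _) p<b) (ℕ.≤-<-trans (ℕ.m≤m+n _ _) q<b) eq

-- Rational expressions and their fractions

infixl 6 _:+_
infixl 7 _:*_
infix  8 :-_

-- Ring expressions in n variables in which inv a stands for the reciprocal of
-- a denominator named a. Negation is the only source of signs, so that a
-- polynomial expression has an evident majorant.
data Expr (n : ℕ) (A : Set) : Set where
  var       : Fin n → Expr n A
  inv       : A → Expr n A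
  :0 :1     : Expr n A
  _:+_ _:*_ : Expr n A → Expr n A → Expr n A
  :-_       : Expr n A → Expr n A

PolyExpr : ℕ → Set
PolyExpr n = Expr n ⊥

module Semantics {c ℓ} (R : CommutativeRing c ℓ) where
  open CommutativeRing R

  ⟦_⟧ : ∀ {n A} → Expr n A → Vec Carrier n → (A → Carrier) → Carrier
  ⟦ var i  ⟧ ρ ι = lookup ρ i
  ⟦ inv k  ⟧ ρ ι = ι k
  ⟦ :0     ⟧ ρ ι = 0#
  ⟦ :1     ⟧ ρ ι = 1#
  ⟦ e :+ f ⟧ ρ ι = ⟦ e ⟧ ρ ι + ⟦ f ⟧ ρ ι
  ⟦ e :* f ⟧ ρ ι = ⟦ e ⟧ ρ ι * ⟦ f ⟧ ρ ι
  ⟦ :- e   ⟧ ρ ι = - ⟦ e ⟧ ρ ι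

  ⟦_⟧ₚ : ∀ {n} → PolyExpr n → Vec Carrier n → Carrier
  ⟦ e ⟧ₚ ρ = ⟦ e ⟧ ρ ⊥-elim

-- The value at v after all signs have been made positive. It bounds the positive
-- and the negative part of the polynomial that e denotes.
∣_∣ᴱ : ∀ {n} → PolyExpr n → Vec ℕ n → ℕ
∣ var i  ∣ᴱ v = lookup v i
∣ :0     ∣ᴱ v = 0
∣ :1     ∣ᴱ v = 1
∣ e :+ f ∣ᴱ v = ∣ e ∣ᴱ v ℕ.+ ∣ f ∣ᴱ v
∣ e :* f ∣ᴱ v = ∣ e ∣ᴱ v ℕ.* ∣ f ∣ᴱ v
∣ :- e   ∣ᴱ v = ∣ e ∣ᴱ v

private module ℤEval = Semantics ℤ.+-*-commutativeRing

nullℤ : ℤ → Bool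
nullℤ (+ n)    = n ℕ.≡ᵇ 0
nullℤ -[1+ _ ] = false

-- Does the integer value at a point that separates the coefficients vanish? A
-- single evaluation, in arbitrary-precision integers, decides whether the
-- polynomial is zero.
null : ∀ {n} → PolyExpr n → Bool
null e = nullℤ (ℤEval.⟦ e ⟧ₚ (map +_ (separating ∣ e ∣ᴱ)))

-- Trivial factors and summands are removed when fractions are formed.
data Special {n A} : Expr n A → Set where
  isZero : Special :0
  isOne  : Special :1
  other  : ∀ {e} → Special e

special : ∀ {n A} (e : Expr n A) → Special e
special :0 = isZero
special :1 = isOne
special e  = other

simpleMul : ∀ {n A} → Expr n A → Expr n A → Expr n A
simpleMul e f with special e | special f
... | isZero | _      = :0
... | isOne  | _      = f
... | other  | isZero = :0
... | other  | isOne  = e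
... | other  | other  = e :* f

-- An expression is brought over a common denominator. A denominator is a list of
-- names, read as the product of the named polynomials; sums use the least common
-- multiple of these lists.
module Fractions {n} {A : Set} (_≡?_ : (a b : A) → Maybe (a ≡ b)) (denominator : A → PolyExpr n) where

  Fraction : Set
  Fraction = PolyExpr n × List A

  extract : A → List A → Maybe (List A)
  extract k []      = nothing
  extract k (j ∷ l) with k ≡? j
  ... | just _  = just l
  ... | nothing with extract k l
  ...   | just l′ = just (j ∷ l′)
  ...   | nothing = nothing

  -- The two multiset differences.
  difference : List A → List A → List A × List A
  difference []      l = [] , l
  difference (k ∷ h) l with extract k l
  ... | just l′ = difference h l′
  ... | nothing with difference h l
  ...   | a , b = k ∷ a , b

  prod : List A → PolyExpr n
  prod []      = :1
  prod (k ∷ l) = simpleMul (denominator k) (prod l)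

  addF : Fraction → Fraction → Fraction
  addF (e , h) (f , l) with special e | special f
  ... | isZero | _      = f , l
  ... | _      | isZero = e , h
  ... | _      | _      with difference h l
  ...   | a , b = simpleMul e (prod b) :+ simpleMul f (prod a) , h ++ b

  mulF : Fraction → Fraction → Fraction
  mulF (e , h) (f , l) = simpleMul e f , h ++ l

  negF : Fraction → Fraction
  negF (e , h) with special e
  ... | isZero = :0 , h
  ... | _      = :- e , h

  fraction : Expr n A → Fraction
  fraction (var i)  = var i , []
  fraction (inv k)  = :1 , k ∷ []
  fraction :0       = :0 , []
  fraction :1       = :1 , []
  fraction (e :+ f) = addF (fraction e) (fraction f)
  fraction (e :* f) = mulF (fraction e) (fraction f)
  fraction (:- e)   = negF (fraction e)

  equal : Expr n A → Expr n A → Bool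
  equal e f = null (proj₁ (fraction (e :+ (:- f))))

-- Correctness of the test for equality of fractions

-- A polynomial with integer coefficients is represented by a formal difference
-- of two polynomials with natural coefficients, without cancellation: the
-- majorant of an expression is then the sum of the two (total).
mulPair : ∀ {n} → Poly n × Poly n → Poly n × Poly n → Poly n × Poly n
mulPair (p , m) (p′ , m′) = (p ⊠ p′) ⊞ (m ⊠ m′) , (p ⊠ m′) ⊞ (m ⊠ p′)

parts : ∀ {n} → PolyExpr n → Poly n × Poly n
parts (var i)  = variable-at i , constant 0
parts :0       = constant 0 , constant 0
parts :1       = constant 1 , constant 0
parts (e :+ f) with parts e | parts f
... | p , m | p′ , m′ = p ⊞ p′ , m ⊞ m′
parts (e :* f) = mulPair (parts e) (parts f)
parts (:- e) with parts e
... | p , m = m , p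

total : ∀ {n} → Poly n × Poly n → Vec ℕ n → ℕ
total (p , m) v = ⟪ p ⟫ℕ v ℕ.+ ⟪ m ⟫ℕ v

total-mul : ∀ {n} (a b : Poly n × Poly n) v → total (mulPair a b) v ≡ total a v ℕ.* total b v
total-mul (p , m) (p′ , m′) v = ≡.trans
  (≡.cong₂ ℕ._+_
    (≡.trans (⟪⊞⟫ℕ (p ⊠ p′) (m ⊠ m′) v) (≡.cong₂ ℕ._+_ (⟪⊠⟫ℕ p p′ v) (⟪⊠⟫ℕ m m′ v)))
    (≡.trans (⟪⊞⟫ℕ (p ⊠ m′) (m ⊠ p′) v) (≡.cong₂ ℕ._+_ (⟪⊠⟫ℕ p m′ v) (⟪⊠⟫ℕ m p′ v))))
  (expand (⟪ p ⟫ℕ v) (⟪ m ⟫ℕ v) (⟪ p′ ⟫ℕ v) (⟪ m′ ⟫ℕ v))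
  where
  expand : ∀ a b c d → a ℕ.* c ℕ.+ b ℕ.* d ℕ.+ (a ℕ.* d ℕ.+ b ℕ.* c) ≡ (a ℕ.+ b) ℕ.* (c ℕ.+ d)
  expand = solve-∀

∣∣-total : ∀ {n} (e : PolyExpr n) v → ∣ e ∣ᴱ v ≡ total (parts e) v
∣∣-total (var i)  v = ≡.sym (≡.trans (≡.cong₂ ℕ._+_ (⟪variable-at⟫ℕ i v) (⟪0⟫ℕ v)) (ℕ.+-identityʳ _))
∣∣-total :0       v = ≡.sym (≡.cong₂ ℕ._+_ (⟪0⟫ℕ v) (⟪0⟫ℕ v))
∣∣-total :1       v = ≡.sym (≡.cong₂ ℕ._+_ (⟪1⟫ℕ v) (⟪0⟫ℕ v))
∣∣-total (e :+ f) v with parts e | parts f | ∣∣-total e v | ∣∣-total f v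
... | p , m | p′ , m′ | eq | eq′ = ≡.trans (≡.cong₂ ℕ._+_ eq eq′)
  (≡.trans (expand (⟪ p ⟫ℕ v) (⟪ m ⟫ℕ v) (⟪ p′ ⟫ℕ v) (⟪ m′ ⟫ℕ v)) (≡.sym (≡.cong₂ ℕ._+_ (⟪⊞⟫ℕ p p′ v) (⟪⊞⟫ℕ m m′ v))))
  where
  expand : ∀ a b c d → (a ℕ.+ b) ℕ.+ (c ℕ.+ d) ≡ (a ℕ.+ c) ℕ.+ (b ℕ.+ d)
  expand = solve-∀
∣∣-total (e :* f) v =
  ≡.trans (≡.cong₂ ℕ._*_ (∣∣-total e v) (∣∣-total f v)) (≡.sym (total-mul (parts e) (parts f) v))
∣∣-total (:- e)   v with parts e | ∣∣-total e v
... | p , m | eq = ≡.trans eq (ℕ.+-comm (⟪ p ⟫ℕ v) _)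

module Parts {c ℓ} (R : CommutativeRing c ℓ) where
  open CommutativeRing R
  open Semantics R public
  open PolyEval commutativeSemiring public
  open import Algebra.Properties.Ring ring using (-0#≈0#; -‿+-comm; -‿involutive; -‿distribˡ-*; -‿distribʳ-*)
  open import Algebra.Properties.CommutativeSemigroup +-commutativeSemigroup using (interchange)
  open import Relation.Binary.Reasoning.Setoid setoid

  x-0 : ∀ {x} → x - 0# ≈ x
  x-0 = trans (+-congˡ -0#≈0#) (+-identityʳ _)

  difference-+ : ∀ a b c d → (a - b) + (c - d) ≈ (a + c) - (b + d)
  difference-+ a b c d = trans (interchange a (- b) c (- d)) (+-congˡ (-‿+-comm b d))

  difference-* : ∀ a b c d → (a - b) * (c - d) ≈ (a * c + b * d) - (a * d + b * c)
  difference-* a b c d = begin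
    (a - b) * (c - d)
      ≈⟨ trans (distribʳ _ _ _) (+-cong (distribˡ _ _ _) (distribˡ _ _ _)) ⟩
    (a * c + a * - d) + (- b * c + - b * - d)
      ≈⟨ +-cong (+-congˡ (sym (-‿distribʳ-* a d))) (trans (+-comm _ _)
           (+-cong (trans (sym (-‿distribˡ-* b (- d)))
             (trans (-‿cong (sym (-‿distribʳ-* b d))) (-‿involutive _))) (sym (-‿distribˡ-* b c)))) ⟩
    (a * c - a * d) + (b * d - b * c)
      ≈⟨ difference-+ _ _ _ _ ⟩
    (a * c + b * d) - (a * d + b * c) ∎

  difference-neg : ∀ a b → - (a - b) ≈ b - a
  difference-neg a b = trans (sym (-‿+-comm a (- b))) (trans (+-comm _ _) (+-congʳ (-‿involutive b)))

  ⟪_⟫± : ∀ {n} → Poly n × Poly n → Vec Carrier n → Carrier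
  ⟪ p , m ⟫± ρ = ⟪ p ⟫ ρ - ⟪ m ⟫ ρ

  ⟪mulPair⟫ : ∀ {n} (a b : Poly n × Poly n) ρ → ⟪ mulPair a b ⟫± ρ ≈ ⟪ a ⟫± ρ * ⟪ b ⟫± ρ
  ⟪mulPair⟫ (p , m) (p′ , m′) ρ = trans
    (+-cong (trans (⟪⊞⟫ (p ⊠ p′) (m ⊠ m′) ρ) (+-cong (⟪⊠⟫ p p′ ρ) (⟪⊠⟫ m m′ ρ)))
      (-‿cong (trans (⟪⊞⟫ (p ⊠ m′) (m ⊠ p′) ρ) (+-cong (⟪⊠⟫ p m′ ρ) (⟪⊠⟫ m p′ ρ)))))
    (sym (difference-* _ _ _ _))

  ⟪1⟫± : ∀ {n} (ρ : Vec Carrier n) → ⟪ constant 1 , constant 0 ⟫± ρ ≈ 1#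
  ⟪1⟫± ρ = trans (+-cong (⟪1⟫ ρ) (-‿cong (⟪0⟫ ρ))) x-0

  ⟦⟧-parts : ∀ {n} (e : PolyExpr n) ρ → ⟦ e ⟧ₚ ρ ≈ ⟪ parts e ⟫± ρ
  ⟦⟧-parts (var i)  ρ = sym (trans (+-cong (⟪variable-at⟫ i ρ) (-‿cong (⟪0⟫ ρ))) x-0)
  ⟦⟧-parts :0       ρ = sym (trans (+-cong (⟪0⟫ ρ) (-‿cong (⟪0⟫ ρ))) x-0)
  ⟦⟧-parts :1       ρ = sym (⟪1⟫± ρ)
  ⟦⟧-parts (e :+ f) ρ with parts e | parts f | ⟦⟧-parts e ρ | ⟦⟧-parts f ρ
  ... | p , m | p′ , m′ | eq | eq′ = trans (+-cong eq eq′) (trans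
    (difference-+ _ _ _ _)
    (sym (+-cong (⟪⊞⟫ p p′ ρ) (-‿cong (⟪⊞⟫ m m′ ρ)))))
  ⟦⟧-parts (e :* f) ρ = trans (*-cong (⟦⟧-parts e ρ) (⟦⟧-parts f ρ)) (sym (⟪mulPair⟫ (parts e) (parts f) ρ))
  ⟦⟧-parts (:- e)   ρ with parts e | ⟦⟧-parts e ρ
  ... | p , m | eq = trans (-‿cong eq) (difference-neg _ _)

private module ℤP = Parts ℤ.+-*-commutativeRing

⟪⟫ℤ : ∀ {n} (p : Poly n) v → ℤP.⟪ p ⟫ (map +_ v) ≡ + ⟪ p ⟫ℕ v
⟪⟫ℤ (con zero)    []      = ≡.refl
⟪⟫ℤ (con (suc k)) []      = ≡.cong (ℤ._+_ (+ 1)) (⟪⟫ℤ (con k) [])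
⟪⟫ℤ []            (b ∷ v) = ≡.refl
⟪⟫ℤ (p ∷ ps)      (b ∷ v) = ≡.cong₂ ℤ._+_ (⟪⟫ℤ p v)
  (≡.trans (≡.cong (ℤ._*_ (+ b)) (⟪⟫ℤ ps (b ∷ v))) (≡.sym (ℤ.pos-* b _)))

nullℤ-sound : ∀ i → nullℤ i ≡ true → i ≡ + 0
nullℤ-sound (+ zero) _ = ≡.refl

module NullSound {c ℓ} (R : CommutativeRing c ℓ) where
  open CommutativeRing R
  open Parts R

  null-sound : ∀ {n} (e : PolyExpr n) → null e ≡ true → ∀ ρ → ⟦ e ⟧ₚ ρ ≈ 0#
  null-sound e eq ρ = trans (⟦⟧-parts e ρ)
    (trans (+-congʳ (Uniqueness.unique commutativeSemiring (proj₁ (parts e)) (proj₂ (parts e)) β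
       (separated-mono (λ v → ≤total v (ℕ.m≤m+n _ _)) β sep)
       (separated-mono (λ v → ≤total v (ℕ.m≤n+m _ _)) β sep) same ρ)) (-‿inverseʳ _))
    where
    β = separating ∣ e ∣ᴱ
    sep : Separated ∣ e ∣ᴱ β
    sep = separating-separated ∣ e ∣ᴱ
    ≤total : ∀ {k} v → k ≤ total (parts e) v → k ≤ ∣ e ∣ᴱ v
    ≤total v k≤ = ℕ.≤-trans k≤ (ℕ.≤-reflexive (≡.sym (∣∣-total e v)))
    P M : ℕ
    P = ⟪ proj₁ (parts e) ⟫ℕ β
    M = ⟪ proj₂ (parts e) ⟫ℕ β
    same : P ≡ M
    same = ℤ.+-injective (ℤ.i-j≡0⇒i≡j (+ P) (+ M) (≡.trans
      (≡.sym (≡.trans (ℤP.⟦⟧-parts e (map +_ β))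
        (≡.cong₂ (λ a b → a ℤ.+ ℤ.- b) (⟪⟫ℤ (proj₁ (parts e)) β) (⟪⟫ℤ (proj₂ (parts e)) β))))
      (nullℤ-sound _ eq)))

module FractionSound {c ℓ} (R : CommutativeRing c ℓ) where
  open CommutativeRing R
  open Semantics R
  open NullSound R
  open import Algebra.Properties.Ring ring using (-0#≈0#; x∙y⁻¹≈ε⇒x≈y; -‿distribˡ-*)
  open import Algebra.Properties.CommutativeSemigroup *-commutativeSemigroup
    using (x∙yz≈y∙xz; interchange)
  open import Relation.Binary.Reasoning.Setoid setoid

  ⟦simpleMul⟧ : ∀ {n A} (e f : Expr n A) ρ ι → ⟦ simpleMul e f ⟧ ρ ι ≈ ⟦ e ⟧ ρ ι * ⟦ f ⟧ ρ ι
  ⟦simpleMul⟧ e f ρ ι with special e | special f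
  ... | isZero | _      = sym (zeroˡ _)
  ... | isOne  | _      = sym (*-identityˡ _)
  ... | other  | isZero = sym (zeroʳ _)
  ... | other  | isOne  = sym (*-identityʳ _)
  ... | other  | other  = refl

  module _ {n} {A : Set} (_≡?_ : (a b : A) → Maybe (a ≡ b)) (denominator : A → PolyExpr n)
           (ρ : Vec Carrier n) (ι : A → Carrier)
           (inverse : ∀ a → ι a * ⟦ denominator a ⟧ₚ ρ ≈ 1#) where
    open Fractions _≡?_ denominator

    -- The reciprocal of a product of denominators.
    recip : List A → Carrier
    recip []      = 1#
    recip (k ∷ l) = ι k * recip l

    ⟦_⟧ꟳ : Fraction → Carrier
    ⟦ e , l ⟧ꟳ = ⟦ e ⟧ ρ ⊥-elim * recip l

    recip-++ : ∀ h l → recip (h ++ l) ≈ recip h * recip l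
    recip-++ []      l = sym (*-identityˡ _)
    recip-++ (k ∷ h) l = trans (*-congˡ (recip-++ h l)) (sym (*-assoc _ _ _))

    recip-prod : ∀ l → recip l * ⟦ prod l ⟧ ρ ⊥-elim ≈ 1#
    recip-prod []      = *-identityˡ 1#
    recip-prod (k ∷ l) = begin
      (ι k * recip l) * ⟦ prod (k ∷ l) ⟧ ρ ⊥-elim ≈⟨ *-congˡ (⟦simpleMul⟧ (denominator k) (prod l) ρ ⊥-elim) ⟩
      _ ≈⟨ interchange _ _ _ _ ⟩
      (ι k * ⟦ denominator k ⟧ ρ ⊥-elim) * (recip l * ⟦ prod l ⟧ ρ ⊥-elim)
        ≈⟨ *-cong (inverse k) (recip-prod l) ⟩
      1# * 1# ≈⟨ *-identityˡ 1# ⟩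
      1# ∎

    recip-extract : ∀ k l {l′} → extract k l ≡ just l′ → recip l ≈ ι k * recip l′
    recip-extract k (j ∷ l) eq with k ≡? j
    recip-extract k (.k ∷ l) ≡.refl | just ≡.refl = refl
    ... | nothing with extract k l in eq′
    recip-extract k (j ∷ l) ≡.refl | nothing | just l′ =
      trans (*-congˡ (recip-extract k l eq′)) (x∙yz≈y∙xz _ _ _)

    recip-difference : ∀ h l → recip h * recip (proj₂ (difference h l)) ≈ recip l * recip (proj₁ (difference h l))
    recip-difference []      l = *-comm _ _
    recip-difference (k ∷ h) l with extract k l in eq
    ... | just l′ = trans (*-assoc _ _ _) (trans (*-congˡ (recip-difference h l′))
      (trans (sym (*-assoc _ _ _)) (*-congʳ (sym (recip-extract k l eq)))))
    ... | nothing = trans (*-assoc _ _ _) (trans (*-congˡ (recip-difference h l)) (x∙yz≈y∙xz _ _ _))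

    extend : ∀ e h b → ⟦ simpleMul e (prod b) ⟧ ρ ⊥-elim * (recip h * recip b) ≈ ⟦ e ⟧ ρ ⊥-elim * recip h
    extend e h b = begin
      ⟦ simpleMul e (prod b) ⟧ ρ ⊥-elim * (recip h * recip b)
        ≈⟨ *-congʳ (⟦simpleMul⟧ e (prod b) ρ ⊥-elim) ⟩
      (⟦ e ⟧ ρ ⊥-elim * ⟦ prod b ⟧ ρ ⊥-elim) * (recip h * recip b)
        ≈⟨ interchange _ _ _ _ ⟩
      (⟦ e ⟧ ρ ⊥-elim * recip h) * (⟦ prod b ⟧ ρ ⊥-elim * recip b)
        ≈⟨ *-congˡ (trans (*-comm _ _) (recip-prod b)) ⟩
      (⟦ e ⟧ ρ ⊥-elim * recip h) * 1# ≈⟨ *-identityʳ _ ⟩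
      _ ∎

    -- Both fractions are extended to the common denominator h ++ b.
    ⟦addF⟧-common : ∀ e h f l → let a , b = difference h l in
      ⟦ simpleMul e (prod b) :+ simpleMul f (prod a) , h ++ b ⟧ꟳ ≈ ⟦ e , h ⟧ꟳ + ⟦ f , l ⟧ꟳ
    ⟦addF⟧-common e h f l = let a , b = difference h l in begin
      (⟦ simpleMul e (prod b) ⟧ ρ ⊥-elim + ⟦ simpleMul f (prod a) ⟧ ρ ⊥-elim) * recip (h ++ b)
        ≈⟨ trans (*-congˡ (recip-++ h b)) (distribʳ _ _ _) ⟩
      _ ≈⟨ +-cong (extend e h b) (trans (*-congˡ (recip-difference h l)) (extend f l a)) ⟩
      _ ∎

    ⟦addF⟧ : ∀ f g → ⟦ addF f g ⟧ꟳ ≈ ⟦ f ⟧ꟳ + ⟦ g ⟧ꟳ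
    ⟦addF⟧ (e , h) (f , l) with special e | special f
    ... | isZero | _      = sym (trans (+-congʳ (zeroˡ _)) (+-identityˡ _))
    ... | isOne  | isZero = sym (trans (+-congˡ (zeroˡ _)) (+-identityʳ _))
    ... | other  | isZero = sym (trans (+-congˡ (zeroˡ _)) (+-identityʳ _))
    ... | isOne  | isOne  = ⟦addF⟧-common e h f l
    ... | isOne  | other  = ⟦addF⟧-common e h f l
    ... | other  | isOne  = ⟦addF⟧-common e h f l
    ... | other  | other  = ⟦addF⟧-common e h f l

    ⟦mulF⟧ : ∀ f g → ⟦ mulF f g ⟧ꟳ ≈ ⟦ f ⟧ꟳ * ⟦ g ⟧ꟳ
    ⟦mulF⟧ (e , h) (f , l) =
      trans (*-cong (⟦simpleMul⟧ e f ρ ⊥-elim) (recip-++ h l)) (interchange _ _ _ _)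

    ⟦negF⟧ : ∀ f → ⟦ negF f ⟧ꟳ ≈ - ⟦ f ⟧ꟳ
    ⟦negF⟧ (e , h) with special e
    ... | isZero = trans (zeroˡ _) (trans (sym -0#≈0#) (-‿cong (sym (zeroˡ _))))
    ... | isOne  = sym (-‿distribˡ-* _ _)
    ... | other  = sym (-‿distribˡ-* _ _)

    ⟦fraction⟧ : ∀ e → ⟦ fraction e ⟧ꟳ ≈ ⟦ e ⟧ ρ ι
    ⟦fraction⟧ (var i)  = *-identityʳ _
    ⟦fraction⟧ (inv k)  = trans (*-identityˡ _) (*-identityʳ _)
    ⟦fraction⟧ :0       = zeroˡ _
    ⟦fraction⟧ :1       = *-identityˡ 1#
    ⟦fraction⟧ (e :+ f) =
      trans (⟦addF⟧ (fraction e) (fraction f)) (+-cong (⟦fraction⟧ e) (⟦fraction⟧ f))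
    ⟦fraction⟧ (e :* f) =
      trans (⟦mulF⟧ (fraction e) (fraction f)) (*-cong (⟦fraction⟧ e) (⟦fraction⟧ f))
    ⟦fraction⟧ (:- e)   = trans (⟦negF⟧ (fraction e)) (-‿cong (⟦fraction⟧ e))

    equal-sound : ∀ e f → equal e f ≡ true → ⟦ e ⟧ ρ ι ≈ ⟦ f ⟧ ρ ι
    equal-sound e f eq = x∙y⁻¹≈ε⇒x≈y _ _ (trans (sym (⟦fraction⟧ (e :+ (:- f))))
      (trans (*-congʳ (null-sound (proj₁ (fraction (e :+ (:- f)))) eq ρ)) (zeroˡ _)))

  polynomial-identity : ∀ {n} (e f : PolyExpr n) → null (e :+ (:- f)) ≡ true →
                        ∀ ρ → ⟦ e ⟧ₚ ρ ≈ ⟦ f ⟧ₚ ρ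
  polynomial-identity e f eq ρ = x∙y⁻¹≈ε⇒x≈y _ _ (null-sound (e :+ (:- f)) eq ρ)

-- Moves of the sites, and the local weights

-- The weights below are written over an arbitrary raw ring, so that the same
-- formulas can be read in a field and as rational expressions.
expressions : ℕ → Set → RawRing 0ℓ 0ℓ
expressions n A = record
  { Carrier = Expr n A ; _≈_ = _≡_ ; _+_ = _:+_ ; _*_ = _:*_ ; -_ = :-_ ; 0# = :0 ; 1# = :1 }

-- The effect of an operator on one site. A site that rises from 0 to 1 receives
-- an arrow ○, from 1 to 2 an arrow ●, from 0 to 2 both. No operator lowers a site:
-- the value down marks transitions whose matrix elements vanish.
data Move : Set where
  stay  : Move
  raise : Decoration → Move
  leap  : Move
  down  : Move

move : (from to : Fin 3) → Move
move 0F 0F = stay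
move 0F 1F = raise ○
move 0F 2F = leap
move 1F 1F = stay
move 1F 2F = raise ●
move 2F 2F = stay
move 1F 0F = down
move 2F 0F = down
move 2F 1F = down

-- The number of arrows that a move adds. The value 5 marks lowered sites: it
-- exceeds the at most four arrows that a product of two operators can add.
arrows : Move → ℕ
arrows stay      = 0
arrows (raise _) = 1
arrows leap      = 2
arrows down      = 5

-- In a product of two operators the right factor acts first (the early step) and
-- the left factor second (the late step). A site that rises by one or by two
-- arrows in total has two or three ways to share them between the steps; the
-- index counts the arrows that are added early. The site starts in state 0: a
-- site that rises from 1 to 2 is later replaced by one that rises from 0 to 1.
data Kind : Set where
  single double : Kind

data Placement : Kind → Set where
  S₀ S₁    : Placement single
  D₀ D₁ D₂ : Placement double

top : Kind → Fin 3
top single = 1F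
top double = 2F

middle : ∀ {κ} → Placement κ → Fin 3
middle S₀ = 0F
middle S₁ = 1F
middle D₀ = 0F
middle D₁ = 1F
middle D₂ = 2F

early late : ∀ {κ} → Placement κ → Move
early     p = move 0F (middle p)
late  {κ} p = move (middle p) (top κ)

-- A site, named by an element of H, with the placement of its arrows.
data Mark {h} (H : Set h) : Set h where
  mark : ∀ {κ} → Placement κ → H → Mark H

earlyTotal lateTotal : ∀ {h} {H : Set h} → List (Mark H) → ℕ
earlyTotal []              = 0
earlyTotal (mark p _ ∷ ms) = arrows (early p) ℕ.+ earlyTotal ms
lateTotal []              = 0
lateTotal (mark p _ ∷ ms) = arrows (late p) ℕ.+ lateTotal ms

-- The histories t, r, s of a site through the two steps that never lower it.
data Path : (t r s : Fin 3) → Set where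
  idle  : ∀ c → Path c c c
  plain : ∀ {κ} (p : Placement κ) → Path 0F (middle p) (top κ)
  ●₀    : Path 1F 1F 2F
  ●₁    : Path 1F 2F 2F

-- A site that rises from 1 to 2 is recorded as a single arrow ●; idle sites are
-- forgotten.
toMark : ∀ {I : Set} {t r s} → Path t r s → I → Maybe (Mark (Decoration × I))
toMark (idle c)  i = nothing
toMark (plain p) i = just (mark p (○ , i))
toMark ●₀        i = just (mark S₀ (● , i))
toMark ●₁        i = just (mark S₁ (● , i))

module MarkSums {c ℓ} (R : RawRing c ℓ) where

  open RawRing R

  module _ {h} {H : Set h} where

    -- The sum over all placements of the arrows of a list of sites.
    placements : List (Kind × H) → (List (Mark H) → Carrier) → Carrier
    placements []                 f = f []
    placements ((single , h) ∷ L) f =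
      placements L (λ ms → f (mark S₀ h ∷ ms)) + placements L (λ ms → f (mark S₁ h ∷ ms))
    placements ((double , h) ∷ L) f =
      placements L (λ ms → f (mark D₀ h ∷ ms)) +
      (placements L (λ ms → f (mark D₁ h ∷ ms)) + placements L (λ ms → f (mark D₂ h ∷ ms)))

    -- The product of w over the marks and of u over the pairs of marks, the pairs
    -- being absorbed into w from the left.
    weight : (Mark H → Mark H → Carrier) → (Mark H → Carrier) → List (Mark H) → Carrier
    weight u w []       = 1#
    weight u w (m ∷ ms) = w m * weight u (λ m′ → w m′ * u m m′) ms

    siteOf : (Mark H → Carrier) → Maybe (Mark H) → Carrier
    siteOf w (just m) = w m
    siteOf w nothing  = 1#

    pairOf : (Mark H → Mark H → Carrier) → Maybe (Mark H) → Maybe (Mark H) → Carrier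
    pairOf u (just m) (just m′) = u m m′
    pairOf u _        _         = 1#

-- The matrix element from t to s of Γ_k(z) is a product over the sites and over the
-- pairs of sites. In the factors the reciprocals occur as separate arguments.
module LocalWeights {c ℓ} (R : RawRing c ℓ) (q 1/q 1/[1+q] : RawRing.Carrier R) where

  open RawRing R
  open MarkSums R
  open RawSemiringDefinitions rawSemiring using (_^_)

  infixl 6 _-_
  _-_ : Carrier → Carrier → Carrier
  x - y = x + (- y)

  -- The factor common to all terms of Γ_k(z). It is the same for k = 1 and k = 2,
  -- because the coefficient of e_ij cancels one of the two factors of e_i e_j.
  prefactor : Carrier → ℕ → Carrier
  prefactor z zero    = 1#
  prefactor z (suc _) = (1# - q ^ 2) * z

  module _ (z x p p′ : Carrier) where

    -- p = 1/(x - q²z) and p′ = 1/(x - q³z)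
    siteWeight : Fin 3 → Move → Carrier
    siteWeight _  (raise ○) = p
    siteWeight _  (raise ●) = q * (1# - q) * (x - z) * (p * p′)
    siteWeight _  leap      = (x + q ^ 2 * x - q ^ 2 * z - q ^ 3 * z) * (p * p′)
    siteWeight _  down      = 0#
    siteWeight 0F stay      = 1#
    siteWeight 1F stay      = (x - z) * p
    siteWeight 2F stay      = (x - z) * (x - q * z) * (p * p′)

  module _ (x w d e e′ : Carrier) where

    -- The entry of d°(w), d●(w) or d●○(w) at an idle site with letter x, where w is
    -- the letter of a site that moves; d = 1/(x - w), e = 1/(x - qw) and
    -- e′ = 1/(w - qx).
    dressing : Fin 3 → Move → Carrier
    dressing _  stay      = 1#
    dressing 0F _         = 1#
    dressing 1F (raise ○) = (q * x - w) * (x - q ^ 2 * w) * (1/[1+q] * d)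
    dressing 1F (raise ●) = (1# + q) * (- e′)
    dressing 1F leap      = (x - q ^ 2 * w) * d
    dressing 2F (raise ○) = (x - q ^ 3 * w) * e
    dressing 2F (raise ●) = (x - q ^ 2 * w) * d
    dressing 2F leap      = (x - q ^ 2 * w) * (x - q ^ 3 * w) * (d * e)
    dressing _  down      = 0#

  module _ (z x w d e e′ : Carrier) where

    -- The coefficient of e_ij, multiplied by (1 - q²)z, for two sites with letters x
    -- and w that receive one arrow each. It is 0 if more than two arrows are added:
    -- such terms do not occur.
    jointWeight : Move → Move → Carrier
    jointWeight (raise ○) (raise ○) =
      x * w + q ^ 2 * x * w - q ^ 2 * x * z - q ^ 2 * w * z
    jointWeight (raise ●) (raise ○) =
      (1# + q) * (x * w + q ^ 2 * x * w - q ^ 2 * x * z - q ^ 3 * w * z) * (1/q * d)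
    jointWeight (raise ○) (raise ●) =
      (1# + q) * (x * w + q ^ 2 * x * w - q ^ 3 * x * z - q ^ 2 * w * z) * (1/q * (- d))
    jointWeight (raise ●) (raise ●) =
      (1# + q) ^ 2 * (x * w + q ^ 2 * x * w - q ^ 3 * x * z - q ^ 3 * w * z) * (1/q * (e * e′))
    jointWeight _ _ = 0#

    -- The factor of a pair of sites: an idle site is dressed by the other one.
    pairWeight : Fin 3 → Move → Fin 3 → Move → Carrier
    pairWeight a stay b m    = dressing x w d e e′ a m
    pairWeight a m    b stay = dressing w x (- d) e′ e b m
    pairWeight a m    b m′   = jointWeight m m′

  -- The vertex weight W_{y/x}(i,j;k,l), where u = 1/(x - q²y) and v = 1/(x - q³y).
  crossing : (x y u v : Carrier) (i j k l : Fin 3) → Carrier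
  crossing x y u v 0F 0F 0F 0F = 1#
  crossing x y u v 2F 2F 2F 2F = 1#
  crossing x y u v 1F 0F 1F 0F = q ^ 2 * (x - y) * u
  crossing x y u v 2F 1F 2F 1F = q ^ 2 * (x - y) * u
  crossing x y u v 1F 0F 0F 1F = (1# - q ^ 2) * x * u
  crossing x y u v 2F 1F 1F 2F = (1# - q ^ 2) * x * u
  crossing x y u v 0F 1F 1F 0F = (1# - q ^ 2) * y * u
  crossing x y u v 1F 2F 2F 1F = (1# - q ^ 2) * y * u
  crossing x y u v 0F 1F 0F 1F = (x - y) * u
  crossing x y u v 1F 2F 1F 2F = (x - y) * u
  crossing x y u v 2F 0F 2F 0F = q ^ 4 * (x - y) * (x - q * y) * (u * v)
  crossing x y u v 2F 0F 1F 1F =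
    (- (q * (1# - q) ^ 2 * (1# + q) * x * (x - y))) * (u * v)
  crossing x y u v 2F 0F 0F 2F =
    (1# - q ^ 2) * x * (x + q * x - q * y - q ^ 3 * y) * (u * v)
  crossing x y u v 1F 1F 2F 0F = (- (q ^ 4 * (1# + q) * (x - y) * y)) * (u * v)
  crossing x y u v 1F 1F 1F 1F =
    (- (q * x ^ 2) + (1# + q) * (1# - q ^ 2 + q ^ 4) * x * y - q ^ 4 * y ^ 2) * (u * v)
  crossing x y u v 1F 1F 0F 2F = (1# + q) * x * (x - y) * (u * v)
  crossing x y u v 0F 2F 2F 0F =
    (1# - q ^ 2) * (x + q ^ 2 * x - q ^ 2 * y - q ^ 3 * y) * y * (u * v)
  crossing x y u v 0F 2F 1F 1F =
    q * (1# - q) ^ 2 * (1# + q) * (x - y) * y * (u * v)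
  crossing x y u v 0F 2F 0F 2F = (x - y) * (x - q * y) * (u * v)
  crossing x y u v _  _  _  _  = 0#

  ∑₃ : (Fin 3 → Carrier) → Carrier
  ∑₃ = foldr _+_ 0#

  -- A spectral parameter z with the reciprocals of x - q²z (reach) and x - q³z
  -- (reach′) for the letters x of the sites in H.
  record Spectral {h} (H : Set h) : Set (c ⊔ h) where
    field
      value       : Carrier
      reach reach′ : H → Carrier

  -- The product of two operators on sites that start in state 0. A site is given
  -- by a letter a; d, e and e′ are the reciprocals that dressing and jointWeight
  -- require for a pair of sites.
  module TwoSteps {h} {H : Set h} (a : H → Carrier) (d e e′ : H → H → Carrier) where

    open Spectral

    module _ (Z Y : Spectral H) where

      private
        z = value Z
        y = value Y

      markSite : Mark H → Carrier
      markSite (mark p h) =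
        siteWeight z (a h) (reach Z h) (reach′ Z h) (middle p) (late p) *
        siteWeight y (a h) (reach Y h) (reach′ Y h) 0F (early p)

      markPair : Mark H → Mark H → Carrier
      markPair (mark p h) (mark p′ h′) =
        pairWeight z (a h) (a h′) (d h h′) (e h h′) (e′ h h′) (middle p) (late p) (middle p′) (late p′) *
        pairWeight y (a h) (a h′) (d h h′) (e h h′) (e′ h h′) 0F (early p) 0F (early p′)

      -- Only placements with k late and l early arrows contribute to Γ_k(z) Γ_l(y).
      selected : ℕ → ℕ → List (Mark H) → Carrier
      selected k l ms =
        if (lateTotal ms ℕ.≡ᵇ k) ∧ (earlyTotal ms ℕ.≡ᵇ l) then weight markPair markSite ms else 0#

      twoSteps : ℕ → ℕ → List (Kind × H) → Carrier
      twoSteps k l L = prefactor z k * prefactor y l * placements L (selected k l)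

    -- The right-hand side of the exchange relation.
    exchanged : (u v : Carrier) (Z Y : Spectral H) (k l : Fin 3) → List (Kind × H) → Carrier
    exchanged u v Z Y k l L = ∑₃ λ i → ∑₃ λ j →
      crossing (value Y) (value Z) u v i j k l * twoSteps Y Z (toℕ j) (toℕ i) L

  -- An arrow ○ at a site with letter x has the letter x, an arrow ● the letter x/q.
  -- In terms of the letters of the arrows both kinds have the same weights, up to
  -- factors (siteGauge, pairGauge) that do not depend on the step in which the
  -- arrow is added. Here δ i j = 1/(x i - x j) and κ i j = 1/(x i - q x j).
  module Sites {I : Set} (x : I → Carrier) (δ κ : I → I → Carrier) where

    open Spectral

    letterOf : Decoration × I → Carrier
    letterOf (○ , i) = x i
    letterOf (● , i) = x i * 1/q

    -- 1/(a - b) for the letters a and b of two arrows.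
    difference : Decoration × I → Decoration × I → Carrier
    difference (○ , i) (○ , j) = δ i j
    difference (● , i) (○ , j) = q * κ i j
    difference (○ , i) (● , j) = - (q * κ j i)
    difference (● , i) (● , j) = q * δ i j

    -- 1/(a - qb) and 1/(b - qa) for the letters a and b of two arrows. They enter
    -- only if the first, respectively the second, site rises from 0 to 2 and is
    -- hence listed under ○; the value 0 in the other cases is arbitrary.
    q-difference : Decoration × I → Decoration × I → Carrier
    q-difference (○ , i) (○ , j) = κ i j
    q-difference (○ , i) (● , j) = δ i j
    q-difference (● , i) _       = 0#

    q-difference′ : Decoration × I → Decoration × I → Carrier
    q-difference′ (○ , i) (○ , j) = κ j i
    q-difference′ (● , i) (○ , j) = - δ i j
    q-difference′ (_ , i) (● , j) = 0#

    open TwoSteps letterOf difference q-difference q-difference′ public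

    arrowSpectral : Spectral I → Spectral (Decoration × I)
    arrowSpectral Z = record
      { value  = value Z
      ; reach  = λ where (○ , i) → reach Z i
                         (● , i) → q * reach′ Z i
      ; reach′ = λ where (_ , i) → reach′ Z i
      }

    -- The factors of the matrix element from t to s.
    site : Spectral I → I → Fin 3 → Fin 3 → Carrier
    site Z i t s = siteWeight (value Z) (x i) (reach Z i) (reach′ Z i) t (move t s)

    pair : Spectral I → I → I → Fin 3 → Fin 3 → Fin 3 → Fin 3 → Carrier
    pair Z i j t s t′ s′ =
      pairWeight (value Z) (x i) (x j) (δ i j) (κ i j) (κ j i) t (move t s) t′ (move t′ s′)

    module _ (Z Y : Spectral I) where

      siteGauge : I → Fin 3 → Move → Carrier
      siteGauge i c stay      = site Z i c c * site Y i c c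
      siteGauge i c (raise ○) = 1#
      siteGauge i c (raise ●) =
        (1# - q) * ((x i - value Z) * reach Z i) * ((x i - value Y) * reach Y i)
      siteGauge i c leap      = 1#
      siteGauge i c down      = 0#

      -- The factor of a site in a product of two operators, for a given path, and the
      -- same factor in terms of the letter of the arrow that is added.
      siteSteps siteNormal : ∀ i {t r s} → Path t r s → Carrier
      siteSteps i {t} {r} {s} π = site Z i r s * site Y i t r
      siteNormal i {t} {r} {s} π =
        siteGauge i t (move t s) * siteOf (markSite (arrowSpectral Z) (arrowSpectral Y)) (toMark π i)

    pairGauge : I → I → Fin 3 → Move → Fin 3 → Move → Carrier
    pairGauge i j c stay       c′ m         = dressing (x i) (x j) (δ i j) (κ i j) (κ j i) c m
    pairGauge i j c m          c′ stay      = dressing (x j) (x i) (- δ i j) (κ j i) (κ i j) c′ m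
    pairGauge i j c (raise ●)  c′ (raise ○) = (1# + q) * δ i j
    pairGauge i j c (raise ○)  c′ (raise ●) = (1# + q) * (- δ i j)
    pairGauge i j c (raise ●)  c′ (raise ●) = (1# + q) ^ 2 * (q * (κ i j * κ j i))
    pairGauge i j c (raise ●)  c′ leap      = (x i - q ^ 2 * x j) * δ i j
    pairGauge i j c leap       c′ (raise ●) = (x j - q ^ 2 * x i) * (- δ i j)
    pairGauge i j c _          c′ _         = 1#

    module _ (Z Y : Spectral I) where

      -- The same for a pair of sites.
      pairSteps pairNormal : ∀ i j {t r s t′ r′ s′} → Path t r s → Path t′ r′ s′ → Carrier
      pairSteps i j {t} {r} {s} {t′} {r′} {s′} π π′ = pair Z i j r s r′ s′ * pair Y i j t r t′ r′
      pairNormal i j {t} {r} {s} {t′} {r′} {s′} π π′ =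
        pairGauge i j t (move t s) t′ (move t′ s′) *
        pairOf (markPair (arrowSpectral Z) (arrowSpectral Y)) (toMark π i) (toMark π′ j)

-- The exchange relations for at most four arrows

-- Names for the denominators in the exchange relation for m sites in state 0.
data Denominator (m : ℕ) : Set where
  ofU ofV ofQ of1+Q : Denominator m
  ofZ ofZ′ ofY ofY′ : Fin m → Denominator m
  ofD ofE ofE′      : Fin m → Fin m → Denominator m

sameFin : ∀ {m} (i j : Fin m) → Maybe (i ≡ j)
sameFin i j with i Fin.≟ j
... | yes eq = just eq
... | no  _  = nothing

same : ∀ {m} (a b : Denominator m) → Maybe (a ≡ b)
same ofU       ofU       = just ≡.refl
same ofV       ofV       = just ≡.refl
same ofQ       ofQ       = just ≡.refl
same of1+Q     of1+Q     = just ≡.refl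
same (ofZ  i)  (ofZ  j)  = Maybe.map (≡.cong ofZ ) (sameFin i j)
same (ofZ′ i)  (ofZ′ j)  = Maybe.map (≡.cong ofZ′) (sameFin i j)
same (ofY  i)  (ofY  j)  = Maybe.map (≡.cong ofY ) (sameFin i j)
same (ofY′ i)  (ofY′ j)  = Maybe.map (≡.cong ofY′) (sameFin i j)
same (ofD  i k) (ofD  j l) = Maybe.zipWith (≡.cong₂ ofD ) (sameFin i j) (sameFin k l)
same (ofE  i k) (ofE  j l) = Maybe.zipWith (≡.cong₂ ofE ) (sameFin i j) (sameFin k l)
same (ofE′ i k) (ofE′ j l) = Maybe.zipWith (≡.cong₂ ofE′) (sameFin i j) (sameFin k l)
same _         _         = nothing

items : ∀ {h} {H : Set h} (κs : List Kind) → Vec H (length κs) → List (Kind × H)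
items []       []       = []
items (κ ∷ κs) (h ∷ hs) = (κ , h) ∷ items κs hs

module _ {A : Set} {m : ℕ} where
  private E = Expr (3 ℕ.+ m) A
  varQ varZ varY : E
  varQ = var 0F
  varZ = var 1F
  varY = var 2F
  varA : Fin m → E
  varA i = var (suc (suc (suc i)))

if-double : ∀ {a} {A : Set a} → A → Kind → A → A
if-double default single _ = default
if-double default double x = x

-- Both sides of the exchange relation as rational expressions in q, z, y and the
-- letters of the sites.
module Symbolic (κs : List Kind) where
  private m = length κs
  E = Expr (3 ℕ.+ m) (Denominator m)
  open LocalWeights (expressions (3 ℕ.+ m) (Denominator m)) varQ (inv ofQ) (inv of1+Q) public
  Zᵉ Yᵉ : Spectral (Fin m)
  Zᵉ = record { value = varZ ; reach = λ i → inv (ofZ i) ; reach′ = λ i → inv (ofZ′ i) }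
  Yᵉ = record { value = varY ; reach = λ i → inv (ofY i) ; reach′ = λ i → inv (ofY′ i) }
  open TwoSteps {H = Fin m} varA (λ i j → inv (ofD i j)) (λ i j → inv (ofE i j)) (λ i j → inv (ofE′ i j)) public

  Lᵉ : List (Kind × Fin m)
  Lᵉ = items κs (Vec.allFin m)

  lhsᵉ rhsᵉ : Fin 3 → Fin 3 → E
  lhsᵉ k l = twoSteps Zᵉ Yᵉ (toℕ k) (toℕ l) Lᵉ
  rhsᵉ k l = exchanged (inv ofU) (inv ofV) Zᵉ Yᵉ k l Lᵉ

  module P = LocalWeights (expressions (3 ℕ.+ m) ⊥) varQ :1 :1
  open import Algebra.Definitions.RawSemiring (RawRing.rawSemiring (expressions (3 ℕ.+ m) ⊥)) using (_^_)

  kind : Fin m → Kind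
  kind = List.lookup κs

  -- Denominators that do not occur are replaced by 1: those for i not before j,
  -- and those that belong to sites rising by two arrows if the site rises by one.
  if-before : Fin m → Fin m → PolyExpr (3 ℕ.+ m) → PolyExpr (3 ℕ.+ m)
  if-before i j e = if toℕ i ℕ.<ᵇ toℕ j then e else :1

  denominator : Denominator m → PolyExpr (3 ℕ.+ m)
  denominator ofU       = varY P.- varQ ^ 2 :* varZ
  denominator ofV       = varY P.- varQ ^ 3 :* varZ
  denominator ofQ       = varQ
  denominator of1+Q     = :1 :+ varQ
  denominator (ofZ  i)  = varA i P.- varQ ^ 2 :* varZ
  denominator (ofZ′ i)  = if-double :1 (kind i) (varA i P.- varQ ^ 3 :* varZ)
  denominator (ofY  i)  = varA i P.- varQ ^ 2 :* varY
  denominator (ofY′ i)  = if-double :1 (kind i) (varA i P.- varQ ^ 3 :* varY)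
  denominator (ofD i j) = if-before i j (varA i P.- varA j)
  denominator (ofE i j) = if-before i j (if-double :1 (kind i) (varA i P.- varQ :* varA j))
  denominator (ofE′ i j) = if-before i j (if-double :1 (kind j) (varA j P.- varQ :* varA i))

  open Fractions same denominator

  verified : Fin 3 → Fin 3 → Bool
  verified k l = equal (lhsᵉ k l) (rhsᵉ k l)

all-items : ∀ {h p} {H : Set h} {P : Kind × H → Set p} (κs : List Kind) hs →
            All P (items κs hs) → ∀ i → P (List.lookup κs i , lookup hs i)
all-items (κ ∷ κs) (h ∷ hs) (px ∷ _)  zero    = px
all-items (κ ∷ κs) (h ∷ hs) (_ ∷ pxs) (suc i) = all-items κs hs pxs i

all-item-pairs : ∀ {h p} {H : Set h} {R : Kind × H → Kind × H → Set p} (κs : List Kind) hs →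
  AllPairs R (items κs hs) → ∀ i j → T (toℕ i ℕ.<ᵇ toℕ j) →
  R (List.lookup κs i , lookup hs i) (List.lookup κs j , lookup hs j)
all-item-pairs (κ ∷ κs) (h ∷ hs) (px ∷ _)  zero    (suc j) _   = all-items κs hs px j
all-item-pairs (κ ∷ κs) (h ∷ hs) (_ ∷ pxs) (suc i) (suc j) i<j = all-item-pairs κs hs pxs i j i<j

-- The lists of sites that carry n arrows in total.
data Shape {h} {H : Set h} : ℕ → List (Kind × H) → Set h where
  done : Shape 0 []
  S∷_  : ∀ {n h L} → Shape n L → Shape (1 ℕ.+ n) ((single , h) ∷ L)
  D∷_  : ∀ {n h L} → Shape n L → Shape (2 ℕ.+ n) ((double , h) ∷ L)

infixr 5 S∷_ D∷_

module ExchangeIdentities {c ℓ} (R : CommutativeRing c ℓ) where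

  open CommutativeRing R

  module Exchange (q 1/q 1/[1+q] : Carrier) (q-inverse : 1/q * q ≈ 1#) (1+q-inverse : 1/[1+q] * (1# + q) ≈ 1#)
                  {h} {H : Set h} (a : H → Carrier) (d e e′ : H → H → Carrier) where

    open LocalWeights rawRing q 1/q 1/[1+q] hiding (_-_)
    open TwoSteps a d e e′
    open Spectral
    open RawSemiringDefinitions (RawRing.rawSemiring rawRing) using (_^_)

    -- The reciprocals that occur for one site and for a pair of sites.
    record Reaches (Z : Spectral H) (κ,x : Kind × H) : Set ℓ where
      field
        reaches  : reach Z (proj₂ κ,x) * (a (proj₂ κ,x) - q ^ 2 * value Z) ≈ 1#
        reaches′ : proj₁ κ,x ≡ double → reach′ Z (proj₂ κ,x) * (a (proj₂ κ,x) - q ^ 3 * value Z) ≈ 1#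

    -- The reciprocals for a site that rises by two arrows include those of the
    -- differences with a factor q.
    record Separates (κ,x μ,y : Kind × H) : Set ℓ where
      private
        x = proj₂ κ,x
        y = proj₂ μ,y
      field
        separates   : d x y * (a x - a y) ≈ 1#
        separatesˡ : proj₁ κ,x ≡ double → e x y * (a x - q * a y) ≈ 1#
        separatesʳ : proj₁ μ,y ≡ double → e′ x y * (a y - q * a x) ≈ 1#

    open Reaches
    open Separates

    module _ (u v : Carrier) (Z Y : Spectral H)
             (u-inverse : u * (value Y - q ^ 2 * value Z) ≈ 1#)
             (v-inverse : v * (value Y - q ^ 3 * value Z) ≈ 1#) where

      module _ (κs : List Kind) (hs : Vec H (length κs))
               (Z-reaches : All (Reaches Z) (items κs hs))
               (Y-reaches : All (Reaches Y) (items κs hs))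
               (separate : AllPairs Separates (items κs hs)) where

        open Symbolic κs using (denominator; verified; lhsᵉ; rhsᵉ; kind)
        open Semantics R

        ρ : Vec Carrier (3 ℕ.+ length κs)
        ρ = q ∷ value Z ∷ value Y ∷ Vec.map a hs

        x : Fin (length κs) → H
        x = lookup hs

        ι : Denominator (length κs) → Carrier
        ι ofU       = u
        ι ofV       = v
        ι ofQ       = 1/q
        ι of1+Q     = 1/[1+q]
        ι (ofZ  i)  = reach Z (x i)
        ι (ofZ′ i)  = if-double 1# (kind i) (reach′ Z (x i))
        ι (ofY  i)  = reach Y (x i)
        ι (ofY′ i)  = if-double 1# (kind i) (reach′ Y (x i))
        ι (ofD i j) = if toℕ i ℕ.<ᵇ toℕ j then d (x i) (x j) else 1#
        ι (ofE i j) = if toℕ i ℕ.<ᵇ toℕ j then if-double 1# (kind i) (e (x i) (x j)) else 1#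
        ι (ofE′ i j) = if toℕ i ℕ.<ᵇ toℕ j then if-double 1# (kind j) (e′ (x i) (x j)) else 1#

        private
          1*1 : 1# * 1# ≈ 1#
          1*1 = *-identityˡ 1#

          double-law : ∀ κ {t e} → (κ ≡ double → t * ⟦ e ⟧ₚ ρ ≈ 1#) →
                       if-double 1# κ t * ⟦ if-double :1 κ e ⟧ₚ ρ ≈ 1#
          double-law single _  = 1*1
          double-law double eq = eq ≡.refl

          before-law : ∀ b {t e} → (T b → t * ⟦ e ⟧ₚ ρ ≈ 1#) →
                       (if b then t else 1#) * ⟦ if b then e else :1 ⟧ₚ ρ ≈ 1#
          before-law false _  = 1*1
          before-law true  eq = eq tt

          at : ∀ (P : Carrier → Set ℓ) i → P (a (x i)) → P (lookup (Vec.map a hs) i)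
          at P i = ≡.subst P (≡.sym (Vec.lookup-map i a hs))

          at₂ : ∀ (P : Carrier → Carrier → Set ℓ) i j → P (a (x i)) (a (x j)) →
                P (lookup (Vec.map a hs) i) (lookup (Vec.map a hs) j)
          at₂ P i j px = at (λ t → P t _) i (at (P _) j px)

        inverse : ∀ k → ι k * ⟦ denominator k ⟧ₚ ρ ≈ 1#
        inverse ofU       = u-inverse
        inverse ofV       = v-inverse
        inverse ofQ       = q-inverse
        inverse of1+Q     = 1+q-inverse
        inverse (ofZ  i)  = at (λ t → _ * (t - _) ≈ 1#) i (reaches (all-items κs hs Z-reaches i))
        inverse (ofZ′ i)  = double-law (kind i) λ eq →
          at (λ t → _ * (t - _) ≈ 1#) i (reaches′ (all-items κs hs Z-reaches i) eq)
        inverse (ofY  i)  = at (λ t → _ * (t - _) ≈ 1#) i (reaches (all-items κs hs Y-reaches i))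
        inverse (ofY′ i)  = double-law (kind i) λ eq →
          at (λ t → _ * (t - _) ≈ 1#) i (reaches′ (all-items κs hs Y-reaches i) eq)
        inverse (ofD i j) = before-law (toℕ i ℕ.<ᵇ toℕ j) λ i<j →
          at₂ (λ s t → _ * (s - t) ≈ 1#) i j (separates (all-item-pairs κs hs separate i j i<j))
        inverse (ofE i j) = before-law (toℕ i ℕ.<ᵇ toℕ j) λ i<j → double-law (kind i) λ eq →
          at₂ (λ s t → _ * (s - q * t) ≈ 1#) i j (separatesˡ (all-item-pairs κs hs separate i j i<j) eq)
        inverse (ofE′ i j) = before-law (toℕ i ℕ.<ᵇ toℕ j) λ i<j → double-law (kind j) λ eq →
          at₂ (λ s t → _ * (t - q * s) ≈ 1#) i j (separatesʳ (all-item-pairs κs hs separate i j i<j) eq)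

        by-evaluation : ∀ k l → verified k l ≡ true → ⟦ lhsᵉ k l ⟧ ρ ι ≈ ⟦ rhsᵉ k l ⟧ ρ ι
        by-evaluation k l = FractionSound.equal-sound R same denominator ρ ι inverse (lhsᵉ k l) (rhsᵉ k l)

      -- Twenty identities between rational functions, one for each k, l and each list
      -- of sites with k + l arrows. The case of four single arrows is the largest.
      -- Sites that rise from 0 to 2 cannot be treated as two single arrows: the
      -- weights of all placements would share the factor x - q²a, where x is the
      -- letter of the site and a that of another arrow, and x - q²a may vanish.
      exchange : ∀ k l {L} → Shape (toℕ k ℕ.+ toℕ l) L →
                 All (Reaches Z) L → All (Reaches Y) L → AllPairs Separates L →
                 twoSteps Z Y (toℕ k) (toℕ l) L ≈ exchanged u v Z Y k l L
      exchange 0F 0F done r s t = by-evaluation [] [] r s t 0F 0F ≡.refl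
      exchange 0F 1F (S∷_ {h = h} done) r s t = by-evaluation (single ∷ []) (h ∷ []) r s t 0F 1F ≡.refl
      exchange 1F 0F (S∷_ {h = h} done) r s t = by-evaluation (single ∷ []) (h ∷ []) r s t 1F 0F ≡.refl
      exchange 0F 2F (D∷_ {h = h} done) r s t = by-evaluation (double ∷ []) (h ∷ []) r s t 0F 2F ≡.refl
      exchange 1F 1F (D∷_ {h = h} done) r s t = by-evaluation (double ∷ []) (h ∷ []) r s t 1F 1F ≡.refl
      exchange 2F 0F (D∷_ {h = h} done) r s t = by-evaluation (double ∷ []) (h ∷ []) r s t 2F 0F ≡.refl
      exchange 0F 2F (S∷_ {h = h} (S∷_ {h = h′} done)) r s t =
        by-evaluation (single ∷ single ∷ []) (h ∷ h′ ∷ []) r s t 0F 2F ≡.refl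
      exchange 1F 1F (S∷_ {h = h} (S∷_ {h = h′} done)) r s t =
        by-evaluation (single ∷ single ∷ []) (h ∷ h′ ∷ []) r s t 1F 1F ≡.refl
      exchange 2F 0F (S∷_ {h = h} (S∷_ {h = h′} done)) r s t =
        by-evaluation (single ∷ single ∷ []) (h ∷ h′ ∷ []) r s t 2F 0F ≡.refl
      exchange 1F 2F (S∷_ {h = h} (D∷_ {h = h′} done)) r s t =
        by-evaluation (single ∷ double ∷ []) (h ∷ h′ ∷ []) r s t 1F 2F ≡.refl
      exchange 2F 1F (S∷_ {h = h} (D∷_ {h = h′} done)) r s t =
        by-evaluation (single ∷ double ∷ []) (h ∷ h′ ∷ []) r s t 2F 1F ≡.refl
      exchange 1F 2F (D∷_ {h = h} (S∷_ {h = h′} done)) r s t =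
        by-evaluation (double ∷ single ∷ []) (h ∷ h′ ∷ []) r s t 1F 2F ≡.refl
      exchange 2F 1F (D∷_ {h = h} (S∷_ {h = h′} done)) r s t =
        by-evaluation (double ∷ single ∷ []) (h ∷ h′ ∷ []) r s t 2F 1F ≡.refl
      exchange 1F 2F (S∷_ {h = h} (S∷_ {h = h′} (S∷_ {h = h″} done))) r s t =
        by-evaluation (single ∷ single ∷ single ∷ []) (h ∷ h′ ∷ h″ ∷ []) r s t 1F 2F ≡.refl
      exchange 2F 1F (S∷_ {h = h} (S∷_ {h = h′} (S∷_ {h = h″} done))) r s t =
        by-evaluation (single ∷ single ∷ single ∷ []) (h ∷ h′ ∷ h″ ∷ []) r s t 2F 1F ≡.refl
      exchange 2F 2F (D∷_ {h = h} (D∷_ {h = h′} done)) r s t =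
        by-evaluation (double ∷ double ∷ []) (h ∷ h′ ∷ []) r s t 2F 2F ≡.refl
      exchange 2F 2F (D∷_ {h = h} (S∷_ {h = h′} (S∷_ {h = h″} done))) r s t =
        by-evaluation (double ∷ single ∷ single ∷ []) (h ∷ h′ ∷ h″ ∷ []) r s t 2F 2F ≡.refl
      exchange 2F 2F (S∷_ {h = h} (D∷_ {h = h′} (S∷_ {h = h″} done))) r s t =
        by-evaluation (single ∷ double ∷ single ∷ []) (h ∷ h′ ∷ h″ ∷ []) r s t 2F 2F ≡.refl
      exchange 2F 2F (S∷_ {h = h} (S∷_ {h = h′} (D∷_ {h = h″} done))) r s t =
        by-evaluation (single ∷ single ∷ double ∷ []) (h ∷ h′ ∷ h″ ∷ []) r s t 2F 2F ≡.refl
      exchange 2F 2F (S∷_ {h = h} (S∷_ {h = h′} (S∷_ {h = h″} (S∷_ {h = h‴} done)))) r s t =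
        by-evaluation (single ∷ single ∷ single ∷ single ∷ []) (h ∷ h′ ∷ h″ ∷ h‴ ∷ []) r s t 2F 2F ≡.refl

-- The sum over intermediate states

totalArrows : ∀ {n} → State n → State n → ℕ
totalArrows []      []      = 0
totalArrows (a ∷ t) (b ∷ s) = arrows (move a b) ℕ.+ totalArrows t s

-- The sites that move between t and s, with their number of arrows.
item : ∀ {I : Set} → Fin 3 → Fin 3 → I → List (Kind × (Decoration × I)) → List (Kind × (Decoration × I))
item 0F 1F i L = (single , ○ , i) ∷ L
item 1F 2F i L = (single , ● , i) ∷ L
item 0F 2F i L = (double , ○ , i) ∷ L
item _  _  i L = L

itemsBetween : ∀ {I : Set} {n} → State n → State n → (Fin n → I) → List (Kind × (Decoration × I))
itemsBetween []      []      θ = []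
itemsBetween (a ∷ t) (b ∷ s) θ = item a b (θ 0F) (itemsBetween t s (θ ∘ suc))

-- The selections of the numbers of late and early arrows that exclude lowered sites.
Bounded : (ℕ → ℕ → Bool) → Set
Bounded φ = ∀ n m → 5 ≤ n ⊎ 5 ≤ m → φ n m ≡ false

module Triangles {c ℓ} (R : CommutativeRing c ℓ) where
  open CommutativeRing R

  -- The product of w over the sites and of u over the pairs i < j, in the form in
  -- which the first site can be split off.
  triangle : ∀ {n} → (Fin n → Carrier) → (Fin n → Fin n → Carrier) → Carrier
  triangle {zero}  w u = 1#
  triangle {suc n} w u =
    w 0F * triangle (λ j → w (suc j) * u 0F (suc j)) (λ i j → u (suc i) (suc j))

  triangle-cong : ∀ {n} {w w′ : Fin n → Carrier} {u u′ : Fin n → Fin n → Carrier} →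
                  (∀ i → w i ≈ w′ i) → (∀ i j → i Fin.< j → u i j ≈ u′ i j) →
                  triangle w u ≈ triangle w′ u′
  triangle-cong {zero}  w≈ u≈ = refl
  triangle-cong {suc n} w≈ u≈ = *-cong (w≈ 0F)
    (triangle-cong (λ j → *-cong (w≈ (suc j)) (u≈ 0F (suc j) (s≤s z≤n))) (λ i j i<j → u≈ (suc i) (suc j) (s≤s i<j)))

module Collapse {c ℓ₁ ℓ₂} (F : HeytingField c ℓ₁ ℓ₂) where
  open FieldNotation F
  open Operators F
  open Triangles commutativeRing
  open import Algebra.Properties.CommutativeSemigroup (CommutativeRing.*-commutativeSemigroup commutativeRing)
    using (interchange; x∙yz≈y∙xz)

  1st-of-3 : ∀ {x x′ y z} → x ≈ x′ → y ≈ 0# → z ≈ 0# → x + (y + (z + 0#)) ≈ x′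
  1st-of-3 p q r = trans (+-cong p (trans (+-cong q (trans (+-identityʳ _) r)) (+-identityʳ _))) (+-identityʳ _)

  2nd-of-3 : ∀ {x y y′ z} → x ≈ 0# → y ≈ y′ → z ≈ 0# → x + (y + (z + 0#)) ≈ y′
  2nd-of-3 p q r = trans (+-cong p (trans (+-cong q (trans (+-identityʳ _) r)) (+-identityʳ _))) (+-identityˡ _)

  3rd-of-3 : ∀ {x y z z′} → x ≈ 0# → y ≈ 0# → z ≈ z′ → x + (y + (z + 0#)) ≈ z′
  3rd-of-3 p q r = trans (+-cong p (trans (+-cong q (trans (+-identityʳ _) r)) (+-identityˡ _))) (+-identityˡ _)

  sumStates-cong : ∀ {n} {f g : State n → Carrier} → (∀ r → f r ≈ g r) → sumStates f ≈ sumStates g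
  sumStates-cong {zero}  f≈g = f≈g []
  sumStates-cong {suc n} f≈g = +-cong (go 0F) (+-cong (go 1F) (+-congʳ (go 2F)))
    where go = λ a → sumStates-cong (λ r → f≈g (a ∷ r))

  sumStates-zero : ∀ {n} {f : State n → Carrier} → (∀ r → f r ≈ 0#) → sumStates f ≈ 0#
  sumStates-zero {zero}  f≈0 = f≈0 []
  sumStates-zero {suc n} f≈0 =
    1st-of-3 (go 0F) (go 1F) (go 2F)
    where go = λ a → sumStates-zero (λ r → f≈0 (a ∷ r))

  sumStates-* : ∀ {n} k (f : State n → Carrier) → sumStates (λ r → k * f r) ≈ k * sumStates f
  sumStates-* {zero}  k f = refl
  sumStates-* {suc n} k f =
    trans (+-cong (go 0F) (trans (+-cong (go 1F) (trans (+-cong (go 2F) (sym (zeroʳ k))) (sym (distribˡ _ _ _))))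
      (sym (distribˡ _ _ _)))) (sym (distribˡ _ _ _))
    where go = λ a → sumStates-* k (λ r → f (a ∷ r))

  when : Bool → Carrier → Carrier
  when b x = if b then x else 0#

  when-* : ∀ b x y → when b (x * y) ≈ x * when b y
  when-* true  x y = refl
  when-* false x y = sym (zeroʳ x)

  when-cong : ∀ b {x y} → x ≈ y → when b x ≈ when b y
  when-cong true  eq = eq
  when-cong false eq = refl

  module _ {I : Set} where

    open MarkSums (CommutativeRing.rawRing commutativeRing)

    private
      Arrow = Decoration × I
      M = Mark Arrow

    placements-cong : ∀ L {f g : List M → Carrier} → (∀ ms → f ms ≈ g ms) → placements L f ≈ placements L g
    placements-cong []                 f≈g = f≈g []
    placements-cong ((single , h) ∷ L) f≈g =
      +-cong (placements-cong L λ ms → f≈g _) (placements-cong L λ ms → f≈g _)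
    placements-cong ((double , h) ∷ L) f≈g =
      +-cong (placements-cong L λ ms → f≈g _)
        (+-cong (placements-cong L λ ms → f≈g _) (placements-cong L λ ms → f≈g _))

    placements-* : ∀ L k (f : List M → Carrier) → placements L (λ ms → k * f ms) ≈ k * placements L f
    placements-* []                 k f = refl
    placements-* ((single , h) ∷ L) k f =
      trans (+-cong (placements-* L k _) (placements-* L k _)) (sym (distribˡ k _ _))
    placements-* ((double , h) ∷ L) k f =
      trans (+-cong (placements-* L k _)
              (trans (+-cong (placements-* L k _) (placements-* L k _)) (sym (distribˡ k _ _))))
        (sym (distribˡ k _ _))

    module _ (pairing : M → M → Carrier) where

      -- A is the product of the site factors of the two steps and B that of the pair
      -- factors, as functions of the intermediate state. Up to the factors γ and Γ,
      -- which depend only on the initial and the final state t and s, they are the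
      -- weights of the marks. In particular idle sites contribute nothing else.
      record Gauge {n} (t s : State n) (θ : Fin n → I)
                   (A : Fin n → Fin 3 → Carrier) (B : Fin n → Fin n → Fin 3 → Fin 3 → Carrier)
                   (γ : Fin n → Carrier) (Γ : Fin n → Fin n → Carrier) (w : M → Carrier) : Set (c ⊔ ℓ₁) where
        field
          at-site : ∀ i {r} (π : Path (lookup t i) r (lookup s i)) →
                    A i r ≈ γ i * siteOf w (toMark π (θ i))
          at-pair : ∀ i j → i Fin.< j → ∀ {r r′} (π : Path (lookup t i) r (lookup s i))
                    (π′ : Path (lookup t j) r′ (lookup s j)) →
                    B i j r r′ ≈ Γ i j * pairOf pairing (toMark π (θ i)) (toMark π′ (θ j))
          blocked : ∀ i → move (lookup t i) (lookup s i) ≡ down → γ i ≈ 0#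

      open Gauge

      -- The weights of the later marks after m has been split off.
      absorbed : (M → Carrier) → Maybe M → M → Carrier
      absorbed w nothing  m′ = w m′
      absorbed w (just m) m′ = w m′ * pairing m m′

      siteOf-absorbed : ∀ w m? m?′ → siteOf w m?′ * pairOf pairing m? m?′ ≈ siteOf (absorbed w m?) m?′
      siteOf-absorbed w nothing  nothing   = *-identityʳ _
      siteOf-absorbed w nothing  (just m′) = *-identityʳ _
      siteOf-absorbed w (just m) nothing   = *-identityʳ _
      siteOf-absorbed w (just m) (just m′) = refl

      gauge-tail : ∀ {n t₀ r₀ s₀} {t s : State n} {θ A B γ Γ w} →
                   Gauge (t₀ ∷ t) (s₀ ∷ s) θ A B γ Γ w → (π₀ : Path t₀ r₀ s₀) →
                   Gauge t s (θ ∘ suc)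
                     (λ j b → A (suc j) b * B 0F (suc j) r₀ b) (λ i j → B (suc i) (suc j))
                     (λ j → γ (suc j) * Γ 0F (suc j)) (λ i j → Γ (suc i) (suc j))
                     (absorbed w (toMark π₀ (θ 0F)))
      gauge-tail {θ = θ} {w = w} g π₀ = record
        { at-site = λ i π → trans (*-cong (at-site g (suc i) π) (at-pair g 0F (suc i) (s≤s z≤n) π₀ π))
            (trans (interchange _ _ _ _) (*-congˡ (siteOf-absorbed w (toMark π₀ (θ 0F)) (toMark π (θ (suc i))))))
        ; at-pair = λ i j i<j → at-pair g (suc i) (suc j) (s≤s i<j)
        ; blocked = λ i eq → trans (*-congʳ (blocked g (suc i) eq)) (zeroˡ _)
        }

      -- The weight of an intermediate state r.
      config : ∀ {n} → (Fin n → Fin 3 → Carrier) → (Fin n → Fin n → Fin 3 → Fin 3 → Carrier) →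
               State n → Carrier
      config A B r = triangle (λ i → A i (lookup r i)) (λ i j → B i j (lookup r i) (lookup r j))

      bounded-shift : ∀ {φ} → Bounded φ → ∀ k l → Bounded (λ n m → φ (k ℕ.+ n) (l ℕ.+ m))
      bounded-shift b k l n m (inj₁ 5≤n) = b _ _ (inj₁ (ℕ.m≤n⇒m≤o+n k 5≤n))
      bounded-shift b k l n m (inj₂ 5≤m) = b _ _ (inj₂ (ℕ.m≤n⇒m≤o+n l 5≤m))

      -- The selected part of the sum over intermediate states, and that of the sum
      -- over placements of arrows.
      throughMiddle : ∀ {n} (t s : State n) → (Fin n → Fin 3 → Carrier) →
            (Fin n → Fin n → Fin 3 → Fin 3 → Carrier) → (ℕ → ℕ → Bool) → Carrier
      throughMiddle t s A B φ =
        sumStates λ r → when (φ (totalArrows r s) (totalArrows t r)) (config A B r)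

      throughMarks : ∀ {n} (t s : State n) → (Fin n → I) → (M → Carrier) → (ℕ → ℕ → Bool) → Carrier
      throughMarks t s θ w φ =
        placements (itemsBetween t s θ) λ ms → when (φ (lateTotal ms) (earlyTotal ms)) (weight pairing w ms)

      module _ {n t₀ s₀} {t s : State n} {θ A B γ Γ w}
               (g : Gauge (t₀ ∷ t) (s₀ ∷ s) θ A B γ Γ w) {φ : ℕ → ℕ → Bool} (φ-bounded : Bounded φ) where

        private
          slice : Fin 3 → Carrier
          slice r₀ = sumStates λ r →
            when (φ (totalArrows (r₀ ∷ r) (s₀ ∷ s)) (totalArrows (t₀ ∷ t) (r₀ ∷ r))) (config A B (r₀ ∷ r))

          L = itemsBetween t s (θ ∘ suc)
          rest = triangle (λ j → γ (suc j) * Γ 0F (suc j)) (λ i j → Γ (suc i) (suc j))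

          shifted : Fin 3 → ℕ → ℕ → Bool
          shifted r₀ n m = φ (arrows (move r₀ s₀) ℕ.+ n) (arrows (move t₀ r₀) ℕ.+ m)

        -- The collapse of the sum over the states of the other sites.
        Tail : Set ℓ₁
        Tail = ∀ {r₀} (π : Path t₀ r₀ s₀) →
          throughMiddle t s (λ j b → A (suc j) b * B 0F (suc j) r₀ b) (λ i j → B (suc i) (suc j)) (shifted r₀)
          ≈ rest * throughMarks t s (θ ∘ suc) (absorbed w (toMark π (θ 0F))) (shifted r₀)

        -- A path through r₀ would lower the first site.
        slice-dead : ∀ r₀ → (5 ≤ arrows (move r₀ s₀) ⊎ 5 ≤ arrows (move t₀ r₀)) → slice r₀ ≈ 0#
        slice-dead r₀ 5≤ = sumStates-zero λ r → reflexive (≡.cong (λ b → when b (config A B (r₀ ∷ r)))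
          (φ-bounded _ _ (Sum.map (λ le → ℕ.≤-trans le (ℕ.m≤m+n _ _)) (λ le → ℕ.≤-trans le (ℕ.m≤m+n _ _)) 5≤)))

        slice-tail : Tail → ∀ {r₀} (π : Path t₀ r₀ s₀) →
          slice r₀ ≈ (γ 0F * rest) * (siteOf w (toMark π (θ 0F)) *
                      throughMarks t s (θ ∘ suc) (absorbed w (toMark π (θ 0F))) (shifted r₀))
        slice-tail ih {r₀} π = trans
          (sumStates-cong λ r → when-* (φ (totalArrows (r₀ ∷ r) (s₀ ∷ s)) (totalArrows (t₀ ∷ t) (r₀ ∷ r))) (A 0F r₀) _)
          (trans (sumStates-* {n} (A 0F r₀) _) (trans (*-cong (at-site g 0F π) (ih π)) (interchange _ _ _ _)))

        slice-mark : Tail → ∀ {r₀} (π : Path t₀ r₀ s₀) {m} → toMark π (θ 0F) ≡ just m →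
          slice r₀ ≈ (γ 0F * rest) * placements L λ ms →
            when (shifted r₀ (lateTotal ms) (earlyTotal ms)) (weight pairing w (m ∷ ms))
        slice-mark ih {r₀} π {m} eq with toMark π (θ 0F) | slice-tail ih π
        slice-mark ih {r₀} π {m} ≡.refl | .(just m) | tail = trans tail (*-congˡ (sym (trans
          (placements-cong L λ ms → when-* (shifted r₀ (lateTotal ms) (earlyTotal ms)) (w m) _)
          (placements-* L (w m) _))))

      private
        total₃ : ∀ {x y z x′ y′ z′} → x ≈ x′ → y ≈ y′ → z ≈ z′ → x + (y + (z + 0#)) ≈ x′ + (y′ + z′)
        total₃ p q r = +-cong p (+-cong q (trans (+-identityʳ _) r))
        0+ : ∀ {x} → 0# + x ≈ x
        0+ = +-identityˡ _
        +0 : ∀ {x} → x + 0# ≈ x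
        +0 = +-identityʳ _

      module _ {n} {t s : State n} {θ : Fin (suc n) → I} {A : Fin (suc n) → Fin 3 → Carrier}
               {B : Fin (suc n) → Fin (suc n) → Fin 3 → Fin 3 → Carrier}
               {γ : Fin (suc n) → Carrier} {Γ : Fin (suc n) → Fin (suc n) → Carrier}
               {w : M → Carrier} {φ} (b : Bounded φ) where

        Claim : ∀ t₀ s₀ → Set ℓ₁
        Claim t₀ s₀ = throughMiddle (t₀ ∷ t) (s₀ ∷ s) A B φ ≈ triangle γ Γ * throughMarks (t₀ ∷ t) (s₀ ∷ s) θ w φ

        vanish : ∀ {x y z T} → γ 0F ≈ 0# → x ≈ 0# → y ≈ 0# → z ≈ 0# →
                 x + (y + (z + 0#)) ≈ triangle γ Γ * T
        vanish γ≈0 p q r = trans (1st-of-3 p q r)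
          (sym (trans (*-congʳ (trans (*-congʳ γ≈0) (zeroˡ _))) (zeroˡ _)))

        cases : ∀ t₀ s₀ (g : Gauge (t₀ ∷ t) (s₀ ∷ s) θ A B γ Γ w) → Tail g b → Claim t₀ s₀
        cases 0F 0F g ih = 1st-of-3
          (trans (slice-tail g b ih (idle 0F)) (*-congˡ (*-identityˡ _)))
          (slice-dead g b 1F (inj₁ ℕ.≤-refl)) (slice-dead g b 2F (inj₁ ℕ.≤-refl))
        cases 1F 1F g ih = 2nd-of-3
          (slice-dead g b 0F (inj₂ ℕ.≤-refl))
          (trans (slice-tail g b ih (idle 1F)) (*-congˡ (*-identityˡ _)))
          (slice-dead g b 2F (inj₁ ℕ.≤-refl))
        cases 2F 2F g ih = 3rd-of-3
          (slice-dead g b 0F (inj₂ ℕ.≤-refl)) (slice-dead g b 1F (inj₂ ℕ.≤-refl))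
          (trans (slice-tail g b ih (idle 2F)) (*-congˡ (*-identityˡ _)))
        cases 0F 1F g ih = trans (total₃
          (slice-mark g b ih (plain S₀) ≡.refl)
          (slice-mark g b ih (plain S₁) ≡.refl)
          (slice-dead g b 2F (inj₁ ℕ.≤-refl)))
          (trans (+-congˡ +0) (sym (distribˡ _ _ _)))
        cases 1F 2F g ih = trans (total₃
          (slice-dead g b 0F (inj₂ ℕ.≤-refl))
          (slice-mark g b ih ●₀ ≡.refl)
          (slice-mark g b ih ●₁ ≡.refl))
          (trans 0+ (sym (distribˡ _ _ _)))
        cases 0F 2F g ih = trans (total₃
          (slice-mark g b ih (plain D₀) ≡.refl)
          (slice-mark g b ih (plain D₁) ≡.refl)
          (slice-mark g b ih (plain D₂) ≡.refl))
          (trans (+-congˡ (sym (distribˡ _ _ _))) (sym (distribˡ _ _ _)))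
        cases 1F 0F g ih = vanish (blocked g 0F ≡.refl)
          (slice-dead g b 0F (inj₂ ℕ.≤-refl)) (slice-dead g b 1F (inj₁ ℕ.≤-refl)) (slice-dead g b 2F (inj₁ ℕ.≤-refl))
        cases 2F 0F g ih = vanish (blocked g 0F ≡.refl)
          (slice-dead g b 0F (inj₂ ℕ.≤-refl)) (slice-dead g b 1F (inj₁ ℕ.≤-refl)) (slice-dead g b 2F (inj₁ ℕ.≤-refl))
        cases 2F 1F g ih = vanish (blocked g 0F ≡.refl)
          (slice-dead g b 0F (inj₂ ℕ.≤-refl)) (slice-dead g b 1F (inj₂ ℕ.≤-refl)) (slice-dead g b 2F (inj₁ ℕ.≤-refl))

      -- The sum over intermediate states is a sum over the placements of the arrows
      -- of the sites that move.
      collapse : ∀ {n} (t s : State n) {θ A B γ Γ w} → Gauge t s θ A B γ Γ w →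
                 ∀ φ → Bounded φ → throughMiddle t s A B φ ≈ triangle γ Γ * throughMarks t s θ w φ
      collapse []       []       g φ b = sym (*-identityˡ _)
      collapse (t₀ ∷ t) (s₀ ∷ s) g φ b = cases b t₀ s₀ g λ {r₀} π →
        collapse t s (gauge-tail g π) _ (bounded-shift b (arrows (move r₀ s₀)) (arrows (move t₀ r₀)))

-- The comparison of the arrows ○ and ●

-- Rational expressions for a pair of sites with letters x₁ and x₂.
data Two : Set where
  1st 2nd : Two

data Den : Set where
  1/Q 1/1+Q 1/Δ 1/Δ′ 1/K 1/K′ Rz Rz′ Ry Ry′ : Den

sameDen : (a b : Den) → Maybe (a ≡ b)
sameDen 1/Q 1/Q = just ≡.refl
sameDen 1/1+Q 1/1+Q = just ≡.refl
sameDen 1/Δ 1/Δ = just ≡.refl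
sameDen 1/Δ′ 1/Δ′ = just ≡.refl
sameDen 1/K 1/K = just ≡.refl
sameDen 1/K′ 1/K′ = just ≡.refl
sameDen Rz Rz = just ≡.refl
sameDen Rz′ Rz′ = just ≡.refl
sameDen Ry Ry = just ≡.refl
sameDen Ry′ Ry′ = just ≡.refl
sameDen _ _ = nothing

module TwoSites where
  open LocalWeights (expressions 5 Den) (var 0F) (inv 1/Q) (inv 1/1+Q) public
  private module P = LocalWeights (expressions 5 ⊥) (var 0F) :1 :1
  open RawSemiringDefinitions (RawRing.rawSemiring (expressions 5 ⊥)) using (_^_)

  Q z y x₁ x₂ : ∀ {A} → Expr 5 A
  Q = var 0F
  z = var 1F
  y = var 2F
  x₁ = var 3F
  x₂ = var 4F

  den : Den → PolyExpr 5
  den 1/Q   = Q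
  den 1/1+Q = :1 :+ Q
  den 1/Δ   = x₁ P.- x₂
  den 1/Δ′  = x₂ P.- x₁
  den 1/K   = x₁ P.- Q :* x₂
  den 1/K′  = x₂ P.- Q :* x₁
  den Rz    = x₁ P.- Q ^ 2 :* z
  den Rz′   = x₁ P.- Q ^ 3 :* z
  den Ry    = x₁ P.- Q ^ 2 :* y
  den Ry′   = x₁ P.- Q ^ 3 :* y

  -- The same for the first site alone.
  den₁ : Den → PolyExpr 5
  den₁ 1/Δ  = :1
  den₁ 1/Δ′ = :1
  den₁ 1/K  = :1
  den₁ 1/K′ = :1
  den₁ k    = den k

  letter : Two → Expr 5 Den
  letter 1st = x₁
  letter 2nd = x₂

  δ κ : Two → Two → Expr 5 Den
  δ 1st 2nd = inv 1/Δ
  δ 2nd 1st = :- inv 1/Δ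
  δ _   _   = :0
  κ 1st 2nd = inv 1/K
  κ 2nd 1st = inv 1/K′
  κ _   _   = :0

  open Sites letter δ κ public
  Z Y : Spectral Two
  Z = record { value = z ; reach = λ _ → inv Rz ; reach′ = λ _ → inv Rz′ }
  Y = record { value = y ; reach = λ _ → inv Ry ; reach′ = λ _ → inv Ry′ }

  equalᵉ : Expr 5 Den → Expr 5 Den → Bool
  equalᵉ = Fractions.equal sameDen den

module SiteIdentities {c ℓ} (R : CommutativeRing c ℓ) where

  open CommutativeRing R

  -- Reciprocals for a family of letters; δ i i and κ i i are arbitrary.
  record Reciprocals (q : Carrier) {I : Set} (x : I → Carrier) : Set (c ⊔ ℓ) where
    field
      1/q 1/[1+q] : Carrier
      δ κ         : I → I → Carrier
      q-inverse   : 1/q * q ≈ 1#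
      1+q-inverse : 1/[1+q] * (1# + q) ≈ 1#
      δ-inverse   : ∀ {i j} → i ≢ j → δ i j * (x i - x j) ≈ 1#
      κ-inverse   : ∀ {i j} → i ≢ j → κ i j * (x i - q * x j) ≈ 1#

  module LetterLaws {q : Carrier} {I : Set} {x : I → Carrier} (inverses : Reciprocals q x) where

    open Reciprocals inverses
    open LocalWeights rawRing q 1/q 1/[1+q] hiding (_-_)
    open Sites x δ κ
    open Spectral
    open RawSemiringDefinitions (RawRing.rawSemiring rawRing) using (_^_)
    open Semantics R
    open import Algebra.Properties.CommutativeSemigroup *-commutativeSemigroup using (interchange)
    private module E = TwoSites

    -- The reciprocals in Z are those of the letters x.
    record Lawful (Z : Spectral I) : Set ℓ where
      field
        reach-inverse  : ∀ i → reach Z i * (x i - q ^ 2 * value Z) ≈ 1#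
        reach′-inverse : ∀ i → reach′ Z i * (x i - q ^ 3 * value Z) ≈ 1#

    open Lawful

    -- Identities for the sites i and j, with the letters x₁ and x₂ in this order.
    module _ (Z Y : Spectral I) (Z-lawful : Lawful Z) (Y-lawful : Lawful Y) (i j : I) (i≢j : i ≢ j) where

      ρ : Vec Carrier 5
      ρ = q ∷ value Z ∷ value Y ∷ x i ∷ x j ∷ []

      ι : Den → Carrier
      ι 1/Q   = 1/q
      ι 1/1+Q = 1/[1+q]
      ι 1/Δ   = δ i j
      ι 1/Δ′  = δ j i
      ι 1/K   = κ i j
      ι 1/K′  = κ j i
      ι Rz    = reach Z i
      ι Rz′   = reach′ Z i
      ι Ry    = reach Y i
      ι Ry′   = reach′ Y i

      by-two-sites : ∀ e f → E.equalᵉ e f ≡ true → ⟦ e ⟧ ρ ι ≈ ⟦ f ⟧ ρ ι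
      by-two-sites = FractionSound.equal-sound R sameDen E.den ρ ι λ where
        1/Q   → q-inverse
        1/1+Q → 1+q-inverse
        1/Δ   → δ-inverse i≢j
        1/Δ′  → δ-inverse (≢-sym i≢j)
        1/K   → κ-inverse i≢j
        1/K′  → κ-inverse (≢-sym i≢j)
        Rz    → reach-inverse Z-lawful i
        Rz′   → reach′-inverse Z-lawful i
        Ry    → reach-inverse Y-lawful i
        Ry′   → reach′-inverse Y-lawful i

      δ-antisym : δ j i ≈ - δ i j
      δ-antisym = by-two-sites (inv 1/Δ′) (:- inv 1/Δ) ≡.refl

    module _ {a b d e e′ : Carrier} where

      private
        dress = dressing a b d e e′

      -- The dressing by a site does not depend on the steps in which the site moves,
      -- provided that d°d● = d●○ in state 1.
      dressing-split : dress 1F (raise ●) * dress 1F (raise ○) ≈ dress 1F leap →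
        ∀ c {t r s} → Path t r s → dress c (move r s) * dress c (move t r) ≈ dress c (move t s) * 1#
      dressing-split eq c  (idle 0F)  = refl
      dressing-split eq c  (idle 1F)  = refl
      dressing-split eq c  (idle 2F)  = refl
      dressing-split eq c  (plain S₀) = refl
      dressing-split eq c  (plain S₁) = *-comm _ _
      dressing-split eq c  (plain D₀) = refl
      dressing-split eq 0F (plain D₁) = refl
      dressing-split eq 1F (plain D₁) = trans eq (sym (*-identityʳ _))
      dressing-split eq 2F (plain D₁) = trans (interchange _ _ _ _) (sym (*-identityʳ _))
      dressing-split eq c  (plain D₂) = *-comm _ _
      dressing-split eq c  ●₀         = refl
      dressing-split eq c  ●₁         = *-comm _ _

    module _ (Z Y : Spectral I) (Z-lawful : Lawful Z) (Y-lawful : Lawful Y) where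

      ρ₁ : I → Vec Carrier 5
      ρ₁ i = q ∷ value Z ∷ value Y ∷ x i ∷ 0# ∷ []

      ι₁ : I → Den → Carrier
      ι₁ i 1/Q   = 1/q
      ι₁ i 1/1+Q = 1/[1+q]
      ι₁ i Rz    = reach Z i
      ι₁ i Rz′   = reach′ Z i
      ι₁ i Ry    = reach Y i
      ι₁ i Ry′   = reach′ Y i
      ι₁ i _     = 1#

      by-one-site : ∀ i e f → Fractions.equal sameDen E.den₁ e f ≡ true → ⟦ e ⟧ (ρ₁ i) (ι₁ i) ≈ ⟦ f ⟧ (ρ₁ i) (ι₁ i)
      by-one-site i = FractionSound.equal-sound R sameDen E.den₁ (ρ₁ i) (ι₁ i) λ where
        1/Q   → q-inverse
        1/1+Q → 1+q-inverse
        1/Δ   → *-identityˡ 1#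
        1/Δ′  → *-identityˡ 1#
        1/K   → *-identityˡ 1#
        1/K′  → *-identityˡ 1#
        Rz    → reach-inverse Z-lawful i
        Rz′   → reach′-inverse Z-lawful i
        Ry    → reach-inverse Y-lawful i
        Ry′   → reach′-inverse Y-lawful i

      -- An arrow ● at the letter x i has the weights of an arrow ○ at x i / q, up to
      -- siteGauge; for arrows ○ there is nothing to prove.
      site-gauge : ∀ i {t r s} (π : Path t r s) → siteSteps Z Y i π ≈ siteNormal Z Y i π
      site-gauge i (idle 0F)          = sym (*-identityʳ _)
      site-gauge i (idle 1F)          = sym (*-identityʳ _)
      site-gauge i (idle 2F)          = sym (*-identityʳ _)
      site-gauge i (plain {single} p) = sym (*-identityˡ _)
      site-gauge i (plain {double} p) = sym (*-identityˡ _)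
      site-gauge i ●₀ = by-one-site i (E.siteSteps E.Z E.Y 1st ●₀) (E.siteNormal E.Z E.Y 1st ●₀) ≡.refl
      site-gauge i ●₁ = by-one-site i (E.siteSteps E.Z E.Y 1st ●₁) (E.siteNormal E.Z E.Y 1st ●₁) ≡.refl

      pair-gauge : ∀ {i j} → i ≢ j → ∀ {t r s t′ r′ s′} (π : Path t r s) (π′ : Path t′ r′ s′) →
                   pairSteps Z Y i j π π′ ≈ pairNormal Z Y i j π π′
      pair-gauge {i} {j} i≢j = go
        where
        ρ₂ = ρ Z Y Z-lawful Y-lawful i j i≢j
        ι₂ = ι Z Y Z-lawful Y-lawful i j i≢j
        by : ∀ {t r s t′ r′ s′} (π : Path t r s) (π′ : Path t′ r′ s′) →
             E.equalᵉ (E.pairSteps E.Z E.Y 1st 2nd π π′) (E.pairNormal E.Z E.Y 1st 2nd π π′) ≡ true →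
             ⟦ E.pairSteps E.Z E.Y 1st 2nd π π′ ⟧ ρ₂ ι₂ ≈ ⟦ E.pairNormal E.Z E.Y 1st 2nd π π′ ⟧ ρ₂ ι₂
        by π π′ = by-two-sites Z Y Z-lawful Y-lawful i j i≢j
          (E.pairSteps E.Z E.Y 1st 2nd π π′) (E.pairNormal E.Z E.Y 1st 2nd π π′)

        split-ij : ∀ c {t r s} → Path t r s →
          dressing (x i) (x j) (δ i j) (κ i j) (κ j i) c (move r s) *
          dressing (x i) (x j) (δ i j) (κ i j) (κ j i) c (move t r)
          ≈ dressing (x i) (x j) (δ i j) (κ i j) (κ j i) c (move t s) * 1#
        split-ij = dressing-split (by-two-sites Z Y Z-lawful Y-lawful i j i≢j (D (raise ●) :* D (raise ○)) (D leap) ≡.refl)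
          where D = E.dressing E.x₁ E.x₂ (inv 1/Δ) (inv 1/K) (inv 1/K′) 1F

        split-ji : ∀ c {t r s} → Path t r s →
          dressing (x j) (x i) (- δ i j) (κ j i) (κ i j) c (move r s) *
          dressing (x j) (x i) (- δ i j) (κ j i) (κ i j) c (move t r)
          ≈ dressing (x j) (x i) (- δ i j) (κ j i) (κ i j) c (move t s) * 1#
        split-ji = dressing-split (by-two-sites Z Y Z-lawful Y-lawful i j i≢j (D (raise ●) :* D (raise ○)) (D leap) ≡.refl)
          where D = E.dressing E.x₂ E.x₁ (:- inv 1/Δ) (inv 1/K′) (inv 1/K) 1F

        go : ∀ {t r s t′ r′ s′} (π : Path t r s) (π′ : Path t′ r′ s′) →
             pairSteps Z Y i j π π′ ≈ pairNormal Z Y i j π π′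
        go (idle 0F) π′ = split-ij 0F π′
        go (idle 1F) π′ = split-ij 1F π′
        go (idle 2F) π′ = split-ij 2F π′
        go (plain S₀) (idle 0F) = split-ji 0F (plain S₀)
        go (plain S₀) (idle 1F) = split-ji 1F (plain S₀)
        go (plain S₀) (idle 2F) = split-ji 2F (plain S₀)
        go (plain S₁) (idle 0F) = split-ji 0F (plain S₁)
        go (plain S₁) (idle 1F) = split-ji 1F (plain S₁)
        go (plain S₁) (idle 2F) = split-ji 2F (plain S₁)
        go (plain D₀) (idle 0F) = split-ji 0F (plain D₀)
        go (plain D₀) (idle 1F) = split-ji 1F (plain D₀)
        go (plain D₀) (idle 2F) = split-ji 2F (plain D₀)
        go (plain D₁) (idle 0F) = split-ji 0F (plain D₁)
        go (plain D₁) (idle 1F) = split-ji 1F (plain D₁)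
        go (plain D₁) (idle 2F) = split-ji 2F (plain D₁)
        go (plain D₂) (idle 0F) = split-ji 0F (plain D₂)
        go (plain D₂) (idle 1F) = split-ji 1F (plain D₂)
        go (plain D₂) (idle 2F) = split-ji 2F (plain D₂)
        go ●₀ (idle 0F) = split-ji 0F ●₀
        go ●₀ (idle 1F) = split-ji 1F ●₀
        go ●₀ (idle 2F) = split-ji 2F ●₀
        go ●₁ (idle 0F) = split-ji 0F ●₁
        go ●₁ (idle 1F) = split-ji 1F ●₁
        go ●₁ (idle 2F) = split-ji 2F ●₁
        go (plain {single} p) (plain {single} p′) = sym (*-identityˡ _)
        go (plain {single} p) (plain {double} p′) = sym (*-identityˡ _)
        go (plain {double} p) (plain {single} p′) = sym (*-identityˡ _)
        go (plain {double} p) (plain {double} p′) = sym (*-identityˡ _)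
        go (plain S₀) ●₀ = by (plain S₀) ●₀ ≡.refl
        go (plain S₁) ●₀ = by (plain S₁) ●₀ ≡.refl
        go (plain D₀) ●₀ = by (plain D₀) ●₀ ≡.refl
        go (plain D₁) ●₀ = by (plain D₁) ●₀ ≡.refl
        go (plain D₂) ●₀ = by (plain D₂) ●₀ ≡.refl
        go (plain S₀) ●₁ = by (plain S₀) ●₁ ≡.refl
        go (plain S₁) ●₁ = by (plain S₁) ●₁ ≡.refl
        go (plain D₀) ●₁ = by (plain D₀) ●₁ ≡.refl
        go (plain D₁) ●₁ = by (plain D₁) ●₁ ≡.refl
        go (plain D₂) ●₁ = by (plain D₂) ●₁ ≡.refl
        go ●₀ (plain S₀) = by ●₀ (plain S₀) ≡.refl
        go ●₀ (plain S₁) = by ●₀ (plain S₁) ≡.refl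
        go ●₀ (plain D₀) = by ●₀ (plain D₀) ≡.refl
        go ●₀ (plain D₁) = by ●₀ (plain D₁) ≡.refl
        go ●₀ (plain D₂) = by ●₀ (plain D₂) ≡.refl
        go ●₁ (plain S₀) = by ●₁ (plain S₀) ≡.refl
        go ●₁ (plain S₁) = by ●₁ (plain S₁) ≡.refl
        go ●₁ (plain D₀) = by ●₁ (plain D₀) ≡.refl
        go ●₁ (plain D₁) = by ●₁ (plain D₁) ≡.refl
        go ●₁ (plain D₂) = by ●₁ (plain D₂) ≡.refl
        go ●₀ ●₀ = by ●₀ ●₀ ≡.refl
        go ●₀ ●₁ = by ●₀ ●₁ ≡.refl
        go ●₁ ●₀ = by ●₁ ●₀ ≡.refl
        go ●₁ ●₁ = by ●₁ ●₁ ≡.refl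

-- The exchange relations for the closed form of the matrix elements

-- The items that occur in itemsBetween.
data Admissible {I : Set} : Kind × (Decoration × I) → Set where
  single : ∀ u i → Admissible (single , u , i)
  double : ∀ i → Admissible (double , ○ , i)

module _ {I : Set} where
  private Item = Kind × (Decoration × I)

  place : Item → I
  place (_ , _ , i) = i

  between-all : ∀ {p} {P : Item → Set p} {n} (t s : State n) (θ : Fin n → I) →
    (∀ i {it} → Admissible it → place it ≡ θ i → P it) → All P (itemsBetween t s θ)
  between-all []      []      θ h = []
  between-all (a ∷ t) (b ∷ s) θ h = head a b
    where
    rest = between-all t s (θ ∘ suc) (h ∘ suc)
    head : ∀ a b → All _ (item a b (θ 0F) (itemsBetween t s (θ ∘ suc)))
    head 0F 0F = rest
    head 0F 1F = h 0F (single ○ _) ≡.refl ∷ rest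
    head 0F 2F = h 0F (double _) ≡.refl ∷ rest
    head 1F 0F = rest
    head 1F 1F = rest
    head 1F 2F = h 0F (single ● _) ≡.refl ∷ rest
    head 2F 0F = rest
    head 2F 1F = rest
    head 2F 2F = rest

  between-allPairs : ∀ {p} {P : Item → Item → Set p} {n} (t s : State n) (θ : Fin n → I) →
    (∀ {i j} → i ≢ j → θ i ≢ θ j) →
    (∀ {it it′} → Admissible it → Admissible it′ → place it ≢ place it′ → P it it′) →
    AllPairs P (itemsBetween t s θ)
  between-allPairs []      []      θ inj h = []
  between-allPairs {P = P} (a ∷ t) (b ∷ s) θ inj h = head a b
    where
    rest = between-allPairs t s (θ ∘ suc) (λ i≢j → inj (i≢j ∘ Fin.suc-injective)) h
    cons : ∀ {it} → Admissible it → place it ≡ θ 0F → AllPairs P (it ∷ itemsBetween t s (θ ∘ suc))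
    cons ad eq = between-all t s (θ ∘ suc) (λ i ad′ eq′ → h ad ad′
      λ eq″ → inj {0F} {suc i} (λ ()) (≡.trans (≡.sym eq) (≡.trans eq″ eq′))) ∷ rest
    head : ∀ a b → AllPairs P (item a b (θ 0F) (itemsBetween t s (θ ∘ suc)))
    head 0F 0F = rest
    head 0F 1F = cons (single ○ _) ≡.refl
    head 0F 2F = cons (double _) ≡.refl
    head 1F 0F = rest
    head 1F 1F = rest
    head 1F 2F = cons (single ● _) ≡.refl
    head 2F 0F = rest
    head 2F 1F = rest
    head 2F 2F = rest

size : ∀ {h} {H : Set h} → List (Kind × H) → ℕ
size []                 = 0
size ((single , _) ∷ L) = 1 ℕ.+ size L
size ((double , _) ∷ L) = 2 ℕ.+ size L

shape : ∀ {h} {H : Set h} (L : List (Kind × H)) → Shape (size L) L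
shape []                 = done
shape ((single , _) ∷ L) = S∷ shape L
shape ((double , _) ∷ L) = D∷ shape L

module ProductElements {c ℓ₁ ℓ₂} (F : HeytingField c ℓ₁ ℓ₂) where
  open FieldNotation F
  open Operators F
  open Collapse F
  open Triangles commutativeRing
  private
    raw = CommutativeRing.rawRing commutativeRing
  open MarkSums raw
  open SiteIdentities commutativeRing
  open import Algebra.Properties.CommutativeSemigroup (CommutativeRing.*-commutativeSemigroup commutativeRing)
    using (interchange; x∙yz≈y∙xz)

  triangle-* : ∀ {n} (w w′ : Fin n → Carrier) (u u′ : Fin n → Fin n → Carrier) →
    triangle (λ i → w i * w′ i) (λ i j → u i j * u′ i j) ≈ triangle w u * triangle w′ u′
  triangle-* {zero}  w w′ u u′ = sym (*-identityˡ 1#)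
  triangle-* {suc n} w w′ u u′ = trans
    (*-congˡ (trans (triangle-cong {n} (λ j → interchange _ _ _ _) (λ _ _ _ → refl))
      (triangle-* {n} (λ j → w (suc j) * u 0F (suc j)) (λ j → w′ (suc j) * u′ 0F (suc j))
        (λ i j → u (suc i) (suc j)) (λ i j → u′ (suc i) (suc j)))))
    (interchange _ _ _ _)

  placements-size : ∀ {h} {H : Set h} (L : List (Kind × H)) (f : List (Mark H) → Carrier) →
    (∀ ms → lateTotal ms ℕ.+ earlyTotal ms ≡ size L → f ms ≈ 0#) → placements L f ≈ 0#
  placements-size []                 f h = h [] ≡.refl
  placements-size ((single , x) ∷ L) f h = trans (+-cong
    (placements-size L _ λ ms eq → h _ (≡.cong suc eq))
    (placements-size L _ λ ms eq → h _ (≡.trans (ℕ.+-suc _ _) (≡.cong suc eq))))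
    (+-identityˡ 0#)
  placements-size ((double , x) ∷ L) f h = trans (+-cong
    (placements-size L _ λ ms eq → h _ (≡.cong (2 ℕ.+_) eq))
    (trans (+-cong
      (placements-size L _ λ ms eq → h _ (≡.cong suc (≡.trans (ℕ.+-suc _ _) (≡.cong suc eq))))
      (placements-size L _ λ ms eq → h _ (≡.trans (ℕ.+-suc _ _) (≡.cong suc (≡.trans (ℕ.+-suc _ _) (≡.cong suc eq))))))
      (+-identityˡ 0#)))
    (+-identityˡ 0#)

  private
    both-≡ᵇ : ∀ n m k l → (n ℕ.≡ᵇ k) ∧ (m ℕ.≡ᵇ l) ≡ false ⊎ n ℕ.+ m ≡ k ℕ.+ l
    both-≡ᵇ n m k l with n ℕ.≟ k | m ℕ.≟ l
    ... | yes ≡.refl | yes ≡.refl = inj₂ ≡.refl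
    ... | no n≢k     | _          = inj₁ (≡.cong (_∧ (m ℕ.≡ᵇ l)) (dec-false (n ℕ.≟ k) n≢k))
    ... | yes _      | no m≢l     =
      inj₁ (≡.trans (≡.cong ((n ℕ.≡ᵇ k) ∧_) (dec-false (m ℕ.≟ l) m≢l)) (∧-zeroʳ _))

  module _ {q : Carrier} {N : ℕ} {x : Fin N → Carrier} (inverses : Reciprocals q x) where

    open Reciprocals inverses

    open LocalWeights raw q 1/q 1/[1+q] hiding (_-_)
    open Sites x δ κ
    open LetterLaws inverses
    open Spectral
    open Lawful
    private
      module E = TwoSites
      module X = ExchangeIdentities.Exchange commutativeRing q 1/q 1/[1+q] q-inverse 1+q-inverse
                   letterOf difference q-difference q-difference′

    -- The closed form of the matrix element of Γ_k from t to s: it vanishes unless k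
    -- arrows are added, and is a product over sites and pairs of sites otherwise.
    strength : Spectral (Fin N) → State N → State N → Carrier
    strength Z s t = triangle (λ i → site Z i (lookup t i) (lookup s i))
      (λ i j → pair Z i j (lookup t i) (lookup s i) (lookup t j) (lookup s j))

    element : Spectral (Fin N) → ℕ → State N → State N → Carrier
    element Z k s t = when (totalArrows t s ℕ.≡ᵇ k) (prefactor (value Z) k * strength Z s t)

    productElement : Spectral (Fin N) → Spectral (Fin N) → ℕ → ℕ → State N → State N → Carrier
    productElement Z Y k l s t = sumStates λ r → element Z k s r * element Y l r t

    module _ (Z Y : Spectral (Fin N)) (Z-lawful : Lawful Z) (Y-lawful : Lawful Y) (s t : State N) where

      L : List (Kind × (Decoration × Fin N))
      L = itemsBetween t s id

      -- The parts of the product that do not depend on the intermediate state.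
      siteFactor : Spectral (Fin N) → Spectral (Fin N) → Fin N → Carrier
      siteFactor Z Y i = siteGauge Z Y i (lookup t i) (move (lookup t i) (lookup s i))

      pairFactor : Fin N → Fin N → Carrier
      pairFactor i j =
        pairGauge i j (lookup t i) (move (lookup t i) (lookup s i)) (lookup t j) (move (lookup t j) (lookup s j))

      gaugeFactor : Carrier
      gaugeFactor = triangle (siteFactor Z Y) pairFactor

      gauge : Gauge (markPair (arrowSpectral Z) (arrowSpectral Y)) t s id
        (λ i r → site Z i r (lookup s i) * site Y i (lookup t i) r)
        (λ i j r r′ → pair Z i j r (lookup s i) r′ (lookup s j) * pair Y i j (lookup t i) r (lookup t j) r′)
        (siteFactor Z Y) pairFactor
        (markSite (arrowSpectral Z) (arrowSpectral Y))
      gauge = record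
        { at-site = λ i π → site-gauge Z Y Z-lawful Y-lawful i π
        ; at-pair = λ i j i<j π π′ → pair-gauge Z Y Z-lawful Y-lawful (Fin.<⇒≢ i<j) π π′
        ; blocked = λ i eq → reflexive (≡.cong (siteGauge Z Y i (lookup t i)) eq)
        }

      chosen : ℕ → ℕ → ℕ → ℕ → Bool
      chosen k l n m = (n ℕ.≡ᵇ k) ∧ (m ℕ.≡ᵇ l)

      chosen-bounded : ∀ k l → k ≤ 4 → l ≤ 4 → Bounded (chosen k l)
      chosen-bounded k l k≤4 l≤4 n m (inj₁ 5≤n) = ≡.cong (_∧ (m ℕ.≡ᵇ l))
        (dec-false (n ℕ.≟ k) λ n≡k → ℕ.<⇒≢ (ℕ.≤-<-trans k≤4 5≤n) (≡.sym n≡k))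
      chosen-bounded k l k≤4 l≤4 n m (inj₂ 5≤m) = ≡.trans (≡.cong ((n ℕ.≡ᵇ k) ∧_)
        (dec-false (m ℕ.≟ l) λ m≡l → ℕ.<⇒≢ (ℕ.≤-<-trans l≤4 5≤m) (≡.sym m≡l))) (∧-zeroʳ _)

      when-when : ∀ b b′ x y → when b x * when b′ y ≈ when (b ∧ b′) (x * y)
      when-when true  true  x y = refl
      when-when true  false x y = zeroʳ x
      when-when false b′    x y = zeroˡ _

      -- Idle sites, the kinds of the arrows and lowered sites enter only through a
      -- factor that is symmetric in Z and Y.
      productElement-twoSteps : ∀ k l → k ≤ 4 → l ≤ 4 →
        productElement Z Y k l s t ≈ gaugeFactor * twoSteps (arrowSpectral Z) (arrowSpectral Y) k l L
      productElement-twoSteps k l k≤4 l≤4 = trans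
        (sumStates-cong λ r → trans (when-when (totalArrows r s ℕ.≡ᵇ k) (totalArrows t r ℕ.≡ᵇ l) _ _)
          (trans (when-cong (chosen k l (totalArrows r s) (totalArrows t r))
            (trans (interchange _ _ _ _) (*-congˡ (sym (triangle-* {N}
              (λ i → site Z i (lookup r i) (lookup s i)) (λ i → site Y i (lookup t i) (lookup r i))
              (λ i j → pair Z i j (lookup r i) (lookup s i) (lookup r j) (lookup s j))
              (λ i j → pair Y i j (lookup t i) (lookup r i) (lookup t j) (lookup r j)))))))
            (when-* (chosen k l (totalArrows r s) (totalArrows t r)) _ _)))
        (trans (sumStates-* {N} _ _) (trans
          (*-congˡ (collapse _ t s gauge (chosen k l) (chosen-bounded k l k≤4 l≤4)))
          (x∙yz≈y∙xz _ _ _)))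

      twoSteps-zero : ∀ k l → size L ≢ k ℕ.+ l →
        twoSteps (arrowSpectral Z) (arrowSpectral Y) k l L ≈ 0#
      twoSteps-zero k l size≢ = trans (*-congˡ (placements-size L _ λ ms eq → selected-zero ms eq)) (zeroʳ _)
        where
        selected-zero : ∀ ms → lateTotal ms ℕ.+ earlyTotal ms ≡ size L →
                        selected (arrowSpectral Z) (arrowSpectral Y) k l ms ≈ 0#
        selected-zero ms eq with both-≡ᵇ (lateTotal ms) (earlyTotal ms) k l
        ... | inj₁ eq′  = reflexive (≡.cong (λ b → if b then _ else 0#) eq′)
        ... | inj₂ same = ⊥-elim (size≢ (≡.trans (≡.sym eq) same))

      gaugeFactor-sym : gaugeFactor ≈ triangle (siteFactor Y Z) pairFactor
      gaugeFactor-sym = triangle-cong {N} (λ i → commute i (lookup t i) (move (lookup t i) (lookup s i))) (λ _ _ _ → refl)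
        where
        commute : ∀ i c m → siteGauge Z Y i c m ≈ siteGauge Y Z i c m
        commute i c stay      = *-comm _ _
        commute i c (raise ○) = refl
        commute i c (raise ●) = trans (*-assoc _ _ _) (trans (*-congˡ (*-comm _ _)) (sym (*-assoc _ _ _)))
        commute i c leap      = refl
        commute i c down      = refl

      Z-reaches : All (X.Reaches (arrowSpectral Z)) L
      Z-reaches = between-all t s id λ i ad _ → reaches ad
        where
        reaches : ∀ {it} → Admissible it → X.Reaches (arrowSpectral Z) it
        reaches (single ○ i) = record { reaches = reach-inverse Z-lawful i ; reaches′ = λ () }
        reaches (single ● i) = record
          { reaches = by-one-site Z Y Z-lawful Y-lawful i
              (E.Q :* inv Rz′ :* (E.x₁ :* inv 1/Q :+ (:- (E.Q :* (E.Q :* :1) :* E.z)))) :1 ≡.refl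
          ; reaches′ = λ () }
        reaches (double i)   = record
          { reaches = reach-inverse Z-lawful i ; reaches′ = λ _ → reach′-inverse Z-lawful i }

      separates : AllPairs X.Separates L
      separates = between-allPairs t s id id apart
        where
        apart : ∀ {it it′} → Admissible it → Admissible it′ → place it ≢ place it′ → X.Separates it it′
        apart (single ○ i) (single ○ j) i≢j = record
          { separates = δ-inverse i≢j ; separatesˡ = λ () ; separatesʳ = λ () }
        apart (single ○ i) (single ● j) i≢j = record
          { separates = by-two-sites Z Y Z-lawful Y-lawful i j i≢j
              ((:- (E.Q :* inv 1/K′)) :* (E.x₁ :+ (:- (E.x₂ :* inv 1/Q)))) :1 ≡.refl
          ; separatesˡ = λ () ; separatesʳ = λ () }
        apart (single ○ i) (double j) i≢j = record
          { separates = δ-inverse i≢j ; separatesˡ = λ () ; separatesʳ = λ _ → κ-inverse (≢-sym i≢j) }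
        apart (single ● i) (single ○ j) i≢j = record
          { separates = by-two-sites Z Y Z-lawful Y-lawful i j i≢j
              (E.Q :* inv 1/K :* (E.x₁ :* inv 1/Q :+ (:- E.x₂))) :1 ≡.refl
          ; separatesˡ = λ () ; separatesʳ = λ () }
        apart (single ● i) (single ● j) i≢j = record
          { separates = by-two-sites Z Y Z-lawful Y-lawful i j i≢j
              (E.Q :* inv 1/Δ :* (E.x₁ :* inv 1/Q :+ (:- (E.x₂ :* inv 1/Q)))) :1 ≡.refl
          ; separatesˡ = λ () ; separatesʳ = λ () }
        apart (single ● i) (double j) i≢j = record
          { separates = by-two-sites Z Y Z-lawful Y-lawful i j i≢j
              (E.Q :* inv 1/K :* (E.x₁ :* inv 1/Q :+ (:- E.x₂))) :1 ≡.refl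
          ; separatesˡ = λ ()
          ; separatesʳ = λ _ → by-two-sites Z Y Z-lawful Y-lawful i j i≢j
              ((:- inv 1/Δ) :* (E.x₂ :+ (:- (E.Q :* (E.x₁ :* inv 1/Q))))) :1 ≡.refl }
        apart (double i) (single ○ j) i≢j = record
          { separates = δ-inverse i≢j ; separatesˡ = λ _ → κ-inverse i≢j ; separatesʳ = λ () }
        apart (double i) (single ● j) i≢j = record
          { separates = by-two-sites Z Y Z-lawful Y-lawful i j i≢j
              ((:- (E.Q :* inv 1/K′)) :* (E.x₁ :+ (:- (E.x₂ :* inv 1/Q)))) :1 ≡.refl
          ; separatesˡ = λ _ → by-two-sites Z Y Z-lawful Y-lawful i j i≢j
              (inv 1/Δ :* (E.x₁ :+ (:- (E.Q :* (E.x₂ :* inv 1/Q))))) :1 ≡.refl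
          ; separatesʳ = λ () }
        apart (double i) (double j) i≢j = record
          { separates = δ-inverse i≢j ; separatesˡ = λ _ → κ-inverse i≢j
          ; separatesʳ = λ _ → κ-inverse (≢-sym i≢j) }

    module _ (Z Y : Spectral (Fin N)) (Z-lawful : Lawful Z) (Y-lawful : Lawful Y)
             (u v : Carrier) (u-inverse : u * (value Y - q ^ 2 * value Z) ≈ 1#)
             (v-inverse : v * (value Y - q ^ 3 * value Z) ≈ 1#)
             (conservation : ∀ i j k l → crossing (value Y) (value Z) u v i j k l ≈ 0# ⊎
                             toℕ i ℕ.+ toℕ j ≡ toℕ k ℕ.+ toℕ l) where

      ∑₃-cong : ∀ {f g : Fin 3 → Carrier} → (∀ i → f i ≈ g i) → ∑₃ f ≈ ∑₃ g
      ∑₃-cong f≈g = +-cong (f≈g 0F) (+-cong (f≈g 1F) (+-cong (f≈g 2F) refl))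

      ∑₃-* : ∀ a (f : Fin 3 → Carrier) → ∑₃ (λ i → a * f i) ≈ a * ∑₃ f
      ∑₃-* a f = sym (trans (distribˡ _ _ _) (+-congˡ (trans (distribˡ _ _ _) (+-congˡ
        (trans (distribˡ _ _ _) (+-congˡ (zeroʳ a)))))))

      ∑₃-rescale : ∀ {a} (c : Fin 3 → Fin 3 → Carrier) {f g : Fin 3 → Fin 3 → Carrier} →
        (∀ i j → a * f i j ≈ g i j) →
        a * ∑₃ (λ i → ∑₃ λ j → c i j * f i j) ≈ ∑₃ (λ i → ∑₃ λ j → c i j * g i j)
      ∑₃-rescale {a} c {f} {g} eq =
        trans (sym (∑₃-* a (λ i → ∑₃ λ j → c i j * f i j)))
          (∑₃-cong {λ i → a * ∑₃ λ j → c i j * f i j} {λ i → ∑₃ λ j → c i j * g i j} λ i →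
            trans (sym (∑₃-* a (λ j → c i j * f i j)))
              (∑₃-cong {λ j → a * (c i j * f i j)} {λ j → c i j * g i j} λ j →
                trans (x∙yz≈y∙xz a (c i j) (f i j)) (*-congˡ (eq i j))))

      ∑₃-zero : ∀ {f : Fin 3 → Carrier} → (∀ i → f i ≈ 0#) → ∑₃ f ≈ 0#
      ∑₃-zero f≈0 = 1st-of-3 (f≈0 0F) (f≈0 1F) (f≈0 2F)

      small : ∀ (k : Fin 3) → toℕ k ≤ 4
      small k = ℕ.≤-trans (Fin.toℕ≤pred[n] k) (s≤s (s≤s z≤n))

      twoSteps-exchange : ∀ s t k l →
        twoSteps (arrowSpectral Z) (arrowSpectral Y) (toℕ k) (toℕ l) (itemsBetween t s id)
        ≈ exchanged u v (arrowSpectral Z) (arrowSpectral Y) k l (itemsBetween t s id)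
      twoSteps-exchange s t k l with size (itemsBetween t s id) ℕ.≟ toℕ k ℕ.+ toℕ l
      ... | yes eq = X.exchange u v (arrowSpectral Z) (arrowSpectral Y) u-inverse v-inverse k l
                       (≡.subst (λ n → Shape n (itemsBetween t s id)) eq (shape (itemsBetween t s id)))
                       (Z-reaches Z Y Z-lawful Y-lawful s t) (Z-reaches Y Z Y-lawful Z-lawful s t)
                       (separates Z Y Z-lawful Y-lawful s t)
      ... | no ≢ = trans (twoSteps-zero Z Y Z-lawful Y-lawful s t (toℕ k) (toℕ l) ≢)
                     (sym (∑₃-zero {λ i → ∑₃ λ j → crossing (value Y) (value Z) u v i j k l *
                         twoSteps (arrowSpectral Y) (arrowSpectral Z) (toℕ j) (toℕ i) (itemsBetween t s id)}
                       λ i → ∑₃-zero {λ j → crossing (value Y) (value Z) u v i j k l *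
                         twoSteps (arrowSpectral Y) (arrowSpectral Z) (toℕ j) (toℕ i) (itemsBetween t s id)}
                       λ j → vanishing-term i j (conservation i j k l)))
        where
        vanishing-term : ∀ i j → crossing (value Y) (value Z) u v i j k l ≈ 0# ⊎
                         toℕ i ℕ.+ toℕ j ≡ toℕ k ℕ.+ toℕ l →
                         crossing (value Y) (value Z) u v i j k l *
                         twoSteps (arrowSpectral Y) (arrowSpectral Z) (toℕ j) (toℕ i) (itemsBetween t s id) ≈ 0#
        vanishing-term i j (inj₁ ≈0) = trans (*-congʳ ≈0) (zeroˡ _)
        vanishing-term i j (inj₂ eq) = trans (*-congˡ
          (twoSteps-zero Y Z Y-lawful Z-lawful s t (toℕ j) (toℕ i)
            λ eq′ → ≢ (≡.trans eq′ (≡.trans (ℕ.+-comm (toℕ j) (toℕ i)) eq)))) (zeroʳ _)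

      -- The exchange relation for the closed form.
      product-exchange : ∀ k l s t →
        productElement Z Y (toℕ k) (toℕ l) s t ≈
        ∑₃ λ i → ∑₃ λ j → crossing (value Y) (value Z) u v i j k l * productElement Y Z (toℕ j) (toℕ i) s t
      product-exchange k l s t = trans
        (productElement-twoSteps Z Y Z-lawful Y-lawful s t (toℕ k) (toℕ l) (small k) (small l))
        (trans (*-congˡ (twoSteps-exchange s t k l))
        (∑₃-rescale (λ i j → crossing (value Y) (value Z) u v i j k l) λ i j → sym (trans
          (productElement-twoSteps Y Z Y-lawful Z-lawful s t (toℕ j) (toℕ i) (small j) (small i))
          (*-congʳ (sym (gaugeFactor-sym Z Y Z-lawful Y-lawful s t))))))

-- Matrix elements of the elementary and diagonal operators

module OperatorEntries {c ℓ₁ ℓ₂} (F : HeytingField c ℓ₁ ℓ₂) where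
  open FieldNotation F
  open Operators F
  private
    module R = CommutativeRing commutativeRing
    module Π = Sums R.*-commutativeMonoid
    module Σ = SemiringSum R.semiring
  open Collapse F using (sumStates-cong; sumStates-*; 1st-of-3; 2nd-of-3; 3rd-of-3)
  open import Relation.Binary.Reasoning.Setoid R.setoid

  choose : ∀ {a} {A : Set a} → Bool → A → A → A
  choose b x y = if b then x else y

  -- The factors of m at i come from a function without a name; the type of
  -- at-factor is determined by its use in at-product.
  mutual
    at-factor : ∀ {N} (m : Mat₃) (i : Fin N) (s t : State N) (k : Fin N) →
                _ ≈ choose (does (k ≟ i)) m I₃ (lookup s k) (lookup t k)

    at-product : ∀ {N} (m : Mat₃) (i : Fin N) (s t : State N) →
                 (m at i) s t ≈ product (λ k → choose (does (k ≟ i)) m I₃ (lookup s k) (lookup t k))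
    at-product m i s t = Π.sum-cong-≋ (at-factor m i s t)

    at-factor m i s t k with k ≟ i
    ... | yes _ = refl
    ... | no  _ = refl

  open import Algebra.Properties.CommutativeSemigroup R.*-commutativeSemigroup
    using (interchange; x∙yz≈y∙xz)

  product-ones : ∀ {n} {f : Fin n → Carrier} → (∀ k → f k ≈ 1#) → product f ≈ 1#
  product-ones {zero}  f≈1 = refl
  product-ones {suc n} f≈1 =
    trans (*-cong (f≈1 0F) (product-ones λ k → f≈1 (suc k))) (*-identityˡ 1#)

  product-zero : ∀ {n} {f : Fin n → Carrier} k → f k ≈ 0# → product f ≈ 0#
  product-zero zero    f≈0 = trans (*-congʳ f≈0) (zeroˡ _)
  product-zero (suc k) f≈0 = trans (*-congˡ (product-zero k f≈0)) (zeroʳ _)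

  -- The family f with the i-th member replaced by 1.
  except : ∀ {n} → Fin n → (Fin n → Carrier) → Fin n → Carrier
  except i f k = choose (does (k ≟ i)) 1# (f k)

  product-at : ∀ {n} i (f : Fin n → Carrier) → product f ≈ f i * product (except i f)
  product-at zero    f = *-congˡ (sym (*-identityˡ _))
  product-at (suc i) f = trans (*-congˡ (product-at i λ k → f (suc k))) (x∙yz≈y∙xz _ _ _)

  except-cong : ∀ {n} i {f g : Fin n → Carrier} → (∀ k → k ≢ i → f k ≈ g k) → ∀ k → except i f k ≈ except i g k
  except-cong i f≈g k with k ≟ i
  ... | yes _  = refl
  ... | no k≢i = f≈g k k≢i

  except-cong₂ : ∀ {n} i j {f g : Fin n → Carrier} → (∀ k → k ≢ i → k ≢ j → f k ≈ g k) →
                 ∀ k → except j (except i f) k ≈ except j (except i g) k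
  except-cong₂ i j f≈g k with k ≟ j | k ≟ i
  ... | yes _   | _       = refl
  ... | no  _   | yes _   = refl
  ... | no  k≢j | no  k≢i = f≈g k k≢i k≢j

  product-single : ∀ {n} i {f : Fin n → Carrier} → (∀ k → k ≢ i → f k ≈ 1#) → product f ≈ f i
  product-single i {f} f≈1 = trans (product-at i f)
    (trans (*-congˡ (product-ones λ k → trans (except-cong i {f} {λ _ → 1#} f≈1 k) (ones k))) (*-identityʳ _))
    where
    ones : ∀ k → except i (λ _ → 1#) k ≈ 1#
    ones k with does (k ≟ i)
    ... | true  = refl
    ... | false = refl

  product-cong : ∀ {n} {f g : Fin n → Carrier} → (∀ k → f k ≈ g k) → product f ≈ product g
  product-cong = Π.sum-cong-≋

  product-* : ∀ {n} (f g : Fin n → Carrier) → product (λ k → f k * g k) ≈ product f * product g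
  product-* = Π.∑-distrib-+

  product-single′ : ∀ {n} i (v : Fin n → Carrier) → product (λ k → choose (does (k ≟ i)) (v k) 1#) ≈ v i
  product-single′ i v = trans (product-single i off) on
    where
    off : ∀ k → k ≢ i → choose (does (k ≟ i)) (v k) 1# ≈ 1#
    off k k≢i with k ≟ i
    ... | yes k≡i = contradiction k≡i k≢i
    ... | no  _   = refl
    on : choose (does (i ≟ i)) (v i) 1# ≈ v i
    on with i ≟ i
    ... | yes _   = refl
    ... | no  i≢i = contradiction ≡.refl i≢i

  product-replace : ∀ {n} i {f g : Fin n → Carrier} {a b} → (∀ k → k ≢ i → f k ≈ g k) →
                    a * f i ≈ b * g i → a * product f ≈ b * product g
  product-replace i {f} {g} {a} {b} f≈g eq = begin
    a * product f                     ≈⟨ *-congˡ (product-at i f) ⟩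
    a * (f i * product (except i f))  ≈⟨ *-assoc _ _ _ ⟨
    a * f i * product (except i f)    ≈⟨ *-cong eq (product-cong (except-cong i {f} {g} f≈g)) ⟩
    b * g i * product (except i g)    ≈⟨ *-assoc _ _ _ ⟩
    b * (g i * product (except i g))  ≈⟨ *-congˡ (product-at i g) ⟨
    b * product g                     ∎

  product-at₂ : ∀ {n} {i j} → i ≢ j → ∀ (f : Fin n → Carrier) →
                product f ≈ f i * f j * product (except j (except i f))
  product-at₂ {i = i} {j} i≢j f = begin
    product f                                                  ≈⟨ product-at i f ⟩
    f i * product (except i f)                                 ≈⟨ *-congˡ (product-at j (except i f)) ⟩
    f i * (except i f j * product (except j (except i f)))     ≈⟨ *-congˡ (*-congʳ unchanged) ⟩
    f i * (f j * product (except j (except i f)))              ≈⟨ *-assoc _ _ _ ⟨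
    f i * f j * product (except j (except i f))                ∎
    where
    unchanged : except i f j ≈ f j
    unchanged with j ≟ i
    ... | yes j≡i = contradiction (≡.sym j≡i) i≢j
    ... | no  _   = refl

  product-replace₂ : ∀ {n} {i j} → i ≢ j → ∀ {f g : Fin n → Carrier} {a b} →
                     (∀ k → k ≢ i → k ≢ j → f k ≈ g k) →
                     a * (f i * f j) ≈ b * (g i * g j) → a * product f ≈ b * product g
  product-replace₂ {i = i} {j} i≢j {f} {g} {a} {b} f≈g eq = begin
    a * product f                                            ≈⟨ *-congˡ (product-at₂ i≢j f) ⟩
    a * (f i * f j * product (except j (except i f)))        ≈⟨ *-assoc _ _ _ ⟨
    a * (f i * f j) * product (except j (except i f))        ≈⟨ *-cong eq (product-cong (except-cong₂ i j f≈g)) ⟩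
    b * (g i * g j) * product (except j (except i g))        ≈⟨ *-assoc _ _ _ ⟩
    b * (g i * g j * product (except j (except i g)))        ≈⟨ *-congˡ (product-at₂ i≢j g) ⟨
    b * product g                                            ∎

  product-double : ∀ {n} {i j} → i ≢ j → ∀ {f : Fin n → Carrier} →
                   (∀ k → k ≢ i → k ≢ j → f k ≈ 1#) → product f ≈ f i * f j
  product-double {i = i} {j} i≢j {f} f≈1 = trans (product-at₂ i≢j f)
    (trans (*-congˡ (product-ones λ k → trans (except-cong₂ i j {f} {λ _ → 1#} f≈1 k) (ones k))) (*-identityʳ _))
    where
    ones : ∀ k → except j (except i (λ _ → 1#)) k ≈ 1#
    ones k with does (k ≟ j) | does (k ≟ i)
    ... | true  | _     = refl
    ... | false | true  = refl
    ... | false | false = refl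

  -- The matrix elements of the identity.
  kron : ∀ {N} → State N → State N → Carrier
  kron s t = product (λ k → I₃ (lookup s k) (lookup t k))

  -- B is diagonal with eigenvalues v.
  Diagonal : ∀ {N} → Op N → (State N → Carrier) → Set ℓ₁
  Diagonal B v = ∀ s t → B s t ≈ kron s t * v t

  diag-entry : ∀ a b c s t → diag a b c s t ≈ I₃ s t * diag a b c t t
  diag-entry a b c 0F 0F = sym (*-identityˡ _)
  diag-entry a b c 0F 1F = sym (zeroˡ _)
  diag-entry a b c 0F 2F = sym (zeroˡ _)
  diag-entry a b c 1F 0F = sym (zeroˡ _)
  diag-entry a b c 1F 1F = sym (*-identityˡ _)
  diag-entry a b c 1F 2F = sym (zeroˡ _)
  diag-entry a b c 2F 0F = sym (zeroˡ _)
  diag-entry a b c 2F 1F = sym (zeroˡ _)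
  diag-entry a b c 2F 2F = sym (*-identityˡ _)

  diagonal-at : ∀ {N} a b c (i : Fin N) →
                Diagonal (diag a b c at i) (λ t → diag a b c (lookup t i) (lookup t i))
  diagonal-at {N} a b c i s t = begin
    (m at i) s t
      ≈⟨ at-product m i s t ⟩
    product (λ k → choose (does (k ≟ i)) m I₃ (lookup s k) (lookup t k))
      ≈⟨ product-cong factor ⟩
    product (λ k → I₃ (lookup s k) (lookup t k) * choose (does (k ≟ i)) (m (lookup t k) (lookup t k)) 1#)
      ≈⟨ product-* {N} _ _ ⟩
    kron s t * product (λ k → choose (does (k ≟ i)) (m (lookup t k) (lookup t k)) 1#)
      ≈⟨ *-congˡ (product-single′ i λ k → m (lookup t k) (lookup t k)) ⟩
    kron s t * m (lookup t i) (lookup t i) ∎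
    where
    m = diag a b c
    factor : ∀ k → choose (does (k ≟ i)) m I₃ (lookup s k) (lookup t k) ≈
      I₃ (lookup s k) (lookup t k) * choose (does (k ≟ i)) (m (lookup t k) (lookup t k)) 1#
    factor k with does (k ≟ i)
    ... | true  = diag-entry a b c (lookup s k) (lookup t k)
    ... | false = sym (*-identityʳ _)

  sumStates-kron : ∀ {N} (f : State N → Carrier) t → sumStates (λ r → f r * kron r t) ≈ f t
  sumStates-kron {N = zero}  f []      = *-identityʳ _
  sumStates-kron {N = suc N} f (b ∷ t) = begin
    sum {3} (λ a → sumStates λ r → f (a ∷ r) * (I₃ a b * kron r t))
      ≈⟨ Σ.sum-cong-≋ {3} {λ a → sumStates λ r → f (a ∷ r) * (I₃ a b * kron r t)} {λ a → I₃ a b * f (a ∷ t)}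
           (λ a → trans (sumStates-cong {N} λ r → x∙yz≈y∙xz _ _ _)
                        (trans (sumStates-* {N} _ _) (*-congˡ (sumStates-kron (λ r → f (a ∷ r)) t)))) ⟩
    sum {3} (λ a → I₃ a b * f (a ∷ t))
      ≈⟨ only b ⟩
    f (b ∷ t) ∎
    where
    only : ∀ b → sum {3} (λ a → I₃ a b * f (a ∷ t)) ≈ f (b ∷ t)
    only 0F = 1st-of-3 (*-identityˡ _) (zeroˡ _) (zeroˡ _)
    only 1F = 2nd-of-3 (zeroˡ _) (*-identityˡ _) (zeroˡ _)
    only 2F = 3rd-of-3 (zeroˡ _) (zeroˡ _) (*-identityˡ _)

  ⊙-diagonal : ∀ {N} (A B : Op N) {v} → Diagonal B v → ∀ s t → (A ⊙ B) s t ≈ A s t * v t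
  ⊙-diagonal {N} A B {v} B-diag s t = begin
    sumStates (λ r → A s r * B r t)
      ≈⟨ sumStates-cong {N} (λ r → trans (*-congˡ (B-diag r t)) (trans (sym (*-assoc _ _ _)) (*-comm _ _))) ⟩
    sumStates (λ r → v t * (A s r * kron r t))   ≈⟨ sumStates-* {N} _ _ ⟩
    v t * sumStates (λ r → A s r * kron r t)     ≈⟨ *-congˡ (sumStates-kron (A s) t) ⟩
    v t * A s t                                  ≈⟨ *-comm _ _ ⟩
    A s t * v t                                  ∎

  diagonal-⊙ : ∀ {N} {A B : Op N} {u v} → Diagonal A u → Diagonal B v → Diagonal (A ⊙ B) (λ t → u t * v t)
  diagonal-⊙ {A = A} {B} A-diag B-diag s t =
    trans (⊙-diagonal A B B-diag s t) (trans (*-congʳ (A-diag s t)) (*-assoc _ _ _))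

  diagonal-∏ : ∀ {N n} {O : Fin n → Op N} {v : Fin n → State N → Carrier} →
               (∀ j → Diagonal (O j) (v j)) → Diagonal (∏ᴼ O) (λ t → product (λ j → v j t))
  diagonal-∏ {n = zero}  O-diag s t = sym (*-identityʳ _)
  diagonal-∏ {n = suc n} O-diag = diagonal-⊙ (O-diag 0F) (diagonal-∏ λ j → O-diag (suc j))

  diagonal-unless : ∀ {N p} {P : Set p} (P? : Dec P) {O : ¬ P → Op N} {v : State N → Carrier} →
    (∀ ¬p → Diagonal (O ¬p) v) → Diagonal (mulUnless P? O) (λ t → choose (does P?) 1# (v t))
  diagonal-unless (yes _)  O-diag s t = sym (*-identityʳ _)
  diagonal-unless (no ¬p)  O-diag     = O-diag ¬p

  ∑ᴼ-entry : ∀ {N n} (O : Fin n → Op N) s t → ∑ᴼ O s t ≈ sum (λ i → O i s t)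
  ∑ᴼ-entry {n = zero}  O s t = refl
  ∑ᴼ-entry {n = suc n} O s t = +-congˡ (∑ᴼ-entry (λ i → O (suc i)) s t)

  sumStates-product : ∀ {N} (f : Fin N → Fin 3 → Carrier) →
    sumStates (λ r → product (λ k → f k (lookup r k))) ≈ product (λ k → sum {3} (f k))
  sumStates-product {zero}  f = refl
  sumStates-product {suc N} f = trans
    (Σ.sum-cong-≋ {3} {λ a → sumStates λ r → f 0F a * product (λ k → f (suc k) (lookup r k))} {λ a → f 0F a * P}
      (λ a → trans (sumStates-* {N} _ _) (*-congˡ (sumStates-product λ k → f (suc k)))))
    (sym (Σ.*-distribʳ-sum {3} P (f 0F)))
    where P = product (λ k → sum {3} (f (suc k)))

  I₃-left : ∀ (m : Mat₃) s t → sum {3} (λ c → I₃ s c * m c t) ≈ m s t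
  I₃-left m 0F t = 1st-of-3 (*-identityˡ _) (zeroˡ _) (zeroˡ _)
  I₃-left m 1F t = 2nd-of-3 (zeroˡ _) (*-identityˡ _) (zeroˡ _)
  I₃-left m 2F t = 3rd-of-3 (zeroˡ _) (zeroˡ _) (*-identityˡ _)

  I₃-right : ∀ (m : Mat₃) s t → sum {3} (λ c → m s c * I₃ c t) ≈ m s t
  I₃-right m s 0F = 1st-of-3 (*-identityʳ _) (zeroʳ _) (zeroʳ _)
  I₃-right m s 1F = 2nd-of-3 (zeroʳ _) (*-identityʳ _) (zeroʳ _)
  I₃-right m s 2F = 3rd-of-3 (zeroʳ _) (zeroʳ _) (*-identityʳ _)

  at-⊙-at : ∀ {N} (m m′ : Mat₃) {i j : Fin N} → i ≢ j → ∀ s t → (m at i ⊙ m′ at j) s t ≈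
    product (λ k → choose (does (k ≟ i)) m (choose (does (k ≟ j)) m′ I₃) (lookup s k) (lookup t k))
  at-⊙-at {N} m m′ {i} {j} i≢j s t = begin
    sumStates (λ r → (m at i) s r * (m′ at j) r t)
      ≈⟨ sumStates-cong {N} (λ r → trans (*-cong (at-product m i s r) (at-product m′ j r t)) (sym (product-* {N} _ _))) ⟩
    sumStates (λ r → product λ k → step k (lookup r k))
      ≈⟨ sumStates-product step ⟩
    product (λ k → sum {3} (step k))
      ≈⟨ product-cong collect ⟩
    _ ∎
    where
    step : Fin _ → Fin 3 → Carrier
    step k c = choose (does (k ≟ i)) m I₃ (lookup s k) c * choose (does (k ≟ j)) m′ I₃ c (lookup t k)
    collect : ∀ k → sum {3} (step k) ≈
      choose (does (k ≟ i)) m (choose (does (k ≟ j)) m′ I₃) (lookup s k) (lookup t k)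
    collect k with k ≟ i | k ≟ j
    ... | yes k≡i | yes k≡j = contradiction (≡.trans (≡.sym k≡i) k≡j) i≢j
    ... | yes _   | no _    = I₃-right m (lookup s k) (lookup t k)
    ... | no _    | yes _   = I₃-left m′ (lookup s k) (lookup t k)
    ... | no _    | no _    = I₃-left I₃ (lookup s k) (lookup t k)

-- Selecting the term that contributes

sameMove : Move → Move → Bool
sameMove stay      stay      = true
sameMove (raise ○) (raise ○) = true
sameMove (raise ●) (raise ●) = true
sameMove leap      leap      = true
sameMove _         _         = false

sameMove-sound : ∀ m m′ → sameMove m m′ ≡ true → m ≡ m′
sameMove-sound stay      stay      _ = ≡.refl
sameMove-sound (raise ○) (raise ○) _ = ≡.refl
sameMove-sound (raise ●) (raise ●) _ = ≡.refl
sameMove-sound leap      leap      _ = ≡.refl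

-- The moves of a transition in which only i moves, or only i and j.
oneMove : ∀ {N} → Fin N → Move → Fin N → Move
oneMove i m k = if does (k ≟ i) then m else stay

twoMoves : ∀ {N} → Fin N → Move → Fin N → Move → Fin N → Move
twoMoves i m j m′ k = if does (k ≟ i) then m else oneMove j m′ k

module PairProducts {c ℓ₁ ℓ₂} (F : HeytingField c ℓ₁ ℓ₂) where
  open FieldNotation F
  open Operators F
  open OperatorEntries F
  open Triangles commutativeRing
  private
    module R = CommutativeRing commutativeRing
    module Π = Sums R.*-commutativeMonoid
  open import Relation.Binary.Reasoning.Setoid R.setoid
  open import Algebra.Properties.CommutativeSemigroup R.*-commutativeSemigroup
    using (interchange; x∙yz≈y∙xz)

  -- The product over the pairs i < j.
  pairProduct : ∀ {n} → (Fin n → Fin n → Carrier) → Carrier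
  pairProduct u = product λ i → product λ j → choose (toℕ i ℕ.<ᵇ toℕ j) (u i j) 1#

  pairProduct-cong : ∀ {n} {u v : Fin n → Fin n → Carrier} → (∀ i j → i Fin.< j → u i j ≈ v i j) →
                     pairProduct u ≈ pairProduct v
  pairProduct-cong u≈v = product-cong λ i → product-cong λ j → factor i j
    where
    factor : ∀ i j → choose (toℕ i ℕ.<ᵇ toℕ j) _ 1# ≈ choose (toℕ i ℕ.<ᵇ toℕ j) _ 1#
    factor i j with toℕ i ℕ.<ᵇ toℕ j in eq
    ... | false = refl
    ... | true  = u≈v i j (ℕ.<ᵇ⇒< (toℕ i) (toℕ j) (≡.subst T (≡.sym eq) _))

  pairProduct-suc : ∀ {n} (u : Fin (suc n) → Fin (suc n) → Carrier) →
    pairProduct u ≈ product (λ j → u 0F (suc j)) * pairProduct (λ i j → u (suc i) (suc j))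
  pairProduct-suc {n} u = *-cong (*-identityˡ _) (product-cong {n} λ i → *-identityˡ _)

  pairProduct-* : ∀ {n} (u v : Fin n → Fin n → Carrier) →
                  pairProduct (λ i j → u i j * v i j) ≈ pairProduct u * pairProduct v
  pairProduct-* {n} u v = trans
    (product-cong {n} λ i → trans (product-cong {n} λ j → split (toℕ i ℕ.<ᵇ toℕ j)) (product-* {n} _ _)) (product-* {n} _ _)
    where
    split : ∀ b {x y} → choose b (x * y) 1# ≈ choose b x 1# * choose b y 1#
    split true  = refl
    split false = sym (*-identityˡ 1#)

  pairProduct-ones : ∀ {n} {u : Fin n → Fin n → Carrier} → (∀ i j → i Fin.< j → u i j ≈ 1#) → pairProduct u ≈ 1#
  pairProduct-ones {n} {u} u≈1 = trans (pairProduct-cong {n} {u} {λ _ _ → 1#} u≈1)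
    (product-ones {n} λ i → product-ones {n} λ j → ones (toℕ i ℕ.<ᵇ toℕ j))
    where
    ones : ∀ b → choose b 1# 1# ≈ 1#
    ones true  = refl
    ones false = refl

  triangle-product : ∀ {n} (w : Fin n → Carrier) u → triangle w u ≈ product w * pairProduct u
  triangle-product {zero}  w u = sym (*-identityˡ 1#)
  triangle-product {suc n} w u = begin
    w 0F * triangle (λ j → w (suc j) * u 0F (suc j)) (λ i j → u (suc i) (suc j))
      ≈⟨ *-congˡ (triangle-product {n} _ _) ⟩
    w 0F * (product (λ j → w (suc j) * u 0F (suc j)) * rest)
      ≈⟨ *-congˡ (trans (*-congʳ (product-* {n} _ _)) (*-assoc _ _ _)) ⟩
    w 0F * (product (λ j → w (suc j)) * (product (λ j → u 0F (suc j)) * rest))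
      ≈⟨ *-assoc _ _ _ ⟨
    product w * (product (λ j → u 0F (suc j)) * rest)
      ≈⟨ *-congˡ (pairProduct-suc u) ⟨
    product w * pairProduct u ∎
    where rest = pairProduct (λ i j → u (suc i) (suc j))

  pairProduct-ordered : ∀ {n} (h : Fin n → Fin n → Carrier) → (∀ i → h i i ≈ 1#) →
    pairProduct (λ i j → h i j * h j i) ≈ product (λ i → product (λ j → h i j))
  pairProduct-ordered {zero}  h h≈1 = refl
  pairProduct-ordered {suc n} h h≈1 = begin
    pairProduct (λ i j → h i j * h j i)
      ≈⟨ pairProduct-suc (λ i j → h i j * h j i) ⟩
    product (λ j → h 0F (suc j) * h (suc j) 0F) * pairProduct (λ i j → h (suc i) (suc j) * h (suc j) (suc i))
      ≈⟨ *-cong (product-* {n} _ _) (pairProduct-ordered {n} (λ i j → h (suc i) (suc j)) λ i → h≈1 (suc i)) ⟩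
    product (λ j → h 0F (suc j)) * product (λ i → h (suc i) 0F) * product (λ i → product (λ j → h (suc i) (suc j)))
      ≈⟨ *-assoc _ _ _ ⟩
    product (λ j → h 0F (suc j)) * (product (λ i → h (suc i) 0F) * product (λ i → product (λ j → h (suc i) (suc j))))
      ≈⟨ *-cong (trans (sym (*-identityˡ _)) (*-congʳ (sym (h≈1 0F)))) (sym (product-* {n} _ _)) ⟩
    product (λ i → product (λ j → h i j)) ∎

  pairProduct-single : ∀ {n} {i j} → i Fin.< j → {u : Fin n → Fin n → Carrier} →
    (∀ k l → k Fin.< l → ¬ (k ≡ i × l ≡ j) → u k l ≈ 1#) → pairProduct u ≈ u i j
  pairProduct-single {n} {i} {j} i<j {u} u≈1 = trans
    (product-single i λ k k≢i → product-ones {n} λ l → factor k l λ eq → k≢i (proj₁ eq))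
    (trans (product-single j λ l l≢j → factor i l λ eq → l≢j (proj₂ eq)) on)
    where
    factor : ∀ k l → ¬ (k ≡ i × l ≡ j) → choose (toℕ k ℕ.<ᵇ toℕ l) (u k l) 1# ≈ 1#
    factor k l ≢ with toℕ k ℕ.<ᵇ toℕ l in eq
    ... | false = refl
    ... | true  = u≈1 k l (ℕ.<ᵇ⇒< (toℕ k) (toℕ l) (≡.subst T (≡.sym eq) _)) ≢
    on : choose (toℕ i ℕ.<ᵇ toℕ j) (u i j) 1# ≈ u i j
    on with toℕ i ℕ.<ᵇ toℕ j | ℕ.<⇒<ᵇ i<j
    ... | true | _ = refl

  bit : Bool → Carrier
  bit b = if b then 1# else 0#

  -- 1 if the transition from t to s consists of the moves ε, and 0 otherwise.
  selects : ∀ {N} → (Fin N → Move) → State N → State N → Carrier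
  selects ε s t = product λ k → bit (sameMove (ε k) (move (lookup t k) (lookup s k)))

  decide-all : ∀ {n} (b : Fin n → Bool) → (∀ k → b k ≡ true) ⊎ ∃ λ k → b k ≡ false
  decide-all {zero}  b = inj₁ λ ()
  decide-all {suc n} b with b 0F in eq | decide-all (λ k → b (suc k))
  ... | false | _              = inj₂ (0F , eq)
  ... | true  | inj₂ (k , eq′) = inj₂ (suc k , eq′)
  ... | true  | inj₁ all       = inj₁ λ where
    0F      → eq
    (suc k) → all k

  selects-* : ∀ {N} (ε : Fin N → Move) (s t : State N) {x y} →
    ((∀ k → ε k ≡ move (lookup t k) (lookup s k)) → x ≈ y) → selects ε s t * x ≈ selects ε s t * y
  selects-* ε s t x≈y with decide-all (λ k → sameMove (ε k) (move (lookup t k) (lookup s k)))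
  ... | inj₁ all      = *-congˡ (x≈y λ k → sameMove-sound _ _ (all k))
  ... | inj₂ (k , eq) = trans (*-congʳ zero!) (trans (zeroˡ _) (sym (trans (*-congʳ zero!) (zeroˡ _))))
    where zero! = product-zero k (reflexive (≡.cong bit eq))

  -- The elementary matrix that performs a move; the value at down is not used.
  raising : Move → Mat₃
  raising (raise ○) = elementary 1F 0F
  raising (raise ●) = elementary 2F 1F
  raising leap      = elementary 2F 0F
  raising _         = I₃

  raising-entry : ∀ {m} → m ≢ down → ∀ s t → raising m s t ≈ bit (sameMove m (move t s))
  raising-entry {down} m≢ s t = contradiction ≡.refl m≢

  raising-entry {stay} _ 0F 0F = refl
  raising-entry {stay} _ 0F 1F = refl
  raising-entry {stay} _ 0F 2F = refl
  raising-entry {stay} _ 1F 0F = refl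
  raising-entry {stay} _ 1F 1F = refl
  raising-entry {stay} _ 1F 2F = refl
  raising-entry {stay} _ 2F 0F = refl
  raising-entry {stay} _ 2F 1F = refl
  raising-entry {stay} _ 2F 2F = refl
  raising-entry {(raise ○)} _ 0F 0F = refl
  raising-entry {(raise ○)} _ 0F 1F = refl
  raising-entry {(raise ○)} _ 0F 2F = refl
  raising-entry {(raise ○)} _ 1F 0F = refl
  raising-entry {(raise ○)} _ 1F 1F = refl
  raising-entry {(raise ○)} _ 1F 2F = refl
  raising-entry {(raise ○)} _ 2F 0F = refl
  raising-entry {(raise ○)} _ 2F 1F = refl
  raising-entry {(raise ○)} _ 2F 2F = refl
  raising-entry {(raise ●)} _ 0F 0F = refl
  raising-entry {(raise ●)} _ 0F 1F = refl
  raising-entry {(raise ●)} _ 0F 2F = refl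
  raising-entry {(raise ●)} _ 1F 0F = refl
  raising-entry {(raise ●)} _ 1F 1F = refl
  raising-entry {(raise ●)} _ 1F 2F = refl
  raising-entry {(raise ●)} _ 2F 0F = refl
  raising-entry {(raise ●)} _ 2F 1F = refl
  raising-entry {(raise ●)} _ 2F 2F = refl
  raising-entry {leap} _ 0F 0F = refl
  raising-entry {leap} _ 0F 1F = refl
  raising-entry {leap} _ 0F 2F = refl
  raising-entry {leap} _ 1F 0F = refl
  raising-entry {leap} _ 1F 1F = refl
  raising-entry {leap} _ 1F 2F = refl
  raising-entry {leap} _ 2F 0F = refl
  raising-entry {leap} _ 2F 1F = refl
  raising-entry {leap} _ 2F 2F = refl

  private module Σ = SemiringSum R.semiring

  module _ {N} (s t : State N) where

    -- The numbers of ways to write the transition from t to s as no move, as the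
    -- move m of one site, and as the moves m and m′ of two sites i < j.
    none : Carrier
    none = selects (λ _ → stay) s t

    singles : Move → Carrier
    singles m = sum λ i → selects (oneMove i m) s t

    doubles : Move → Move → Carrier
    doubles m m′ = sum λ i → sum λ j →
      choose (toℕ i ℕ.<ᵇ toℕ j) (selects (twoMoves i m j m′) s t) 0#

  singles-∷ : ∀ {N} b (s : State N) a t m → let μ = move a b in
    singles (b ∷ s) (a ∷ t) m ≈ bit (sameMove m μ) * none s t + bit (sameMove stay μ) * singles s t m
  singles-∷ {N} b s a t m = +-congˡ (sym (Σ.*-distribˡ-sum {N} _ _))

  doubles-∷ : ∀ {N} b (s : State N) a t m m′ → let μ = move a b in
    doubles (b ∷ s) (a ∷ t) m m′ ≈ bit (sameMove m μ) * singles s t m′ + bit (sameMove stay μ) * doubles s t m m′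
  doubles-∷ {N} b s a t m m′ = +-cong
    (trans (+-identityˡ _) (sym (Σ.*-distribˡ-sum {N} _ _)))
    (trans (Σ.sum-cong-≋ {N} λ i → trans (+-identityˡ _) (trans
       (Σ.sum-cong-≋ {N} λ j → pull (toℕ i ℕ.<ᵇ toℕ j)) (sym (Σ.*-distribˡ-sum {N} _ _))))
      (sym (Σ.*-distribˡ-sum {N} _ _)))
    where
    pull : ∀ b {x y} → choose b (x * y) 0# ≈ x * choose b y 0#
    pull true  = refl
    pull false = sym (zeroʳ _)

  private
    first : ∀ {x y} → 1# * x + 0# * y ≈ x
    first = trans (+-cong (*-identityˡ _) (zeroˡ _)) (+-identityʳ _)
    second : ∀ {x y} → 0# * x + 1# * y ≈ y
    second = trans (+-cong (zeroˡ _) (*-identityˡ _)) (+-identityˡ _)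
    neither : ∀ {x y} → 0# * x + 0# * y ≈ 0#
    neither = trans (+-cong (zeroˡ _) (zeroˡ _)) (+-identityˡ _)
    0+0 : 0# + 0# ≈ 0#
    0+0 = +-identityˡ 0#

  count-none : ∀ {N} (s t : State N) → none s t ≈ bit (totalArrows t s ℕ.≡ᵇ 0)
  count-none []      []      = refl
  count-none (b ∷ s) (a ∷ t) with move a b
  ... | stay    = trans (*-identityˡ _) (count-none s t)
  ... | raise ○ = zeroˡ _
  ... | raise ● = zeroˡ _
  ... | leap    = zeroˡ _
  ... | down    = zeroˡ _

  count-one : ∀ {N} (s t : State N) →
    singles s t (raise ○) + singles s t (raise ●) ≈ bit (totalArrows t s ℕ.≡ᵇ 1)
  count-one []      []      = 0+0
  count-one (b ∷ s) (a ∷ t) = trans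
    (+-cong (singles-∷ b s a t (raise ○)) (singles-∷ b s a t (raise ●))) (cases (move a b))
    where
    cases : ∀ μ →
      (bit (sameMove (raise ○) μ) * none s t + bit (sameMove stay μ) * singles s t (raise ○)) +
      (bit (sameMove (raise ●) μ) * none s t + bit (sameMove stay μ) * singles s t (raise ●))
      ≈ bit (arrows μ ℕ.+ totalArrows t s ℕ.≡ᵇ 1)
    cases stay      = trans (+-cong second second) (count-one s t)
    cases (raise ○) = trans (+-cong first neither) (trans (+-identityʳ _) (count-none s t))
    cases (raise ●) = trans (+-cong neither first) (trans (+-identityˡ _) (count-none s t))
    cases leap      = trans (+-cong neither neither) 0+0
    cases down      = trans (+-cong neither neither) 0+0

  count-two : ∀ {N} (s t : State N) →
    singles s t leap +
      ((doubles s t (raise ○) (raise ○) + doubles s t (raise ○) (raise ●)) +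
       (doubles s t (raise ●) (raise ○) + doubles s t (raise ●) (raise ●)))
    ≈ bit (totalArrows t s ℕ.≡ᵇ 2)
  count-two []      []      = trans (+-congˡ (trans (+-cong 0+0 0+0) 0+0)) 0+0
  count-two (b ∷ s) (a ∷ t) = trans
    (+-cong (singles-∷ b s a t leap) (+-cong
      (+-cong (doubles-∷ b s a t _ _) (doubles-∷ b s a t _ _))
      (+-cong (doubles-∷ b s a t _ _) (doubles-∷ b s a t _ _)))) (cases (move a b))
    where
    one : Decoration → Carrier
    one v = singles s t (raise v)
    two : Decoration → Decoration → Carrier
    two u v = doubles s t (raise u) (raise v)
    cases : ∀ μ →
      (bit (sameMove leap μ) * none s t + bit (sameMove stay μ) * singles s t leap) +
      (((bit (sameMove (raise ○) μ) * one ○ + bit (sameMove stay μ) * two ○ ○) +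
        (bit (sameMove (raise ○) μ) * one ● + bit (sameMove stay μ) * two ○ ●)) +
       ((bit (sameMove (raise ●) μ) * one ○ + bit (sameMove stay μ) * two ● ○) +
        (bit (sameMove (raise ●) μ) * one ● + bit (sameMove stay μ) * two ● ●)))
      ≈ bit (arrows μ ℕ.+ totalArrows t s ℕ.≡ᵇ 2)
    cases stay      = trans (+-cong second (+-cong (+-cong second second) (+-cong second second))) (count-two s t)
    cases (raise ○) = trans (+-cong neither (+-cong (+-cong first first) (trans (+-cong neither neither) 0+0)))
      (trans (+-identityˡ _) (trans (+-identityʳ _) (count-one s t)))
    cases (raise ●) = trans (+-cong neither (+-cong (trans (+-cong neither neither) 0+0) (+-cong first first)))
      (trans (+-identityˡ _) (trans (+-identityˡ _) (count-one s t)))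
    cases leap      = trans (+-cong first (trans (+-cong (trans (+-cong neither neither) 0+0) (trans (+-cong neither neither) 0+0)) 0+0))
      (trans (+-identityʳ _) (count-none s t))
    cases down      = trans (+-cong neither (trans (+-cong (trans (+-cong neither neither) 0+0) (trans (+-cong neither neither) 0+0)) 0+0)) 0+0

oneMove-at : ∀ {N} (i : Fin N) m → oneMove i m i ≡ m
oneMove-at i m with i ≟ i
... | yes _   = ≡.refl
... | no  i≢i = contradiction ≡.refl i≢i

oneMove-off : ∀ {N} {i k : Fin N} m → k ≢ i → oneMove i m k ≡ stay
oneMove-off {i = i} {k} m k≢i with k ≟ i
... | yes k≡i = contradiction k≡i k≢i
... | no  _   = ≡.refl

twoMoves-at : ∀ {N} (i : Fin N) m j m′ → twoMoves i m j m′ i ≡ m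
twoMoves-at i m j m′ with i ≟ i
... | yes _   = ≡.refl
... | no  i≢i = contradiction ≡.refl i≢i

twoMoves-other : ∀ {N} {i j : Fin N} m m′ → i ≢ j → twoMoves i m j m′ j ≡ m′
twoMoves-other {i = i} {j} m m′ i≢j with j ≟ i
... | yes j≡i = contradiction (≡.sym j≡i) i≢j
... | no  _   = oneMove-at j m′

twoMoves-off : ∀ {N} {i j k : Fin N} m m′ → k ≢ i → k ≢ j → twoMoves i m j m′ k ≡ stay
twoMoves-off {i = i} {j} {k} m m′ k≢i k≢j with k ≟ i
... | yes k≡i = contradiction k≡i k≢i
... | no  _   = oneMove-off m′ k≢j

twoMoves-comm : ∀ {N} {i j : Fin N} m m′ → i ≢ j → ∀ k → twoMoves j m′ i m k ≡ twoMoves i m j m′ k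
twoMoves-comm {i = i} {j} m m′ i≢j k with k ≟ i | k ≟ j
... | yes k≡i | yes k≡j = contradiction (≡.trans (≡.sym k≡i) k≡j) i≢j
... | yes _   | no  _   = ≡.refl
... | no  _   | yes _   = ≡.refl
... | no  _   | no  _   = ≡.refl

-- Names for the denominators in the coefficients of e_ij.
data Joint : Set where
  coefficient 1/Q 1/Δ 1/K 1/K′ : Joint

sameJoint : (a b : Joint) → Maybe (a ≡ b)
sameJoint coefficient coefficient = just ≡.refl
sameJoint 1/Q 1/Q = just ≡.refl
sameJoint 1/Δ 1/Δ = just ≡.refl
sameJoint 1/K 1/K = just ≡.refl
sameJoint 1/K′ 1/K′ = just ≡.refl
sameJoint _ _ = nothing

module ClosedForm {c ℓ₁ ℓ₂} (F : HeytingField c ℓ₁ ℓ₂) where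
  open FieldNotation F
  open Operators F
  open ColumnOperators F
  open OperatorEntries F
  open PairProducts F
  open ProductElements F
  open SiteIdentities commutativeRing
  open Collapse F using (when)
  open Triangles commutativeRing
  private
    module R = CommutativeRing commutativeRing
    raw = CommutativeRing.rawRing commutativeRing
    module Σ = SemiringSum R.semiring
  open Semantics commutativeRing
  open import Relation.Binary.Reasoning.Setoid R.setoid
  open import Algebra.Properties.Ring R.ring using (-‿distribˡ-*; -‿distribʳ-*; -‿+-comm; -‿involutive)
  open import Algebra.Properties.CommutativeSemigroup R.*-commutativeSemigroup
    using (interchange; x∙yz≈y∙xz)

  inverse-unique : ∀ {u v a} → u * a ≈ 1# → v * a ≈ 1# → u ≈ v
  inverse-unique {u} {v} {a} ua≈1 va≈1 = begin
    u            ≈⟨ *-identityʳ u ⟨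
    u * 1#       ≈⟨ *-congˡ va≈1 ⟨
    u * (v * a)  ≈⟨ x∙yz≈y∙xz u v a ⟩
    v * (u * a)  ≈⟨ *-congˡ ua≈1 ⟩
    v * 1#       ≈⟨ *-identityʳ v ⟩
    v            ∎

  inverse-* : ∀ {u v a b} → u * a ≈ 1# → v * b ≈ 1# → u * v * (a * b) ≈ 1#
  inverse-* ua≈1 vb≈1 = trans (interchange _ _ _ _) (trans (*-cong ua≈1 vb≈1) (*-identityˡ 1#))

  inverse-neg : ∀ {u a b} → u * (a - b) ≈ 1# → - u * (b - a) ≈ 1#
  inverse-neg {u} {a} {b} eq = trans (trans (sym (-‿distribˡ-* u _)) (-‿distribʳ-* u _)) (trans (*-congˡ
    (trans (sym (-‿+-comm b (- a))) (trans (+-comm _ _) (+-congʳ (-‿involutive a))))) eq)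

  reciprocal : ∀ {b} (b#0 : b # 0#) → proj₁ (#⇒invertible b#0) * b ≈ 1#
  reciprocal b#0 = trans (*-congˡ (sym (x-0≈x _))) (proj₁ (proj₂ (#⇒invertible b#0)))

  quotient : ∀ a {b} (b#0 : b # 0#) {b′} → b′ * b ≈ 1# → a / b ⟨ b#0 ⟩ ≈ a * b′
  quotient a b#0 b′-inverse = *-congˡ (inverse-unique (reciprocal b#0) b′-inverse)

  scaled-at : ∀ {N} a {m} → m ≢ down → ∀ (i : Fin N) s t →
              (scale₃ a (raising m) at i) s t ≈ a * selects (oneMove i m) s t
  scaled-at {N} a {m} m≢ i s t = begin
    (scale₃ a (raising m) at i) s t
      ≈⟨ at-product _ i s t ⟩
    product (λ k → choose (does (k ≟ i)) (scale₃ a (raising m)) I₃ (lookup s k) (lookup t k))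
      ≈⟨ product-cong {N} factor ⟩
    product (λ k → choose (does (k ≟ i)) a 1# * bit (sameMove (oneMove i m k) (move (lookup t k) (lookup s k))))
      ≈⟨ product-* {N} _ _ ⟩
    _ ≈⟨ *-congʳ (product-single′ i λ _ → a) ⟩
    a * selects (oneMove i m) s t ∎
    where
    factor : ∀ k → choose (does (k ≟ i)) (scale₃ a (raising m)) I₃ (lookup s k) (lookup t k) ≈
      choose (does (k ≟ i)) a 1# * bit (sameMove (oneMove i m k) (move (lookup t k) (lookup s k)))
    factor k with does (k ≟ i)
    ... | true  = *-congˡ (raising-entry m≢ (lookup s k) (lookup t k))
    ... | false = trans (raising-entry {stay} (λ ()) (lookup s k) (lookup t k)) (sym (*-identityˡ _))

  scaled-at₂ : ∀ {N} a b {m m′} → m ≢ down → m′ ≢ down → ∀ {i j : Fin N} → i ≢ j → ∀ s t →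
    (scale₃ a (raising m) at i ⊙ scale₃ b (raising m′) at j) s t ≈ a * b * selects (twoMoves i m j m′) s t
  scaled-at₂ {N} a b {m} {m′} m≢ m′≢ {i} {j} i≢j s t = begin
    _ ≈⟨ at-⊙-at _ _ i≢j s t ⟩
    product (λ k → choose (does (k ≟ i)) (scale₃ a (raising m)) (choose (does (k ≟ j)) (scale₃ b (raising m′)) I₃)
                     (lookup s k) (lookup t k))
      ≈⟨ product-cong {N} factor ⟩
    product (λ k → choose (does (k ≟ i)) a 1# * choose (does (k ≟ j)) b 1# *
                   bit (sameMove (twoMoves i m j m′ k) (move (lookup t k) (lookup s k))))
      ≈⟨ trans (product-* {N} _ _) (*-congʳ (product-* {N} _ _)) ⟩
    _ ≈⟨ *-congʳ (*-cong (product-single′ i λ _ → a) (product-single′ j λ _ → b)) ⟩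
    a * b * selects (twoMoves i m j m′) s t ∎
    where
    factor : ∀ k → choose (does (k ≟ i)) (scale₃ a (raising m)) (choose (does (k ≟ j)) (scale₃ b (raising m′)) I₃)
                     (lookup s k) (lookup t k) ≈
      choose (does (k ≟ i)) a 1# * choose (does (k ≟ j)) b 1# *
      bit (sameMove (twoMoves i m j m′ k) (move (lookup t k) (lookup s k)))
    factor k with k ≟ i | k ≟ j
    ... | yes k≡i | yes k≡j = contradiction (≡.trans (≡.sym k≡i) k≡j) i≢j
    ... | yes _   | no _    = *-cong (sym (*-identityʳ a)) (raising-entry m≢ (lookup s k) (lookup t k))
    ... | no _    | yes _   = *-cong (sym (*-identityˡ b)) (raising-entry m′≢ (lookup s k) (lookup t k))
    ... | no _    | no _    = trans (raising-entry {stay} (λ ()) (lookup s k) (lookup t k))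
      (sym (trans (*-congʳ (*-identityˡ 1#)) (*-identityˡ _)))

  module Entries {q : Carrier} {N : ℕ} {x : Fin N → Carrier} (inverses : Reciprocals q x) where

    open Reciprocals inverses

    open LocalWeights raw q 1/q 1/[1+q] hiding (_-_)
    open Sites x δ κ
    open Spectral

    δ-antisym : ∀ {i j} → i ≢ j → - δ i j ≈ δ j i
    δ-antisym i≢j = inverse-unique (inverse-neg (δ-inverse i≢j)) (δ-inverse (≢-sym i≢j))

    dress : Fin N → Fin N → Fin 3 → Move → Carrier
    dress k l = dressing (x k) (x l) (δ k l) (κ k l) (κ l k)

    dressing-cong : ∀ {a b d d′ e e′} → d ≈ d′ → ∀ c m → dressing a b d e e′ c m ≈ dressing a b d′ e e′ c m
    dressing-cong d≈ c  stay      = refl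
    dressing-cong d≈ 0F (raise _) = refl
    dressing-cong d≈ 1F (raise ○) = *-congˡ (*-congˡ d≈)
    dressing-cong d≈ 1F (raise ●) = refl
    dressing-cong d≈ 2F (raise ○) = refl
    dressing-cong d≈ 2F (raise ●) = *-congˡ d≈
    dressing-cong d≈ 0F leap      = refl
    dressing-cong d≈ 1F leap      = *-congˡ d≈
    dressing-cong d≈ 2F leap      = *-congˡ (*-congʳ d≈)
    dressing-cong d≈ 0F down      = refl
    dressing-cong d≈ 1F down      = refl
    dressing-cong d≈ 2F down      = refl

    -- The factor of a pair of sites is the product of the dressing of k by the moves
    -- of l, the dressing of l by the moves of k, and the joint weight.
    half : Fin N → Fin N → Fin 3 → Move → Move → Carrier
    half k l c stay m′ = dress k l c m′
    half k l c _    m′ = 1#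

    joint : Carrier → Fin N → Fin N → Move → Move → Carrier
    joint z k l stay m′   = 1#
    joint z k l m    stay = 1#
    joint z k l m    m′   = jointWeight z (x k) (x l) (δ k l) (κ k l) (κ l k) m m′

    half-stay : ∀ k l c m → half k l c m stay ≈ 1#
    half-stay k l c stay      = refl
    half-stay k l c (raise _) = refl
    half-stay k l c leap      = refl
    half-stay k l c down      = refl

    half-self : ∀ k c m → half k k c m m ≈ 1#
    half-self k c stay      = refl
    half-self k c (raise _) = refl
    half-self k c leap      = refl
    half-self k c down      = refl

    joint-stay : ∀ z k l m → joint z k l m stay ≈ 1#
    joint-stay z k l stay      = refl
    joint-stay z k l (raise _) = refl
    joint-stay z k l leap      = refl
    joint-stay z k l down      = refl

    private
      1*y*1 : ∀ {y} → y ≈ 1# * y * 1#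
      1*y*1 = sym (trans (*-identityʳ _) (*-identityˡ _))
      y*1*1 : ∀ {y} → y ≈ y * 1# * 1#
      y*1*1 = sym (trans (*-identityʳ _) (*-identityʳ _))
      1*1*y : ∀ {y} → y ≈ 1# * 1# * y
      1*1*y = sym (trans (*-congʳ (*-identityˡ _)) (*-identityˡ _))

    dressing-flip : ∀ {k l} → k ≢ l → ∀ c m →
      dressing (x l) (x k) (- δ k l) (κ l k) (κ k l) c m ≈ dress l k c m
    dressing-flip {k} {l} k≢l c m =
      dressing-cong {x l} {x k} {e = κ l k} {κ k l} (δ-antisym k≢l) c m

    pair-split : ∀ z {k l} → k ≢ l → ∀ a m b m′ →
      pairWeight z (x k) (x l) (δ k l) (κ k l) (κ l k) a m b m′ ≈
      half k l a m m′ * half l k b m′ m * joint z k l m m′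
    pair-split z k≢l a stay      b stay      = y*1*1
    pair-split z k≢l a stay      b (raise _) = y*1*1
    pair-split z k≢l a stay      b leap      = y*1*1
    pair-split z k≢l a stay      b down      = y*1*1
    pair-split z k≢l a (raise u) b stay      = trans (dressing-flip k≢l b (raise u)) 1*y*1
    pair-split z k≢l a leap      b stay      = trans (dressing-flip k≢l b leap) 1*y*1
    pair-split z k≢l a down      b stay      = trans (dressing-flip k≢l b down) 1*y*1
    pair-split z k≢l a (raise _) b (raise _) = 1*1*y
    pair-split z k≢l a (raise _) b leap      = 1*1*y
    pair-split z k≢l a (raise _) b down      = 1*1*y
    pair-split z k≢l a leap      b (raise _) = 1*1*y
    pair-split z k≢l a leap      b leap      = 1*1*y
    pair-split z k≢l a leap      b down      = 1*1*y
    pair-split z k≢l a down      b (raise _) = 1*1*y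
    pair-split z k≢l a down      b leap      = 1*1*y
    pair-split z k≢l a down      b down      = 1*1*y

    module _ (Z : Spectral (Fin N)) where

      weightAt : Fin N → Fin 3 → Move → Carrier
      weightAt k = siteWeight (value Z) (x k) (reach Z k) (reach′ Z k)

      -- The closed form as a function of the moves μ and the initial state t, with the
      -- dressings collected as a product over ordered pairs of sites.
      factored : (Fin N → Move) → State N → Carrier
      factored μ t = product (λ k → weightAt k (lookup t k) (μ k)) *
        (product (λ k → product λ l → half k l (lookup t k) (μ k) (μ l)) *
         pairProduct (λ k l → joint (value Z) k l (μ k) (μ l)))

      factored-cong : ∀ {μ ν : Fin N → Move} → (∀ k → μ k ≡ ν k) → ∀ t → factored μ t ≈ factored ν t
      factored-cong {μ} {ν} μ≡ν t = *-cong
        (product-cong {N} λ k → reflexive (≡.cong (weightAt k (lookup t k)) (μ≡ν k)))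
        (*-cong (product-cong {N} λ k → product-cong {N} λ l →
                   reflexive (≡.cong₂ (half k l (lookup t k)) (μ≡ν k) (μ≡ν l)))
                (pairProduct-cong {N} λ k l _ → reflexive (≡.cong₂ (joint (value Z) k l) (μ≡ν k) (μ≡ν l))))

      -- The moves from t to s.
      μ[_,_] : State N → State N → Fin N → Move
      μ[ t , s ] k = move (lookup t k) (lookup s k)

      strength-factored : ∀ s t → strength inverses Z s t ≈ factored μ[ t , s ] t
      strength-factored s t = trans (triangle-product {N} _ _) (*-congˡ (trans
        (pairProduct-cong {N} λ k l k<l →
           pair-split (value Z) (<⇒≢ k<l) (lookup t k) (μ[ t , s ] k) (lookup t l) (μ[ t , s ] l))
        (trans (pairProduct-* {N} (λ k l → H k l * H l k) _)
          (*-congʳ (pairProduct-ordered {N} H λ k → half-self k (lookup t k) (μ[ t , s ] k))))))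
        where
        H : Fin N → Fin N → Carrier
        H k l = half k l (lookup t k) (μ[ t , s ] k) (μ[ t , s ] l)

      factored-one : ∀ i m t → factored (oneMove i m) t ≈
        product (λ k → weightAt k (lookup t k) (oneMove i m k) * half k i (lookup t k) (oneMove i m k) m)
      factored-one i m t = trans (*-congˡ (trans (*-cong inner outer) (*-identityʳ _))) (sym (product-* {N} _ _))
        where
        ε = oneMove i m
        inner = product-cong {N} λ k → trans
          (product-single i {λ l → half k l (lookup t k) (ε k) (ε l)} λ l l≢i →
            trans (reflexive (≡.cong (half k l (lookup t k) (ε k)) (oneMove-off m l≢i)))
                  (half-stay k l (lookup t k) (ε k)))
          (reflexive (≡.cong (half k i (lookup t k) (ε k)) (oneMove-at i m)))
        outer : pairProduct (λ k l → joint (value Z) k l (ε k) (ε l)) ≈ 1#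
        outer = pairProduct-ones {N} λ k l k<l → lonely k l k<l
          where
          lonely : ∀ k l → k Fin.< l → joint (value Z) k l (ε k) (ε l) ≈ 1#
          lonely k l k<l with k ≟ i
          ... | no  _      = refl
          ... | yes ≡.refl = trans (reflexive (≡.cong (joint (value Z) k l m) (oneMove-off m (≢-sym (<⇒≢ k<l)))))
                               (joint-stay (value Z) k l m)

      factored-two : ∀ {i j} → i Fin.< j → ∀ m m′ t → factored (twoMoves i m j m′) t ≈
        product (λ k → weightAt k (lookup t k) (twoMoves i m j m′ k) *
          (half k i (lookup t k) (twoMoves i m j m′ k) m * half k j (lookup t k) (twoMoves i m j m′ k) m′)) *
        joint (value Z) i j m m′
      factored-two {i} {j} i<j m m′ t =
        trans (*-congˡ (*-cong inner outer)) (trans (sym (*-assoc _ _ _)) (*-congʳ (sym (product-* {N} _ _))))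
        where
        ε = twoMoves i m j m′
        i≢j = <⇒≢ i<j
        inner = product-cong {N} λ k → trans
          (product-double i≢j {λ l → half k l (lookup t k) (ε k) (ε l)} λ l l≢i l≢j →
            trans (reflexive (≡.cong (half k l (lookup t k) (ε k)) (twoMoves-off m m′ l≢i l≢j)))
                  (half-stay k l (lookup t k) (ε k)))
          (*-cong (reflexive (≡.cong (half k i (lookup t k) (ε k)) (twoMoves-at i m j m′)))
                  (reflexive (≡.cong (half k j (lookup t k) (ε k)) (twoMoves-other m m′ i≢j))))
        outer : pairProduct (λ k l → joint (value Z) k l (ε k) (ε l)) ≈ joint (value Z) i j m m′
        outer = trans (pairProduct-single {N} i<j {λ k l → joint (value Z) k l (ε k) (ε l)} lonely)
          (reflexive (≡.cong₂ (joint (value Z) i j) (twoMoves-at i m j m′) (twoMoves-other m m′ i≢j)))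
          where
          stayˡ : ∀ k l → ε k ≡ stay → joint (value Z) k l (ε k) (ε l) ≈ 1#
          stayˡ k l eq = reflexive (≡.cong (λ μ → joint (value Z) k l μ (ε l)) eq)
          stayʳ : ∀ k l → ε l ≡ stay → joint (value Z) k l (ε k) (ε l) ≈ 1#
          stayʳ k l eq = trans (reflexive (≡.cong (joint (value Z) k l (ε k)) eq)) (joint-stay (value Z) k l (ε k))
          lonely : ∀ k l → k Fin.< l → ¬ (k ≡ i × l ≡ j) → joint (value Z) k l (ε k) (ε l) ≈ 1#
          lonely k l k<l ≢ = go (k ≟ i) (k ≟ j) (l ≟ j)
            where
            go : Dec (k ≡ i) → Dec (k ≡ j) → Dec (l ≡ j) → joint (value Z) k l (ε k) (ε l) ≈ 1#
            go (no k≢i)  (no k≢j)  _          = stayˡ k l (twoMoves-off m m′ k≢i k≢j)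
            go (no k≢i)  (yes k≡j) _          = stayʳ k l (twoMoves-off m m′
              (λ l≡i → ℕ.<-asym i<j (≡.subst₂ Fin._<_ k≡j l≡i k<l))
              (λ l≡j → <⇒≢ k<l (≡.trans k≡j (≡.sym l≡j))))
            go (yes k≡i) _         (yes l≡j)  = contradiction (k≡i , l≡j) ≢
            go (yes k≡i) _         (no l≢j)   =
              stayʳ k l (twoMoves-off m m′ (λ l≡i → <⇒≢ k<l (≡.trans k≡i (≡.sym l≡i))) l≢j)

      -- The closed form, without the condition on the number of arrows.
      X[_] : ℕ → State N → State N → Carrier
      X[ k ] s t = prefactor (value Z) k * strength inverses Z s t

      siteValue : Fin N → Fin 3 → Carrier
      siteValue k c = weightAt k c stay

      -- A term of Γ₁ or Γ₂ in which only the site i moves, and one in which the sites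
      -- i < j move: each is the closed form, provided that the transition consists of
      -- the moves in question. The prefactors for k = 1 and k = 2 agree, so that the
      -- first serves both Γ₁ and Γ₂.
      one-term : ∀ {i m a} → m ≢ stay → {A : Op N} →
        (∀ s t → A s t ≈ a * selects (oneMove i m) s t) →
        (∀ c → a ≈ prefactor (value Z) 1 * weightAt i c m) →
        {O : Fin N → Op N} {v : Fin N → Fin 3 → Carrier} →
        (∀ k → Diagonal (O k) (λ t → choose (does (k ≟ i)) 1# (v k (lookup t k)))) →
        (∀ k → k ≢ i → ∀ c → v k c ≈ siteValue k c * dress k i c m) →
        ∀ s t → (A ⊙ ∏ᴼ O) s t ≈ selects (oneMove i m) s t * X[ 1 ] s t
      one-term {i} {m} {a} m≢stay {A} A≈ a≈ {O} {v} O-diag v≈ s t = begin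
        (A ⊙ ∏ᴼ O) s t
          ≈⟨ ⊙-diagonal A (∏ᴼ O) (diagonal-∏ {O = O} O-diag) s t ⟩
        A s t * product f
          ≈⟨ *-congʳ (A≈ s t) ⟩
        a * selects ε s t * product f
          ≈⟨ trans (*-congʳ (*-comm _ _)) (*-assoc _ _ _) ⟩
        selects ε s t * (a * product f)
          ≈⟨ selects-* ε s t matched ⟩
        selects ε s t * X[ 1 ] s t ∎
        where
        ε = oneMove i m
        f g : Fin N → Carrier
        f k = choose (does (k ≟ i)) 1# (v k (lookup t k))
        g k = weightAt k (lookup t k) (ε k) * half k i (lookup t k) (ε k) m
        f≈g : ∀ k → k ≢ i → f k ≈ g k
        f≈g k k≢i with k ≟ i
        ... | yes k≡i = contradiction k≡i k≢i
        ... | no  _   = v≈ k k≢i (lookup t k)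
        half-raised : ∀ k c → half k i c m m ≈ 1#
        half-raised k c = half-raised′ m m≢stay
          where
          half-raised′ : ∀ m′ → m′ ≢ stay → half k i c m′ m ≈ 1#
          half-raised′ stay      ≢ = contradiction ≡.refl ≢
          half-raised′ (raise _) ≢ = refl
          half-raised′ leap      ≢ = refl
          half-raised′ down      ≢ = refl
        at-i : a * f i ≈ prefactor (value Z) 1 * g i
        at-i with i ≟ i
        ... | no i≢i = contradiction ≡.refl i≢i
        ... | yes _  = trans (*-identityʳ a) (trans (a≈ (lookup t i))
          (*-congˡ (sym (trans (*-congˡ (half-raised i (lookup t i))) (*-identityʳ _)))))
        matched : (∀ k → ε k ≡ move (lookup t k) (lookup s k)) → a * product f ≈ X[ 1 ] s t
        matched ε≡μ = trans (product-replace i {f} {g} f≈g at-i) (*-congˡ (sym (trans (strength-factored s t)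
          (trans (factored-cong {μ[ t , s ]} {ε} (λ k → ≡.sym (ε≡μ k)) t) (factored-one i m t)))))

      two-term : ∀ {i j} → i Fin.< j → ∀ {m m′ a} → m ≢ stay → m′ ≢ stay → {A : Op N} →
        (∀ s t → A s t ≈ a * selects (twoMoves i m j m′) s t) →
        (∀ c c′ → a ≈ prefactor (value Z) 2 * (weightAt i c m * weightAt j c′ m′ * joint (value Z) i j m m′)) →
        {O : Fin N → Op N} {v : Fin N → Fin 3 → Carrier} →
        (∀ k → Diagonal (O k) (λ t → choose (does (k ≟ i)) 1# (choose (does (k ≟ j)) 1# (v k (lookup t k))))) →
        (∀ k → k ≢ i → k ≢ j → ∀ c → v k c ≈ siteValue k c * (dress k i c m * dress k j c m′)) →
        ∀ s t → (A ⊙ ∏ᴼ O) s t ≈ selects (twoMoves i m j m′) s t * X[ 2 ] s t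
      two-term {i} {j} i<j {m} {m′} {a} m≢stay m′≢stay {A} A≈ a≈ {O} {v} O-diag v≈ s t = begin
        (A ⊙ ∏ᴼ O) s t
          ≈⟨ ⊙-diagonal A (∏ᴼ O) (diagonal-∏ {O = O} O-diag) s t ⟩
        A s t * product f
          ≈⟨ *-congʳ (A≈ s t) ⟩
        a * selects ε s t * product f
          ≈⟨ trans (*-congʳ (*-comm _ _)) (*-assoc _ _ _) ⟩
        selects ε s t * (a * product f)
          ≈⟨ selects-* ε s t matched ⟩
        selects ε s t * X[ 2 ] s t ∎
        where
        ε = twoMoves i m j m′
        i≢j = <⇒≢ i<j
        J = joint (value Z) i j m m′
        f g : Fin N → Carrier
        f k = choose (does (k ≟ i)) 1# (choose (does (k ≟ j)) 1# (v k (lookup t k)))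
        g k = weightAt k (lookup t k) (ε k) * (half k i (lookup t k) (ε k) m * half k j (lookup t k) (ε k) m′)
        f≈g : ∀ k → k ≢ i → k ≢ j → f k ≈ g k
        f≈g k k≢i k≢j with k ≟ i | k ≟ j
        ... | yes k≡i | _       = contradiction k≡i k≢i
        ... | no  _   | yes k≡j = contradiction k≡j k≢j
        ... | no  _   | no  _   = v≈ k k≢i k≢j (lookup t k)
        half-raised : ∀ k l c μ → μ ≢ stay → ∀ m″ → half k l c μ m″ ≈ 1#
        half-raised k l c stay      m≢ m″ = contradiction ≡.refl m≢
        half-raised k l c (raise _) m≢ m″ = refl
        half-raised k l c leap      m≢ m″ = refl
        half-raised k l c down      m≢ m″ = refl
        g-raised : ∀ k μ → μ ≢ stay → ε k ≡ μ → g k ≈ weightAt k (lookup t k) μ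
        g-raised k μ μ≢ ≡.refl = trans (*-congˡ (trans (*-cong (half-raised k i (lookup t k) μ μ≢ m)
          (half-raised k j (lookup t k) μ μ≢ m′)) (*-identityˡ 1#))) (*-identityʳ _)
        f-at-i : f i ≈ 1#
        f-at-i with i ≟ i
        ... | no i≢i = contradiction ≡.refl i≢i
        ... | yes _  = refl
        f-at-j : f j ≈ 1#
        f-at-j with j ≟ i | j ≟ j
        ... | yes _ | _       = refl
        ... | no  _ | no  j≢j = contradiction ≡.refl j≢j
        ... | no  _ | yes _   = refl
        at-ij : a * (f i * f j) ≈ prefactor (value Z) 2 * J * (g i * g j)
        at-ij = trans (trans (*-congˡ (trans (*-cong f-at-i f-at-j) (*-identityˡ 1#))) (*-identityʳ a))
          (trans (a≈ (lookup t i) (lookup t j)) (trans (*-congˡ (*-comm _ _)) (trans (sym (*-assoc _ _ _))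
            (*-congˡ (sym (*-cong (g-raised i m m≢stay (twoMoves-at i m j m′))
                                  (g-raised j m′ m′≢stay (twoMoves-other m m′ i≢j))))))))
        matched : (∀ k → ε k ≡ move (lookup t k) (lookup s k)) → a * product f ≈ X[ 2 ] s t
        matched ε≡μ = trans (product-replace₂ i≢j {f} {g} f≈g at-ij) (trans (*-assoc _ _ _) (*-congˡ
          (trans (*-comm _ _) (sym (trans (strength-factored s t)
            (trans (factored-cong {μ[ t , s ]} {ε} (λ k → ≡.sym (ε≡μ k)) t) (factored-two i<j m m′ t)))))))

-- The closed form of the matrix elements

-- The identities between the coefficients, in q, z, x and w. The denominator of the
-- coefficient of e_ij is a parameter, since the four cases have different ones.
module JointIdentities where
  open RawRing (expressions 4 ⊥) using (rawSemiring)
  open RawSemiringDefinitions rawSemiring using (_^_)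

  q z x w : ∀ {A} → Expr 4 A
  q = var 0F
  z = var 1F
  x = var 2F
  w = var 3F

  infixl 6 _:-_
  _:-_ : ∀ {A} → Expr 4 A → Expr 4 A → Expr 4 A
  e :- f = e :+ (:- f)

  denominator○○ denominator●○ denominator○● denominator●● : PolyExpr 4
  denominator○○ = (:1 :- q ^ 2) :* z
  denominator●○ = q :* (:1 :- q) :* (x :- w) :* z
  denominator○● = q :* (:1 :- q) :* (w :- x) :* z
  denominator●● = q :* (:1 :- q) :* (x :- q :* w) :* (w :- q :* x) :* z

  denominator : PolyExpr 4 → Joint → PolyExpr 4
  denominator D coefficient = D
  denominator D 1/Q  = q
  denominator D 1/Δ  = x :- w
  denominator D 1/K  = x :- q :* w
  denominator D 1/K′ = w :- q :* x

  module _ where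
    open RawSemiringDefinitions (RawRing.rawSemiring (expressions 4 Joint)) using () renaming (_^_ to _^ᴶ_)
    open LocalWeights (expressions 4 Joint) q (inv 1/Q) :0 public using (jointWeight; prefactor)

    numerator○○ numerator●○ numerator○● numerator●● : Expr 4 Joint
    numerator○○ = x :* w :+ q ^ᴶ 2 :* x :* w :- q ^ᴶ 2 :* x :* z :- q ^ᴶ 2 :* w :* z
    numerator●○ = x :* w :+ q ^ᴶ 2 :* x :* w :- q ^ᴶ 2 :* x :* z :- q ^ᴶ 3 :* w :* z
    numerator○● = w :* x :+ q ^ᴶ 2 :* w :* x :- q ^ᴶ 2 :* w :* z :- q ^ᴶ 3 :* x :* z
    numerator●● = (:1 :+ q) :* (x :* w :+ q ^ᴶ 2 :* x :* w :- q ^ᴶ 3 :* x :* z :- q ^ᴶ 3 :* w :* z)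

    weighted : Expr 4 Joint → Expr 4 Joint
    weighted e = e :* inv coefficient :* prefactor z 2

    joint : Move → Move → Expr 4 Joint
    joint = jointWeight z x w (inv 1/Δ) (inv 1/K) (inv 1/K′)

  -- Here w is the reciprocal of (x - q²z)(x - q³z).
  e●-scalar e●-normal e●○-scalar e●○-normal : PolyExpr 4
  e●-scalar  = q :* (:1 :- q) ^ 2 :* (:1 :+ q) :* (x :- z) :* z :* w
  e●-normal  = (:1 :- q ^ 2) :* z :* (q :* (:1 :- q) :* (x :- z) :* w)
  e●○-scalar = (:1 :- q ^ 2) :* (x :+ q ^ 2 :* x :- q ^ 2 :* z :- q ^ 3 :* z) :* z :* w
  e●○-normal = (:1 :- q ^ 2) :* z :* ((x :+ q ^ 2 :* x :- q ^ 2 :* z :- q ^ 3 :* z) :* w)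

-- The commutation n ((p v) (p w)) = p (v w (n p)).
module Shuffle where
  lhs rhs : PolyExpr 4
  lhs = var 0F :* (var 1F :* var 2F :* (var 1F :* var 3F))
  rhs = var 1F :* (var 2F :* var 3F :* (var 0F :* var 1F))

module MatrixElements {c ℓ₁ ℓ₂} (F : HeytingField c ℓ₁ ℓ₂) where
  open FieldNotation F
  open Operators F
  open ColumnOperators using (Γ)
  open ColumnOperators.Twisted using (d; dᵘ[x]; d●○[x]; eᵘ; e●○; eᵘᵛ; Γ₀; Γ₁; Γ₂; den; den#0; xᵢ-q²z#0)
  open OperatorEntries F
  open PairProducts F
  open ProductElements F
  open SiteIdentities commutativeRing
  open ClosedForm F
  open Collapse F using (when)
  private
    module R = CommutativeRing commutativeRing
    raw = CommutativeRing.rawRing commutativeRing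
    module Σ = SemiringSum R.semiring
    module J = JointIdentities
  open Semantics commutativeRing
  open FractionSound commutativeRing using (polynomial-identity)
  open import Relation.Binary.Reasoning.Setoid R.setoid

  diagonal-≈ : ∀ {N} {B : Op N} {u v : State N → Carrier} → (∀ t → u t ≈ v t) → Diagonal B u → Diagonal B v
  diagonal-≈ u≈v B-diag s t = trans (B-diag s t) (*-congˡ (u≈v t))

  sumIf-entry : ∀ {N p} {P : Set p} (P? : Dec P) {O : P → Op N} {s t : State N} {y} →
                (∀ p → O p s t ≈ y) → sumIf P? O s t ≈ choose (does P?) y 0#
  sumIf-entry (yes p) O≈ = O≈ p
  sumIf-entry (no _)  O≈ = refl

  -- The terms of Γ₁ and Γ₂.
  module Terms {q : Carrier} (gq : GenericQ F q) {N : ℕ} (X : Alphabet F q N)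
               (z : Carrier) (gz : GenericSpectral F X z) where

    raised : Decoration → Fin N → Op N
    raised u i = eᵘ F gq X z gz u i ⊙
      ∏ᴼ λ j → mulUnless (j ≟ i) λ j≢i → d F gq X z gz j ⊙ dᵘ[x] F gq X j i j≢i u

    leapt : Fin N → Op N
    leapt i = e●○ F gq X z gz i ⊙
      ∏ᴼ λ j → mulUnless (j ≟ i) λ j≢i → d F gq X z gz j ⊙ d●○[x] F gq X j i j≢i

    raised₂ : Decoration → Decoration → (i j : Fin N) → i Fin.< j → Op N
    raised₂ u v i j i<j = eᵘᵛ F gq X z gz u v i j (<⇒≢ i<j) ⊙
      ∏ᴼ λ k → mulUnless (k ≟ i) λ k≢i → mulUnless (k ≟ j) λ k≢j →
        d F gq X z gz k ⊙ dᵘ[x] F gq X k i k≢i u ⊙ dᵘ[x] F gq X k j k≢j v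

    pairs : Decoration → Decoration → Op N
    pairs u v = ∑ᴼ λ i → ∑ᴼ λ j → sumIf (i <? j) (raised₂ u v i j)

    Γ₁-terms : ∀ s t → Γ₁ F gq X z gz s t ≈ ∑ᴼ (raised ○) s t + ∑ᴼ (raised ●) s t
    Γ₁-terms s t = refl

    Γ₂-terms : ∀ s t → Γ₂ F gq X z gz s t ≈
      ∑ᴼ leapt s t + ((pairs ○ ○ s t + pairs ○ ● s t) + (pairs ● ○ s t + pairs ● ● s t))
    Γ₂-terms s t = refl

  module _ {q : Carrier} (gq : GenericQ F q) {N : ℕ} (X : Alphabet F q N)
           (inverses : Reciprocals q (Alphabet.letter X)) where

    open Reciprocals inverses
    private x = Alphabet.letter X
    open LocalWeights raw q 1/q 1/[1+q] hiding (_-_)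
    open Sites x δ κ
    open Spectral
    open LetterLaws inverses using (Lawful)
    open Lawful
    open Entries inverses

    module _ (Z : Spectral (Fin N)) (Z-lawful : Lawful Z) (gz : GenericSpectral F X (value Z)) where

      open Terms gq X (value Z) gz

      private
        reaches : ∀ k → reach Z k * (x k - q ^ 2 * value Z) ≈ 1#
        reaches = reach-inverse Z-lawful

        both-reach : ∀ k → reach Z k * reach′ Z k * ((x k - q ^ 2 * value Z) * (x k - q ^ 3 * value Z)) ≈ 1#
        both-reach k = inverse-* (reaches k) (reach′-inverse Z-lawful k)

      d-diagonal : ∀ k → Diagonal (d F gq X (value Z) gz k) (λ t → siteValue Z k (lookup t k))
      d-diagonal k = diagonal-≈ (λ t → value≈ (lookup t k)) (diagonal-at _ _ _ k)
        where
        value≈ : ∀ c → diag 1# _ _ c c ≈ siteValue Z k c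
        value≈ 0F = refl
        value≈ 1F = quotient _ _ (reaches k)
        value≈ 2F = quotient _ _ (both-reach k)

      dᵘ-diagonal : ∀ k i (k≢i : k ≢ i) u → Diagonal (dᵘ[x] F gq X k i k≢i u) (λ t → dress k i (lookup t k) (raise u))
      dᵘ-diagonal k i k≢i ○ = diagonal-≈ (λ t → value≈ (lookup t k)) (diagonal-at _ _ _ k)
        where
        value≈ : ∀ c → diag 1# _ _ c c ≈ dress k i c (raise ○)
        value≈ 0F = refl
        value≈ 1F = quotient _ _ (inverse-* 1+q-inverse (δ-inverse k≢i))
        value≈ 2F = quotient _ _ (κ-inverse k≢i)
      dᵘ-diagonal k i k≢i ● = diagonal-≈ (λ t → value≈ (lookup t k)) (diagonal-at _ _ _ k)
        where
        value≈ : ∀ c → diag 1# _ _ c c ≈ dress k i c (raise ●)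
        value≈ 0F = refl
        value≈ 1F = quotient _ _ (inverse-neg (κ-inverse (≢-sym k≢i)))
        value≈ 2F = quotient _ _ (δ-inverse k≢i)

      d●○-diagonal : ∀ k i (k≢i : k ≢ i) → Diagonal (d●○[x] F gq X k i k≢i) (λ t → dress k i (lookup t k) leap)
      d●○-diagonal k i k≢i = diagonal-≈ (λ t → value≈ (lookup t k)) (diagonal-at _ _ _ k)
        where
        value≈ : ∀ c → diag 1# _ _ c c ≈ dress k i c leap
        value≈ 0F = refl
        value≈ 1F = quotient _ _ (δ-inverse k≢i)
        value≈ 2F = quotient _ _ (inverse-* (δ-inverse k≢i) (κ-inverse k≢i))

      scalar : Decoration → Fin N → Carrier
      scalar ○ i = ((1# - q ^ 2) * value Z) / (x i - q ^ 2 * value Z) ⟨ xᵢ-q²z#0 F gq X (value Z) gz i ⟩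
      scalar ● i = (q * (1# - q) ^ 2 * (1# + q) * (x i - value Z) * value Z)
        / den F gq X (value Z) gz i ⟨ den#0 F gq X (value Z) gz i ⟩

      scalar≈ : ∀ u i c → scalar u i ≈ prefactor (value Z) 1 * weightAt Z i c (raise u)
      scalar≈ ○ i c = quotient _ _ (reaches i)
      scalar≈ ● i c = trans (quotient _ _ (both-reach i))
        (polynomial-identity J.e●-scalar J.e●-normal ≡.refl (q ∷ value Z ∷ x i ∷ reach Z i * reach′ Z i ∷ []))

      eᵘ-entry : ∀ u i s t → eᵘ F gq X (value Z) gz u i s t ≈ scalar u i * selects (oneMove i (raise u)) s t
      eᵘ-entry ○ i = scaled-at (scalar ○ i) {raise ○} (λ ()) i
      eᵘ-entry ● i = scaled-at (scalar ● i) {raise ●} (λ ()) i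

      private
        E : ℕ → State N → State N → Carrier
        E k = element inverses Z k

        bit-when : ∀ b y → bit b * y ≈ when b y
        bit-when true  y = *-identityˡ y
        bit-when false y = zeroˡ y

      Γ₀-entry : ∀ s t → Γ₀ F gq X (value Z) gz s t ≈ E 0 s t
      Γ₀-entry s t = begin
        Γ₀ F gq X (value Z) gz s t
          ≈⟨ diagonal-∏ {O = d F gq X (value Z) gz} d-diagonal s t ⟩
        kron s t * product (λ k → siteValue Z k (lookup t k))
          ≈⟨ *-congʳ (product-cong {N} λ k → raising-entry {stay} (λ ()) (lookup s k) (lookup t k)) ⟩
        none s t * product (λ k → siteValue Z k (lookup t k))
          ≈⟨ selects-* (λ _ → stay) s t matched ⟩
        none s t * X[_] Z 0 s t
          ≈⟨ *-congʳ (count-none s t) ⟩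
        bit (totalArrows t s ℕ.≡ᵇ 0) * X[_] Z 0 s t
          ≈⟨ bit-when (totalArrows t s ℕ.≡ᵇ 0) _ ⟩
        E 0 s t ∎
        where
        matched : (∀ k → stay ≡ move (lookup t k) (lookup s k)) →
                  product (λ k → siteValue Z k (lookup t k)) ≈ X[_] Z 0 s t
        matched stay≡μ = sym (trans (*-identityˡ _) (trans (strength-factored Z s t)
          (trans (factored-cong Z (λ k → ≡.sym (stay≡μ k)) t)
            (trans (*-congˡ (trans (*-cong (product-ones {N} λ k → product-ones {N} λ l → refl)
              (pairProduct-ones {N} λ k l _ → refl)) (*-identityˡ 1#))) (*-identityʳ _)))))

      e-term : ∀ u i s t →
        raised u i s t ≈ selects (oneMove i (raise u)) s t * X[_] Z 1 s t
      e-term u i = one-term Z {i} {raise u} (λ ()) (eᵘ-entry u i) (scalar≈ u i)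
        {v = λ k c → siteValue Z k c * dress k i c (raise u)}
        (λ k → diagonal-unless (k ≟ i) λ k≢i → diagonal-⊙ (d-diagonal k) (dᵘ-diagonal k i k≢i u))
        (λ k k≢i c → refl)

      ∑-terms : ∀ {m k} {O : Fin N → Op N} s t → (∀ i → O i s t ≈ selects (oneMove i m) s t * X[_] Z k s t) →
                ∑ᴼ O s t ≈ singles s t m * X[_] Z k s t
      ∑-terms {O = O} s t O≈ = trans (∑ᴼ-entry O s t) (trans (Σ.sum-cong-≋ {N} O≈) (sym (Σ.*-distribʳ-sum {N} _ _)))

      Γ₁-entry : ∀ s t → Γ₁ F gq X (value Z) gz s t ≈ E 1 s t
      Γ₁-entry s t = begin
        Γ₁ F gq X (value Z) gz s t
          ≈⟨ Γ₁-terms s t ⟩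
        ∑ᴼ (raised ○) s t + ∑ᴼ (raised ●) s t
          ≈⟨ +-cong (∑-terms {k = 1} {raised ○} s t λ i → e-term ○ i s t)
                    (∑-terms {k = 1} {raised ●} s t λ i → e-term ● i s t) ⟩
        singles s t (raise ○) * X[_] Z 1 s t + singles s t (raise ●) * X[_] Z 1 s t
          ≈⟨ distribʳ _ _ _ ⟨
        (singles s t (raise ○) + singles s t (raise ●)) * X[_] Z 1 s t
          ≈⟨ *-congʳ (count-one s t) ⟩
        bit (totalArrows t s ℕ.≡ᵇ 1) * X[_] Z 1 s t
          ≈⟨ bit-when (totalArrows t s ℕ.≡ᵇ 1) _ ⟩
        E 1 s t ∎

      scalar●○ : Fin N → Carrier
      scalar●○ i = ((1# - q ^ 2) * (x i + q ^ 2 * x i - q ^ 2 * value Z - q ^ 3 * value Z) * value Z)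
        / den F gq X (value Z) gz i ⟨ den#0 F gq X (value Z) gz i ⟩

      e●○-term : ∀ i s t →
        leapt i s t ≈ selects (oneMove i leap) s t * X[_] Z 2 s t
      e●○-term i = one-term Z {i} {leap} (λ ()) (scaled-at (scalar●○ i) (λ ()) i)
        (λ c → trans (quotient _ _ (both-reach i))
          (polynomial-identity J.e●○-scalar J.e●○-normal ≡.refl (q ∷ value Z ∷ x i ∷ reach Z i * reach′ Z i ∷ [])))
        {v = λ k c → siteValue Z k c * dress k i c leap}
        (λ k → diagonal-unless (k ≟ i) λ k≢i → diagonal-⊙ (d-diagonal k) (d●○-diagonal k i k≢i))
        (λ k k≢i c → refl)

      module _ {i j : Fin N} (i≢j : i ≢ j) where

        jointReciprocal : Carrier → Joint → Carrier
        jointReciprocal n coefficient = n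
        jointReciprocal n 1/Q         = 1/q
        jointReciprocal n 1/Δ         = δ i j
        jointReciprocal n 1/K         = κ i j
        jointReciprocal n 1/K′        = κ j i

        by-joint : ∀ (D : PolyExpr 4) (D#0 : ⟦ D ⟧ₚ (q ∷ value Z ∷ x i ∷ x j ∷ []) # 0#) e f →
          Fractions.equal sameJoint (J.denominator D) e f ≡ true →
          ⟦ e ⟧ (q ∷ value Z ∷ x i ∷ x j ∷ []) (jointReciprocal (proj₁ (#⇒invertible D#0))) ≈
          ⟦ f ⟧ (q ∷ value Z ∷ x i ∷ x j ∷ []) (jointReciprocal (proj₁ (#⇒invertible D#0)))
        by-joint D D#0 = FractionSound.equal-sound commutativeRing sameJoint (J.denominator D)
          (q ∷ value Z ∷ x i ∷ x j ∷ []) (jointReciprocal (proj₁ (#⇒invertible D#0))) λ where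
            coefficient → reciprocal D#0
            1/Q         → q-inverse
            1/Δ         → δ-inverse i≢j
            1/K         → κ-inverse i≢j
            1/K′        → κ-inverse (≢-sym i≢j)

      selects-cong : ∀ {ε η : Fin N → Move} → (∀ k → ε k ≡ η k) → ∀ s t → selects ε s t ≈ selects η s t
      selects-cong ε≡η s t = product-cong {N} λ k → reflexive (≡.cong (λ m → bit (sameMove m _)) (ε≡η k))

      -- A raises the sites i and j by the arrows u and v, with the coefficient of the
      -- closed form.
      RaisesTwo : Decoration → Decoration → (i j : Fin N) → Op N → Set _
      RaisesTwo u v i j A = ∃ λ a →
        (∀ s t → A s t ≈ a * selects (twoMoves i (raise u) j (raise v)) s t) ×
        (∀ c c′ → a ≈ prefactor (value Z) 2 * (weightAt Z i c (raise u) * weightAt Z j c′ (raise v) *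
                                       joint (value Z) i j (raise u) (raise v)))

      raises-two : ∀ {u v i j A n} →
        (∀ s t → A s t ≈ n * (scalar u i * scalar v j * selects (twoMoves i (raise u) j (raise v)) s t)) →
        n * prefactor (value Z) 2 ≈ joint (value Z) i j (raise u) (raise v) → RaisesTwo u v i j A
      raises-two {u} {v} {i} {j} {A} {n} A≈ n≈ = n * (scalar u i * scalar v j) ,
        (λ s t → trans (A≈ s t) (sym (*-assoc _ _ _))) ,
        λ c c′ → trans (*-congˡ (*-cong (scalar≈ u i c) (scalar≈ v j c′)))
          (trans (polynomial-identity Shuffle.lhs Shuffle.rhs ≡.refl
                   (n ∷ prefactor (value Z) 2 ∷ weightAt Z i c (raise u) ∷ weightAt Z j c′ (raise v) ∷ []))
                 (*-congˡ (*-congˡ n≈)))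

      eᵘᵛ-raises : ∀ u v {i j} (i≢j : i ≢ j) → RaisesTwo u v i j (eᵘᵛ F gq X (value Z) gz u v i j i≢j)
      eᵘᵛ-raises ○ ○ {i} {j} i≢j = raises-two
        (λ s t → *-congˡ (scaled-at₂ (scalar ○ i) (scalar ○ j) (λ ()) (λ ()) i≢j s t))
        (by-joint i≢j J.denominator○○ _ (J.weighted J.numerator○○) (J.joint (raise ○) (raise ○)) ≡.refl)
      eᵘᵛ-raises ● ○ {i} {j} i≢j = raises-two
        (λ s t → *-congˡ (scaled-at₂ (scalar ● i) (scalar ○ j) (λ ()) (λ ()) i≢j s t))
        (by-joint i≢j J.denominator●○ _ (J.weighted J.numerator●○) (J.joint (raise ●) (raise ○)) ≡.refl)
      eᵘᵛ-raises ○ ● {i} {j} i≢j = raises-two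
        (λ s t → *-congˡ (trans (scaled-at₂ (scalar ● j) (scalar ○ i) (λ ()) (λ ()) (≢-sym i≢j) s t)
          (*-cong (*-comm _ _) (selects-cong (twoMoves-comm (raise ○) (raise ●) i≢j) s t))))
        (by-joint i≢j J.denominator○● _ (J.weighted J.numerator○●) (J.joint (raise ○) (raise ●)) ≡.refl)
      eᵘᵛ-raises ● ● {i} {j} i≢j = raises-two
        (λ s t → *-congˡ (scaled-at₂ (scalar ● i) (scalar ● j) (λ ()) (λ ()) i≢j s t))
        (by-joint i≢j J.denominator●● _ (J.weighted J.numerator●●) (J.joint (raise ●) (raise ●)) ≡.refl)

      eᵘᵛ-term : ∀ u v {i j} (i<j : i Fin.< j) s t → raised₂ u v i j i<j s t ≈
        selects (twoMoves i (raise u) j (raise v)) s t * X[_] Z 2 s t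
      eᵘᵛ-term u v {i} {j} i<j = two-term Z i<j {raise u} {raise v} (λ ()) (λ ())
        {eᵘᵛ F gq X (value Z) gz u v i j (<⇒≢ i<j)}
        (proj₁ (proj₂ (eᵘᵛ-raises u v (<⇒≢ i<j)))) (proj₂ (proj₂ (eᵘᵛ-raises u v (<⇒≢ i<j))))
        {v = λ k c → siteValue Z k c * dress k i c (raise u) * dress k j c (raise v)}
        (λ k → diagonal-unless (k ≟ i) λ k≢i → diagonal-unless (k ≟ j) λ k≢j →
          diagonal-⊙ (diagonal-⊙ (d-diagonal k) (dᵘ-diagonal k i k≢i u)) (dᵘ-diagonal k j k≢j v))
        (λ k k≢i k≢j c → *-assoc _ _ _)

      ∑∑-terms : ∀ u v s t → pairs u v s t ≈ doubles s t (raise u) (raise v) * X[_] Z 2 s t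
      ∑∑-terms u v s t = trans (∑ᴼ-entry {N} {N} (λ i → ∑ᴼ λ j → sumIf (i <? j) (raised₂ u v i j)) s t) (trans
        (Σ.sum-cong-≋ {N} λ i → trans (∑ᴼ-entry {N} {N} (λ j → sumIf (i <? j) (raised₂ u v i j)) s t) (trans
          (Σ.sum-cong-≋ {N} λ j → trans (sumIf-entry (i <? j) {raised₂ u v i j} λ i<j → eᵘᵛ-term u v i<j s t)
            (pull (does (i <? j))))
          (sym (Σ.*-distribʳ-sum {N} _ _))))
        (sym (Σ.*-distribʳ-sum {N} _ _)))
        where
        pull : ∀ b {y w} → choose b (y * w) 0# ≈ choose b y 0# * w
        pull true  = refl
        pull false = sym (zeroˡ _)

      Γ₂-entry : ∀ s t → Γ₂ F gq X (value Z) gz s t ≈ E 2 s t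
      Γ₂-entry s t = begin
        Γ₂ F gq X (value Z) gz s t
          ≈⟨ Γ₂-terms s t ⟩
        ∑ᴼ leapt s t + ((pairs ○ ○ s t + pairs ○ ● s t) + (pairs ● ○ s t + pairs ● ● s t))
          ≈⟨ +-cong (∑-terms {leap} {2} {leapt} s t λ i → e●○-term i s t)
               (+-cong (+-cong (∑∑-terms ○ ○ s t) (∑∑-terms ○ ● s t))
                       (+-cong (∑∑-terms ● ○ s t) (∑∑-terms ● ● s t))) ⟩
        _ ≈⟨ +-congˡ (trans (+-cong (sym (distribʳ _ _ _)) (sym (distribʳ _ _ _))) (sym (distribʳ _ _ _))) ⟩
        _ ≈⟨ distribʳ _ _ _ ⟨
        _ ≈⟨ *-congʳ (count-two s t) ⟩
        bit (totalArrows t s ℕ.≡ᵇ 2) * X[_] Z 2 s t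
          ≈⟨ bit-when (totalArrows t s ℕ.≡ᵇ 2) _ ⟩
        E 2 s t ∎

      Γ-entry : ∀ k s t → Γ F gq k X (value Z) gz s t ≈ E (toℕ k) s t
      Γ-entry 0F = Γ₀-entry
      Γ-entry 1F = Γ₁-entry
      Γ-entry 2F = Γ₂-entry

-- The vertex weights

module Crossing {c ℓ₁ ℓ₂} (F : HeytingField c ℓ₁ ℓ₂) (q x y : HeytingField.Carrier F) where
  open FieldNotation F
  open ClosedForm F using (quotient; inverse-*)

  module _ (x#q²y : x # q ^ 2 * y) (x#q³y : x # q ^ 3 * y) {1/q 1/[1+q] u v : Carrier}
           (u-inverse : u * (x - q ^ 2 * y) ≈ 1#) (v-inverse : v * (x - q ^ 3 * y) ≈ 1#) where

    open LocalWeights (CommutativeRing.rawRing commutativeRing) q 1/q 1/[1+q] using (crossing)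

    -- The weight has the form used above, and vanishes unless i + j = k + l.
    crossing-weight : ∀ i j k l → Weights.weight F q x y x#q²y x#q³y i j k l ≈ crossing x y u v i j k l ×
      (crossing x y u v i j k l ≈ 0# ⊎ toℕ i ℕ.+ toℕ j ≡ toℕ k ℕ.+ toℕ l)
    crossing-weight 0F 0F 0F 0F = refl , inj₂ ≡.refl
    crossing-weight 0F 0F 0F (suc _) = refl , inj₁ refl
    crossing-weight 0F 0F 1F _ = refl , inj₁ refl
    crossing-weight 0F 0F 2F _ = refl , inj₁ refl
    crossing-weight 0F 1F 0F 1F = quotient _ _ u-inverse , inj₂ ≡.refl
    crossing-weight 0F 1F 0F 0F = refl , inj₁ refl
    crossing-weight 0F 1F 0F (suc (suc _)) = refl , inj₁ refl
    crossing-weight 0F 1F 1F 0F = quotient _ _ u-inverse , inj₂ ≡.refl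
    crossing-weight 0F 1F 1F (suc _) = refl , inj₁ refl
    crossing-weight 0F 1F 2F _ = refl , inj₁ refl
    crossing-weight 0F 2F 0F 2F = quotient _ _ (inverse-* u-inverse v-inverse) , inj₂ ≡.refl
    crossing-weight 0F 2F 0F 0F = refl , inj₁ refl
    crossing-weight 0F 2F 0F 1F = refl , inj₁ refl
    crossing-weight 0F 2F 1F 1F = quotient _ _ (inverse-* u-inverse v-inverse) , inj₂ ≡.refl
    crossing-weight 0F 2F 1F 0F = refl , inj₁ refl
    crossing-weight 0F 2F 1F (suc (suc _)) = refl , inj₁ refl
    crossing-weight 0F 2F 2F 0F = quotient _ _ (inverse-* u-inverse v-inverse) , inj₂ ≡.refl
    crossing-weight 0F 2F 2F (suc _) = refl , inj₁ refl
    crossing-weight 1F 0F 0F 1F = quotient _ _ u-inverse , inj₂ ≡.refl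
    crossing-weight 1F 0F 0F 0F = refl , inj₁ refl
    crossing-weight 1F 0F 0F (suc (suc _)) = refl , inj₁ refl
    crossing-weight 1F 0F 1F 0F = quotient _ _ u-inverse , inj₂ ≡.refl
    crossing-weight 1F 0F 1F (suc _) = refl , inj₁ refl
    crossing-weight 1F 0F 2F _ = refl , inj₁ refl
    crossing-weight 1F 1F 0F 2F = quotient _ _ (inverse-* u-inverse v-inverse) , inj₂ ≡.refl
    crossing-weight 1F 1F 0F 0F = refl , inj₁ refl
    crossing-weight 1F 1F 0F 1F = refl , inj₁ refl
    crossing-weight 1F 1F 1F 1F = quotient _ _ (inverse-* u-inverse v-inverse) , inj₂ ≡.refl
    crossing-weight 1F 1F 1F 0F = refl , inj₁ refl
    crossing-weight 1F 1F 1F (suc (suc _)) = refl , inj₁ refl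
    crossing-weight 1F 1F 2F 0F = quotient _ _ (inverse-* u-inverse v-inverse) , inj₂ ≡.refl
    crossing-weight 1F 1F 2F (suc _) = refl , inj₁ refl
    crossing-weight 1F 2F 0F _ = refl , inj₁ refl
    crossing-weight 1F 2F 1F 2F = quotient _ _ u-inverse , inj₂ ≡.refl
    crossing-weight 1F 2F 1F 0F = refl , inj₁ refl
    crossing-weight 1F 2F 1F 1F = refl , inj₁ refl
    crossing-weight 1F 2F 2F 1F = quotient _ _ u-inverse , inj₂ ≡.refl
    crossing-weight 1F 2F 2F 0F = refl , inj₁ refl
    crossing-weight 1F 2F 2F (suc (suc _)) = refl , inj₁ refl
    crossing-weight 2F 0F 0F 2F = quotient _ _ (inverse-* u-inverse v-inverse) , inj₂ ≡.refl
    crossing-weight 2F 0F 0F 0F = refl , inj₁ refl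
    crossing-weight 2F 0F 0F 1F = refl , inj₁ refl
    crossing-weight 2F 0F 1F 1F = quotient _ _ (inverse-* u-inverse v-inverse) , inj₂ ≡.refl
    crossing-weight 2F 0F 1F 0F = refl , inj₁ refl
    crossing-weight 2F 0F 1F (suc (suc _)) = refl , inj₁ refl
    crossing-weight 2F 0F 2F 0F = quotient _ _ (inverse-* u-inverse v-inverse) , inj₂ ≡.refl
    crossing-weight 2F 0F 2F (suc _) = refl , inj₁ refl
    crossing-weight 2F 1F 0F _ = refl , inj₁ refl
    crossing-weight 2F 1F 1F 2F = quotient _ _ u-inverse , inj₂ ≡.refl
    crossing-weight 2F 1F 1F 0F = refl , inj₁ refl
    crossing-weight 2F 1F 1F 1F = refl , inj₁ refl
    crossing-weight 2F 1F 2F 1F = quotient _ _ u-inverse , inj₂ ≡.refl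
    crossing-weight 2F 1F 2F 0F = refl , inj₁ refl
    crossing-weight 2F 1F 2F (suc (suc _)) = refl , inj₁ refl
    crossing-weight 2F 2F 0F _ = refl , inj₁ refl
    crossing-weight 2F 2F 1F _ = refl , inj₁ refl
    crossing-weight 2F 2F 2F 2F = refl , inj₂ ≡.refl
    crossing-weight 2F 2F 2F 0F = refl , inj₁ refl
    crossing-weight 2F 2F 2F 1F = refl , inj₁ refl

-- Permutations of the sites

module Permutations {c ℓ₁ ℓ₂} (F : HeytingField c ℓ₁ ℓ₂) where
  open FieldNotation F
  open Operators F
  open OperatorEntries F
  open PairProducts F
  open ClosedForm F
  open ProductElements F
  open SiteIdentities commutativeRing
  open Collapse F using (when; when-cong)
  private
    module R = CommutativeRing commutativeRing
    module Π = Sums R.*-commutativeMonoid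
    module ℕΣ = Sums ℕ.+-0-commutativeMonoid
    raw = R.rawRing
  open Semantics commutativeRing
  open FractionSound commutativeRing using (polynomial-identity)
  open import Relation.Binary.Reasoning.Setoid R.setoid

  private
    tri : ∀ m n → m ≢ n →
          ((m ℕ.<ᵇ n) ≡ true × (n ℕ.<ᵇ m) ≡ false) ⊎ ((m ℕ.<ᵇ n) ≡ false × (n ℕ.<ᵇ m) ≡ true)
    tri zero    zero    m≢n = contradiction ≡.refl m≢n
    tri zero    (suc n) m≢n = inj₁ (≡.refl , ≡.refl)
    tri (suc m) zero    m≢n = inj₂ (≡.refl , ≡.refl)
    tri (suc m) (suc n) m≢n = tri m n λ m≡n → m≢n (≡.cong suc m≡n)

    irrefl : ∀ m → (m ℕ.<ᵇ m) ≡ false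
    irrefl zero    = ≡.refl
    irrefl (suc m) = irrefl m

  -- After reindexing by the inverse τ of σ the product is over the pairs with
  -- τ i < τ j. It is split according to whether i < j or j < i; in the second
  -- part i and j are exchanged, and both parts are merged again.
  pairProduct-permute : ∀ {n} (σ : Permutation′ n) (u : Fin n → Fin n → Carrier) →
    (∀ i j → i ≢ j → u i j ≈ u j i) → pairProduct (λ i j → u (σ ⟨$⟩ʳ i) (σ ⟨$⟩ʳ j)) ≈ pairProduct u
  pairProduct-permute {n} σ u u-sym = begin
    product (λ i → product λ j → guard (i ≺ j) (u (σ ⟨$⟩ʳ i) (σ ⟨$⟩ʳ j)))
      ≈⟨ product-cong {n} (λ i → product-cong {n} λ j → reflexive
           (≡.cong₂ (λ a b → guard (a ≺ b) (u (σ ⟨$⟩ʳ i) (σ ⟨$⟩ʳ j))) (≡.sym (inverseˡ σ)) (≡.sym (inverseˡ σ)))) ⟩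
    product (λ i → product λ j → V (σ ⟨$⟩ʳ i) (σ ⟨$⟩ʳ j))
      ≈⟨ product-cong {n} (λ i → Π.sum-permute (V (σ ⟨$⟩ʳ i)) σ) ⟨
    product (λ i → product (V (σ ⟨$⟩ʳ i)))
      ≈⟨ Π.sum-permute (λ i → product (V i)) σ ⟨
    product (λ i → product (V i))
      ≈⟨ product-cong {n} (λ i → trans (product-cong {n} λ j → split i j) (product-* {n} _ _)) ⟩
    product (λ i → product (λ j → guard (i ≺ j ∧ τ i ≺ τ j) (u i j)) *
                   product (λ j → guard (j ≺ i ∧ τ i ≺ τ j) (u i j)))
      ≈⟨ product-* {n} _ _ ⟩
    product (λ i → product (λ j → guard (i ≺ j ∧ τ i ≺ τ j) (u i j))) *
    product (λ i → product (λ j → guard (j ≺ i ∧ τ i ≺ τ j) (u i j)))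
      ≈⟨ *-congˡ (Π.∑-comm {n} {n} _) ⟩
    product (λ i → product (λ j → guard (i ≺ j ∧ τ i ≺ τ j) (u i j))) *
    product (λ j → product (λ i → guard (j ≺ i ∧ τ i ≺ τ j) (u i j)))
      ≈⟨ product-* {n} _ _ ⟨
    product (λ i → product (λ j → guard (i ≺ j ∧ τ i ≺ τ j) (u i j)) *
                   product (λ j → guard (i ≺ j ∧ τ j ≺ τ i) (u j i)))
      ≈⟨ product-cong {n} (λ i → trans (sym (product-* {n} _ _)) (product-cong {n} λ j → merge i j)) ⟩
    product (λ i → product (λ j → guard (i ≺ j) (u i j))) ∎
    where
    _≺_ : Fin n → Fin n → Bool
    i ≺ j = toℕ i ℕ.<ᵇ toℕ j
    τ : Fin n → Fin n
    τ i = σ ⟨$⟩ˡ i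
    guard : Bool → Carrier → Carrier
    guard b y = choose b y 1#
    V : Fin n → Fin n → Carrier
    V i j = guard (τ i ≺ τ j) (u i j)
    τ-injective : ∀ {i j} → i ≢ j → toℕ (τ i) ≢ toℕ (τ j)
    τ-injective i≢j eq = i≢j
      (≡.trans (≡.sym (inverseʳ σ)) (≡.trans (≡.cong (σ ⟨$⟩ʳ_) (Fin.toℕ-injective eq)) (inverseʳ σ)))
    split : ∀ i j → V i j ≈ guard (i ≺ j ∧ τ i ≺ τ j) (u i j) * guard (j ≺ i ∧ τ i ≺ τ j) (u i j)
    split i j with i ≟ j
    ... | yes ≡.refl rewrite irrefl (toℕ i) | irrefl (toℕ (τ i)) = sym (*-identityˡ _)
    ... | no i≢j with tri (toℕ i) (toℕ j) (λ eq → i≢j (Fin.toℕ-injective eq))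
    ...   | inj₁ (a , b) rewrite a | b = sym (*-identityʳ _)
    ...   | inj₂ (a , b) rewrite a | b = sym (*-identityˡ _)
    merge : ∀ i j → guard (i ≺ j ∧ τ i ≺ τ j) (u i j) * guard (i ≺ j ∧ τ j ≺ τ i) (u j i) ≈ guard (i ≺ j) (u i j)
    merge i j with i ≟ j
    ... | yes ≡.refl rewrite irrefl (toℕ i) = *-identityˡ _
    ... | no i≢j with i ≺ j
    ...   | false = *-identityˡ _
    ...   | true  with tri (toℕ (τ i)) (toℕ (τ j)) (τ-injective i≢j)
    ...     | inj₁ (a , b) rewrite a | b = *-identityʳ _
    ...     | inj₂ (a , b) rewrite a | b = trans (*-identityˡ _) (sym (u-sym i j i≢j))

  totalArrows-sum : ∀ {N} (t s : State N) → totalArrows t s ≡ ℕΣ.sum (λ k → arrows (move (lookup t k) (lookup s k)))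
  totalArrows-sum []      []      = ≡.refl
  totalArrows-sum (a ∷ t) (b ∷ s) = ≡.cong (arrows (move a b) ℕ.+_) (totalArrows-sum t s)

  lookup-permute : ∀ {N} (σ : Permutation′ N) (s : State N) k → lookup (permuteState σ s) k ≡ lookup s (σ ⟨$⟩ʳ k)
  lookup-permute σ s k = Vec.lookup∘tabulate (λ k → lookup s (σ ⟨$⟩ʳ k)) k

  totalArrows-permute : ∀ {N} (σ : Permutation′ N) (t s : State N) →
    totalArrows (permuteState σ t) (permuteState σ s) ≡ totalArrows t s
  totalArrows-permute {N} σ t s = ≡.trans (totalArrows-sum (permuteState σ t) (permuteState σ s)) (≡.trans
    (ℕΣ.sum-cong-≗ {N} λ k → ≡.cong₂ (λ a b → arrows (move a b)) (lookup-permute σ t k) (lookup-permute σ s k))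
    (≡.trans (≡.sym (ℕΣ.sum-permute (λ k → arrows (move (lookup t k) (lookup s k))) σ)) (≡.sym (totalArrows-sum t s))))

  permuteReciprocals : ∀ {q N} {x : Fin N → Carrier} (σ : Permutation′ N) → Reciprocals q x →
                       Reciprocals q (λ i → x (σ ⟨$⟩ʳ i))
  permuteReciprocals σ inverses = record
    { 1/q = 1/q ; 1/[1+q] = 1/[1+q]
    ; δ = λ i j → δ (σ ⟨$⟩ʳ i) (σ ⟨$⟩ʳ j) ; κ = λ i j → κ (σ ⟨$⟩ʳ i) (σ ⟨$⟩ʳ j)
    ; q-inverse = q-inverse ; 1+q-inverse = 1+q-inverse
    ; δ-inverse = λ i≢j → δ-inverse (⟨$⟩ʳ-≢ σ i≢j) ; κ-inverse = λ i≢j → κ-inverse (⟨$⟩ʳ-≢ σ i≢j)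
    }
    where open Reciprocals inverses

  module _ {q : Carrier} {N : ℕ} {x : Fin N → Carrier} (inverses : Reciprocals q x) (σ : Permutation′ N) where

    open Reciprocals inverses
    open LocalWeights raw q 1/q 1/[1+q] hiding (_-_)
    open Spectral

    inversesσ = permuteReciprocals σ inverses

    spectralσ : Spectral (Fin N) → Spectral (Fin N)
    spectralσ Z = record
      { value = value Z ; reach = λ i → reach Z (σ ⟨$⟩ʳ i) ; reach′ = λ i → reach′ Z (σ ⟨$⟩ʳ i) }

    private
      module E = Entries inverses
      module Eσ = Entries inversesσ

    -- The joint weight does not distinguish the two sites; the dressings are products
    -- over ordered pairs. Hence no factor depends on the order of the sites.
    joint-sym : ∀ z {k l} → k ≢ l → ∀ m m′ → E.joint z k l m m′ ≈ E.joint z l k m′ m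
    joint-sym z {k} {l} k≢l = go
      where
      module P = LocalWeights (expressions 8 ⊥) (var 0F) (var 1F) :1
      there back : (u v : Decoration) → PolyExpr 8
      there u v = P.jointWeight (var 2F) (var 3F) (var 4F) (var 5F) (var 6F) (var 7F) (raise u) (raise v)
      back  u v = P.jointWeight (var 2F) (var 4F) (var 3F) (:- var 5F) (var 7F) (var 6F) (raise v) (raise u)
      ρ : Vec Carrier 8
      ρ = q ∷ 1/q ∷ z ∷ x k ∷ x l ∷ δ k l ∷ κ k l ∷ κ l k ∷ []
      -δ : - δ k l ≈ δ l k
      -δ = E.δ-antisym k≢l
      go : ∀ m m′ → E.joint z k l m m′ ≈ E.joint z l k m′ m
      go stay      stay      = refl
      go stay      (raise _) = refl
      go stay      leap      = refl
      go stay      down      = refl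
      go (raise _) stay      = refl
      go leap      stay      = refl
      go down      stay      = refl
      go (raise ○) (raise ○) = polynomial-identity (there ○ ○) (back ○ ○) ≡.refl ρ
      go (raise ●) (raise ○) = trans (polynomial-identity (there ● ○) (back ● ○) ≡.refl ρ)
        (*-congˡ (*-congˡ (-‿cong -δ)))
      go (raise ○) (raise ●) = trans (polynomial-identity (there ○ ●) (back ○ ●) ≡.refl ρ)
        (*-congˡ (*-congˡ -δ))
      go (raise ●) (raise ●) = polynomial-identity (there ● ●) (back ● ●) ≡.refl ρ
      go (raise ○) leap      = refl
      go (raise ○) down      = refl
      go (raise ●) leap      = refl
      go (raise ●) down      = refl
      go leap      (raise ○) = refl
      go leap      (raise ●) = refl
      go leap      leap      = refl
      go leap      down      = refl
      go down      (raise ○) = refl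
      go down      (raise ●) = refl
      go down      leap      = refl
      go down      down      = refl

    factored-permute : ∀ Z (μ : Fin N → Move) t →
      Eσ.factored (spectralσ Z) (λ k → μ (σ ⟨$⟩ʳ k)) (permuteState σ t) ≈ E.factored Z μ t
    factored-permute Z μ t = *-cong
      (trans (product-cong {N} λ k → reflexive
               (≡.cong (λ c → E.weightAt Z (σ ⟨$⟩ʳ k) c (μ (σ ⟨$⟩ʳ k))) (lookup-permute σ t k)))
             (sym (Π.sum-permute (λ k → E.weightAt Z k (lookup t k) (μ k)) σ)))
      (*-cong
        (trans (product-cong {N} λ k → trans (product-cong {N} λ l → halves k l)
                 (sym (Π.sum-permute (λ l → E.half (σ ⟨$⟩ʳ k) l (lookup t (σ ⟨$⟩ʳ k)) (μ (σ ⟨$⟩ʳ k)) (μ l)) σ)))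
               (sym (Π.sum-permute (λ k → product λ l → E.half k l (lookup t k) (μ k) (μ l)) σ)))
        (trans (pairProduct-cong {N} λ k l _ → joints k l (μ (σ ⟨$⟩ʳ k)) (μ (σ ⟨$⟩ʳ l)))
               (pairProduct-permute σ (λ k l → E.joint (value Z) k l (μ k) (μ l))
                 λ k l k≢l → joint-sym (value Z) k≢l (μ k) (μ l))))
      where
      halves : ∀ k l → Eσ.half k l (lookup (permuteState σ t) k) (μ (σ ⟨$⟩ʳ k)) (μ (σ ⟨$⟩ʳ l)) ≈
        E.half (σ ⟨$⟩ʳ k) (σ ⟨$⟩ʳ l) (lookup t (σ ⟨$⟩ʳ k)) (μ (σ ⟨$⟩ʳ k)) (μ (σ ⟨$⟩ʳ l))
      halves k l rewrite lookup-permute σ t k with μ (σ ⟨$⟩ʳ k)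
      ... | stay    = refl
      ... | raise _ = refl
      ... | leap    = refl
      ... | down    = refl
      joints : ∀ k l m m′ → Eσ.joint (value Z) k l m m′ ≈ E.joint (value Z) (σ ⟨$⟩ʳ k) (σ ⟨$⟩ʳ l) m m′
      joints k l stay      m′        = refl
      joints k l (raise _) stay      = refl
      joints k l (raise _) (raise _) = refl
      joints k l (raise _) leap      = refl
      joints k l (raise _) down      = refl
      joints k l leap      stay      = refl
      joints k l leap      (raise _) = refl
      joints k l leap      leap      = refl
      joints k l leap      down      = refl
      joints k l down      stay      = refl
      joints k l down      (raise _) = refl
      joints k l down      leap      = refl
      joints k l down      down      = refl

    element-permute : ∀ Z k s t →
      element inversesσ (spectralσ Z) k (permuteState σ s) (permuteState σ t) ≈ element inverses Z k s t
    element-permute Z k s t = trans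
      (reflexive (≡.cong (λ n → when (n ℕ.≡ᵇ k) (prefactor (value Z) k * permuted)) (totalArrows-permute σ t s)))
      (when-cong (totalArrows t s ℕ.≡ᵇ k) (*-congˡ (begin
        _ ≈⟨ Eσ.strength-factored (spectralσ Z) (permuteState σ s) (permuteState σ t) ⟩
        _ ≈⟨ Eσ.factored-cong (spectralσ Z) {Eσ.μ[_,_] (spectralσ Z) (permuteState σ t) (permuteState σ s)}
               {λ k → E.μ[_,_] Z t s (σ ⟨$⟩ʳ k)}
               (λ k → ≡.cong₂ move (lookup-permute σ t k) (lookup-permute σ s k)) (permuteState σ t) ⟩
        _ ≈⟨ factored-permute Z (E.μ[_,_] Z t s) t ⟩
        _ ≈⟨ E.strength-factored Z s t ⟨
        _ ∎)))
      where
      permuted : Carrier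
      permuted = strength inversesσ (spectralσ Z) (permuteState σ s) (permuteState σ t)

theorem1p9p1 : ∀ {c ℓ₁ ℓ₂} (F : HeytingField c ℓ₁ ℓ₂) →
    let open FieldNotation F
        open Operators F
        open ColumnOperators F
    in
    (q : Carrier) (gq : GenericQ F q) (N : ℕ) → N ≥ 1 →
    (X : Alphabet F q N) →
    ((k : Fin 3) (z : Carrier) (gz : GenericSpectral F X z)
     (σ : Permutation′ N) (i j : State N) →
       Γ gq k (permuteAlphabet F σ X) z (permuteGeneric F σ gz)
         (permuteState σ i) (permuteState σ j)
       ≈ Γ gq k X z gz i j)
    ×
    ((k l : Fin 3) (z y : Carrier)
     (gz : GenericSpectral F X z) (gy : GenericSpectral F X y)
     (y#q²z : y # q ^ 2 * z) (y#q³z : y # q ^ 3 * z) →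
       Γ gq k X z gz ⊙ Γ gq l X y gy
       ≈ᴼ ∑ᴼ {n = 3} (λ i → ∑ᴼ {n = 3} (λ j →
            Weights.weight F q y z y#q²z y#q³z i j k l
              · (Γ gq j X y gy ⊙ Γ gq i X z gz))))
theorem1p9p1 F q gq N _ X =
  (λ k z gz σ s t → trans
    (Γ-entry gq (permuteAlphabet F σ X) (permuteReciprocals σ inverses) (permuteSpectral σ (spectral z gz))
      (permuteLawful σ (lawful z gz)) (permuteGeneric F σ gz) k (permuteState σ s) (permuteState σ t))
    (trans (element-permute inverses σ (spectral z gz) (toℕ k) s t) (sym (entry z gz k s t)))) ,
  λ k l z y gz gy y#q²z y#q³z s t →
    let u-inverse = reciprocal (x#y⇒x-y#0 y#q²z)
        v-inverse = reciprocal (x#y⇒x-y#0 y#q³z)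
        crossings = Crossing.crossing-weight F q y z y#q²z y#q³z {1/q} {1/[1+q]} u-inverse v-inverse
    in begin
    (Γ gq k X z gz ⊙ Γ gq l X y gy) s t
      ≈⟨ products z gz y gy k l s t ⟩
    _ ≈⟨ product-exchange inverses (spectral z gz) (spectral y gy) (lawful z gz) (lawful y gy) _ _ u-inverse v-inverse
           (λ i j k l → proj₂ (crossings i j k l)) k l s t ⟩
    _ ≈⟨ sum₃-cong (λ i → sum₃-cong λ j →
           *-cong (sym (proj₁ (crossings i j k l))) (sym (products y gy z gz j i s t))) ⟩
    _ ∎
  where
  open FieldNotation F
  open Operators F
  open ColumnOperators F
  open ClosedForm F using (reciprocal)
  open ProductElements F using (element; productElement; product-exchange)
  open Permutations F
  open MatrixElements F using (Γ-entry)
  open Collapse F using (sumStates-cong)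
  open SiteIdentities commutativeRing using (Reciprocals; module LetterLaws)
  open GenericQ gq
  open import Relation.Binary.Reasoning.Setoid (CommutativeRing.setoid commutativeRing)

  x : Fin N → Carrier
  x = Alphabet.letter X

  -- 1/f i j off the diagonal; the entries on the diagonal play no role.
  table : {f : Fin N → Fin N → Carrier} → (∀ {i j} → i ≢ j → f i j # 0#) → Fin N → Fin N → Carrier
  table f#0 i j with i ≟ j
  ... | yes _   = 0#
  ... | no  i≢j = proj₁ (#⇒invertible (f#0 i≢j))

  table-inverse : {f : Fin N → Fin N → Carrier} (f#0 : ∀ {i j} → i ≢ j → f i j # 0#) →
                  ∀ {i j} → i ≢ j → table {f} f#0 i j * f i j ≈ 1#
  table-inverse f#0 {i} {j} i≢j with i ≟ j
  ... | yes i≡j = contradiction i≡j i≢j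
  ... | no  i≢j = reciprocal (f#0 i≢j)

  differences : ∀ {i j} → i ≢ j → x i - x j # 0#
  differences i≢j = x#y⇒x-y#0 (Alphabet.distinct X i≢j)

  q-differences : ∀ {i j} → i ≢ j → x i - q * x j # 0#
  q-differences i≢j = x#y⇒x-y#0 (Alphabet.q-distinct X i≢j)

  inverses : Reciprocals q x
  inverses = record
    { 1/q         = proj₁ (#⇒invertible q#0)
    ; 1/[1+q]     = proj₁ (#⇒invertible 1+q#0)
    ; δ           = table {λ i j → x i - x j} differences
    ; κ           = table {λ i j → x i - q * x j} q-differences
    ; q-inverse   = reciprocal q#0
    ; 1+q-inverse = reciprocal 1+q#0
    ; δ-inverse   = table-inverse {λ i j → x i - x j} differences
    ; κ-inverse   = table-inverse {λ i j → x i - q * x j} q-differences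
    }

  open Reciprocals inverses using (1/q; 1/[1+q])
  open LocalWeights (CommutativeRing.rawRing commutativeRing) q 1/q 1/[1+q] using (Spectral; ∑₃)
  open LetterLaws inverses using (Lawful)

  spectral : ∀ z → GenericSpectral F X z → Spectral (Fin N)
  spectral z gz = record
    { value  = z
    ; reach  = λ i → proj₁ (#⇒invertible (x#y⇒x-y#0 (GenericSpectral.x#q²z gz i)))
    ; reach′ = λ i → proj₁ (#⇒invertible (x#y⇒x-y#0 (GenericSpectral.x#q³z gz i)))
    }

  lawful : ∀ z gz → Lawful (spectral z gz)
  lawful z gz = record
    { reach-inverse  = λ i → reciprocal (x#y⇒x-y#0 (GenericSpectral.x#q²z gz i))
    ; reach′-inverse = λ i → reciprocal (x#y⇒x-y#0 (GenericSpectral.x#q³z gz i))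
    }

  permuteSpectral : Permutation′ N → Spectral (Fin N) → Spectral (Fin N)
  permuteSpectral σ = spectralσ inverses σ

  permuteLawful : ∀ σ {Z} → Lawful Z → LetterLaws.Lawful (permuteReciprocals σ inverses) (permuteSpectral σ Z)
  permuteLawful σ Z-lawful = record
    { reach-inverse  = λ i → Lawful.reach-inverse Z-lawful (σ ⟨$⟩ʳ i)
    ; reach′-inverse = λ i → Lawful.reach′-inverse Z-lawful (σ ⟨$⟩ʳ i)
    }

  entry : ∀ z gz k s t → Γ gq k X z gz s t ≈ element inverses (spectral z gz) (toℕ k) s t
  entry z gz = Γ-entry gq X inverses (spectral z gz) (lawful z gz) gz

  products : ∀ z gz y gy k l s t → (Γ gq k X z gz ⊙ Γ gq l X y gy) s t ≈
    productElement inverses (spectral z gz) (spectral y gy) (toℕ k) (toℕ l) s t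
  products z gz y gy k l s t = sumStates-cong {N} λ r → *-cong (entry z gz k s r) (entry y gy l r t)

  sum₃-cong : {f g : Fin 3 → Carrier} → (∀ i → f i ≈ g i) → ∑₃ f ≈ ∑₃ g
  sum₃-cong f≈g = +-cong (f≈g 0F) (+-cong (f≈g 1F) (+-cong (f≈g 2F) refl))
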